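{- Let $\mathbf{d}=(d_1,\dots,d_n)$ be a graphical sequence and let $s=\sum_{i=1}^n d_i$ (so every realization has $m=s/2$ edges). Then $\mathbf{d}$ is TC-realizable if and only if one of the following holds: (1) $s=4(n-1)-4$ (i.e. $m=2n-4$), $d_1<n-1$, and $d_n\ge 2$; or (2) $s\ge 4(n-1)-2$ (i.e. $m\ge 2n-3$), and either (a) $n\le 2$, or (b) $n>2$, $d_{n-1}\ge 2$ and $d_n\ge 1$.
   Context: A degree sequence is a non-increasing sequence $d_1\ge\dots\ge d_n$ of non-negative integers; it is graphical if some simple graph on vertices $v_1,\dots,v_n$ has $\deg(v_i)=d_i$ for all $i$ (such a graph is a realization). A temporal graph is a pair $(G,\lambda)$ where $G=(V,E)$ is an undirected graph and $\lambda$ assigns to each edge a non-empty set of positive integer time labels. $\lambda$ is simple if every edge receives exactly one label, and proper if any two distinct edges sharing an endpoint receive no common label. A temporal path is a path $e_1,\dots,e_k$ in $G$ together with labels $t_i\in\lambda(e_i)$ that are non-decreasing (under proper labelings they are automatically strictly increasing). $(G,\lambda)$ is temporally connected if for every ordered pair of vertices $(u,v)$ there is a temporal path from $u$ to $v$. A graphical sequence $\mathbf{d}$ is TC-realizable if there is a realization $G$ of $\mathbf{d}$ (a simple graph) and a simple proper labeling $\lambda$ such that $(G,\lambda)$ is temporally connected. -}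

module Defs where

open import Data.Nat using (ℕ; zero; suc; _+_; _*_; _∸_; _≤_; _<_)
open import Data.Fin using (Fin; zero; suc; fromℕ<; inject₁; fromℕ)
  renaming (_≤_ to _≤ᶠ_)
open import Data.Bool using (Bool; true; false; if_then_else_)
open import Data.List using (List; map; allFin)
open import Data.Nat.ListAction using (sum)
open import Data.Product using (Σ; ∃; _×_; _,_)
open import Relation.Nullary using (¬_; yes; no)
open import Relation.Binary.PropositionalEquality using (_≡_)
open import Function.Definitions using (Injective)

-- Sequences d = (d_1,…,d_n) are functions Fin n → ℕ (0-based indices).

infixl 9 _at_
_at_ : ∀ {n} → (Fin n → ℕ) → ℕ → ℕ
_at_ {n} d i with suc i ≤? n
  where open import Data.Nat using (_≤?_)
... | yes p = d (fromℕ< p)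
... | no _  = 0

seqSum : ∀ {n} → (Fin n → ℕ) → ℕ
seqSum {n} d = sum (map d (allFin n))

NonIncreasing : ∀ {n} → (Fin n → ℕ) → Set
NonIncreasing {n} d = ∀ (i j : Fin n) → i ≤ᶠ j → d j ≤ d i

record Graph (n : ℕ) : Set where
  field
    adj     : Fin n → Fin n → Bool
    sym     : ∀ u v → adj u v ≡ adj v u
    irrefl  : ∀ u → adj u u ≡ false
open Graph public

degree : ∀ {n} → Graph n → Fin n → ℕ
degree {n} G u = sum (map (λ v → if adj G u v then 1 else 0) (allFin n))

Realizes : ∀ {n} → Graph n → (Fin n → ℕ) → Set
Realizes G d = ∀ i → degree G i ≡ d i

Graphical : ∀ {n} → (Fin n → ℕ) → Set
Graphical {n} d = Σ (Graph n) λ G → Realizes G d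

-- Simple labelings: each edge {u,v} gets exactly one positive label
-- lab u v (values on non-edges are irrelevant).

Labeling : ℕ → Set
Labeling n = Fin n → Fin n → ℕ

IsSimpleLabeling : ∀ {n} → Graph n → Labeling n → Set
IsSimpleLabeling G lab =
  (∀ u v → adj G u v ≡ true → lab u v ≡ lab v u) ×
  (∀ u v → adj G u v ≡ true → 1 ≤ lab u v)

IsProper : ∀ {n} → Graph n → Labeling n → Set
IsProper G lab = ∀ u v w → adj G u v ≡ true → adj G u w ≡ true →
  ¬ (v ≡ w) → ¬ (lab u v ≡ lab u w)

record TemporalPath {n} (G : Graph n) (lab : Labeling n) (x y : Fin n) : Set where
  field
    k       : ℕ
    p       : Fin (suc k) → Fin n
    start   : p zero ≡ x
    end     : p (fromℕ k) ≡ y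
    distinct : Injective _≡_ _≡_ p
    edges   : ∀ (i : Fin k) → adj G (p (inject₁ i)) (p (suc i)) ≡ true
    monotone : ∀ (i j : Fin k) → i ≤ᶠ j →
      lab (p (inject₁ i)) (p (suc i)) ≤ lab (p (inject₁ j)) (p (suc j))

TemporallyConnected : ∀ {n} → Graph n → Labeling n → Set
TemporallyConnected {n} G lab = ∀ (x y : Fin n) → TemporalPath G lab x y

TCRealizable : ∀ {n} → (Fin n → ℕ) → Set
TCRealizable {n} d = Σ (Graph n) λ G → Realizes G d ×
  Σ (Labeling n) λ lab → IsSimpleLabeling G lab × IsProper G lab ×
    TemporallyConnected G lab

{-# OPTIONS --safe #-}
-- Sufficiency. Choose a small core (a vertex, an edge or a four-cycle), collect everything into it
-- along one tree, let the core exchange, and broadcast along a second tree sharing no edge with the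
-- first. Such plans survive three operations: adding a vertex of degree ≥ 2, hanging a leaf on a
-- one-vertex core, and subdividing a tree edge by a vertex that is joined to a third vertex.
-- Havel–Hakimi removes vertices as long as the number of edges permits; what remains are the tight
-- sequences of minimum degree 3, which inverse subdivisions reduce to K₄, K₃₃ and the cube.
--
-- Necessity. Order the edges by label and read them as telephone calls. The bound m ≥ 2n − 4 is the
-- gossip theorem, in the proof of Baker and Shostak: somebody who hears his own information can be
-- removed together with two calls; otherwise, with at most 2n − 5 calls, all first and last calls
-- are mutual, and what remains after deleting them has at least five components, of which only three
-- can matter to a vertex of remaining degree one although all calls are useful to it. A leaf, or a
-- vertex adjacent to all others, forces two forests of calls that give m ≥ 2n − 3.
module Submission where

open import Defs hiding (sym)
open import Data.Nat using (ℕ; zero; suc; _+_; _*_; _∸_; _≤_; _<_; z≤n; s≤s; _≤?_; _<?_)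
import Data.Nat as ℕ
open import Data.Nat.Properties hiding (_≟_)
open import Data.Nat.Tactic.RingSolver using (solve-∀)
open import Data.Nat.ListAction using () renaming (sum to sumˡ)
open import Data.Fin using (Fin; zero; suc; punchIn; punchOut; toℕ; inject₁; fromℕ; fromℕ<; combine) renaming (_≤_ to _≤ᶠ_)
open import Data.Fin.Properties using (_≟_; any?; all?; ¬∀⟶∃¬; punchInᵢ≢i; punchIn-punchOut; punchOut-punchIn; punchOut-cong; combine-injectiveˡ; combine-injectiveʳ; toℕ<n; toℕ-injective; toℕ-fromℕ<) renaming (suc-injective to sucᶠ-injective)
open import Data.Fin.Permutation using (Permutation′; _⟨$⟩ʳ_; _⟨$⟩ˡ_; transpose; inverseʳ; inverseˡ; flip)
open import Data.Bool using (Bool; true; false; if_then_else_; _∧_; _∨_; _xor_; not)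
import Data.Bool as Bool
open import Data.Bool.Properties using (∨-comm; ∧-comm; ∧-zeroʳ; ∨-identityʳ)
open import Data.Unit using (⊤; tt)
open import Data.Empty using (⊥)
open import Data.Product using (Σ; ∃; ∃₂; _×_; _,_; proj₁; proj₂)
import Data.Product as Product
open import Data.Sum using (_⊎_; inj₁; inj₂; [_,_]′)
import Data.Sum as Sum
open import Data.Vec using (Vec; []; _∷_; lookup)
open import Data.List using (List; []; _∷_; _++_; length; map; allFin; tabulate)
open import Data.List.Properties using (map-tabulate; map-∘; length-map; length-++; ++-assoc; ++-identityʳ; ∷-injective)
open import Data.List.Membership.Propositional using (_∈_)
open import Data.List.Membership.Propositional.Properties using (∈-map⁺; ∈-++⁺ˡ; ∈-++⁺ʳ)
import Data.List.Membership.DecPropositional as DecMembership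
open import Data.List.Relation.Unary.Any using (here; there)
open import Data.List.Relation.Unary.All using (All; []; _∷_)
import Data.List.Relation.Unary.All as All
open import Data.List.Relation.Unary.All.Properties using (¬Any⇒All¬) renaming (++⁻ʳ to all-++⁻ʳ; ++⁺ to all-++⁺; map⁺ to all-map⁺)
open import Data.List.Relation.Unary.AllPairs using (AllPairs; []; _∷_)
open import Data.List.Relation.Unary.Unique.Propositional using (Unique)
open import Data.List.Relation.Binary.Permutation.Propositional using (_↭_; ↭-sym) renaming (refl to ↭-refl; prep to ↭-prep; swap to ↭-swap; trans to ↭-trans)
open import Data.List.Relation.Binary.Permutation.Propositional.Properties using (∈-resp-↭; All-resp-↭)
open import Data.List.Relation.Unary.Sorted.TotalOrder.Properties using (Sorted⇒AllPairs)
import Data.List.Sort as Sort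
open import Relation.Nullary using (¬_; Dec; yes; no; does; contradiction)
open import Relation.Nullary.Decidable using (True; toWitness; map′; _×-dec_; _⊎-dec_; _→-dec_; ¬?; dec-true; dec-false)
open import Relation.Binary using (tri<; tri≈; tri>)
open import Relation.Binary.Bundles using (DecTotalOrder)
import Relation.Binary.Construct.On as On
open import Relation.Binary.PropositionalEquality using (_≡_; _≢_; refl; sym; trans; cong; cong₂; subst; subst₂; module ≡-Reasoning)
open import Function using (_∘_; id; case_of_)
open import Function.Bundles using (_⇔_; mk⇔)
import Algebra.Properties.CommutativeMonoid.Sum +-0-commutativeMonoid as MonoidSum

-- The cores explain the thresholds: two disjoint trees outside the core together with the edges of
-- the core make 2(n-1), 2(n-2)+1 or 2(n-4)+4 edges, that is `∑ d + q ≡ 4 * n` with q = 4, 6, 8. If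
-- moreover all degrees are 3, this equation says n = q, whence the bases on 4, 6 and 8 vertices. A
-- leaf has one edge for both directions. It therefore has to enter the core, and its neighbour has
-- to be the whole core before that. Havel-Hakimi gives the leaf a neighbour of largest degree, so
-- the induction for m ≥ 2n - 2 carries a prescribed root whose degree is largest up to one. Plans
-- ignore positivity and properness of labels: their walks increase strictly, so equal labels can be
-- separated afterwards. In the lower bounds the usefulness of a call depends on what precedes and
-- what follows it; hence all counting runs over the splits `p ++ e ∷ q` of the list of calls.

≡-≤-trans : ∀ {a b c} → a ≡ b → b ≤ c → a ≤ c
≡-≤-trans refl le = le

≤-≡-trans : ∀ {a b c} → a ≤ b → b ≡ c → a ≤ c
≤-≡-trans le refl = le

-- A Farkas-style certificate: x ≤ y yields p ≤ q as soon as p + y + k = q + x.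
linear : ∀ {x y p q} k → x ≤ y → (p + y) + k ≡ q + x → p ≤ q
linear {x} {y} {p} {q} k x≤y eq = +-cancelʳ-≤ y p q
  (≤-trans (m≤m+n (p + y) k) (≡-≤-trans eq (+-monoʳ-≤ q x≤y)))

infixl 6 _⊕_
_⊕_ : ∀ {a b c d} → a ≤ b → c ≤ d → a + c ≤ b + d
_⊕_ = +-mono-≤

⟦_⟧ : Bool → ℕ
⟦ b ⟧ = if b then 1 else 0

⟦⟧≤1 : ∀ b → ⟦ b ⟧ ≤ 1
⟦⟧≤1 true  = ≤-refl
⟦⟧≤1 false = z≤n

infix 4 _==_
_==_ : ∀ {n} → Fin n → Fin n → Bool
u == v = does (u ≟ v)

==-refl : ∀ {n} (u : Fin n) → (u == u) ≡ true
==-refl u = dec-true (u ≟ u) refl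

==-≢ : ∀ {n} {u v : Fin n} → u ≢ v → (u == v) ≡ false
==-≢ {u = u} {v} ne = dec-false (u ≟ v) ne

==-sym : ∀ {n} (u v : Fin n) → (u == v) ≡ (v == u)
==-sym u v with u ≟ v
... | yes refl = sym (==-refl u)
... | no ne    = sym (==-≢ (ne ∘ sym))

not-both : ∀ {b} → b ≡ true → b ≡ false → ⊥
not-both refl ()

true⇒⟦⟧ : ∀ {b} → b ≡ true → ⟦ b ⟧ ≡ 1
true⇒⟦⟧ refl = refl

-- Finite sums and counting

∑ : ∀ {n} → (Fin n → ℕ) → ℕ
∑ {zero}  f = 0
∑ {suc n} f = f zero + ∑ (f ∘ suc)

infix 8 #_
#_ : ∀ {n} → (Fin n → Bool) → ℕ
# S = ∑ (λ v → ⟦ S v ⟧)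

∑≡sum : ∀ {n} (f : Fin n → ℕ) → ∑ f ≡ MonoidSum.sum f
∑≡sum {zero}  f = refl
∑≡sum {suc n} f = cong (f zero +_) (∑≡sum (f ∘ suc))

∑-cong : ∀ {n} {f g : Fin n → ℕ} → (∀ i → f i ≡ g i) → ∑ f ≡ ∑ g
∑-cong {zero}  eq = refl
∑-cong {suc n} eq = cong₂ _+_ (eq zero) (∑-cong (eq ∘ suc))

∑-distrib-+ : ∀ {n} (f g : Fin n → ℕ) → ∑ (λ i → f i + g i) ≡ ∑ f + ∑ g
∑-distrib-+ f g = trans (∑≡sum (λ i → f i + g i)) (trans (MonoidSum.∑-distrib-+ f g) (sym (cong₂ _+_ (∑≡sum f) (∑≡sum g))))

∑-permute : ∀ {n} (f : Fin n → ℕ) (π : Permutation′ n) → ∑ f ≡ ∑ (λ i → f (π ⟨$⟩ʳ i))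
∑-permute f π = trans (∑≡sum f) (trans (MonoidSum.sum-permute f π) (sym (∑≡sum (λ i → f (π ⟨$⟩ʳ i)))))

∑-mono : ∀ {n} {f g : Fin n → ℕ} → (∀ i → f i ≤ g i) → ∑ f ≤ ∑ g
∑-mono {zero}  le = z≤n
∑-mono {suc n} le = le zero ⊕ ∑-mono (le ∘ suc)

∑-const : ∀ n k → ∑ {n} (λ _ → k) ≡ n * k
∑-const zero    k = refl
∑-const (suc n) k = cong (k +_) (∑-const n k)

∑-zero : ∀ n → ∑ {n} (λ _ → 0) ≡ 0
∑-zero n = trans (∑-const n 0) (*-zeroʳ n)

∑-*ʳ : ∀ {n} (f : Fin n → ℕ) k → ∑ (λ u → f u * k) ≡ ∑ f * k
∑-*ʳ {zero}  f k = refl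
∑-*ʳ {suc n} f k = trans (cong (f zero * k +_) (∑-*ʳ (f ∘ suc) k)) (sym (*-distribʳ-+ k (f zero) _))

∑-pick : ∀ {n} (a : Fin n) (f : Fin n → ℕ) → ∑ (λ u → ⟦ a == u ⟧ * f u) ≡ f a
∑-pick {suc n} zero    f = trans (cong₂ _+_ (+-identityʳ (f zero)) (∑-zero n)) (+-identityʳ (f zero))
∑-pick {suc n} (suc a) f = ∑-pick a (f ∘ suc)

∑-δ : ∀ {n} (a : Fin n) → ∑ (λ u → ⟦ a == u ⟧) ≡ 1
∑-δ a = trans (∑-cong (λ u → sym (*-identityʳ ⟦ a == u ⟧))) (∑-pick a (λ _ → 1))

∑-shift : ∀ {n} k (f : Fin n → ℕ) → ∑ (λ u → k + f u) ≡ n * k + ∑ f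
∑-shift {n} k f = trans (∑-distrib-+ (λ _ → k) f) (cong (_+ ∑ f) (∑-const n k))

∑-bump : ∀ {n} (a : Fin n) k (f : Fin n → ℕ) → ∑ (λ u → f u + ⟦ a == u ⟧ * k) ≡ ∑ f + k
∑-bump a k f = trans (∑-distrib-+ f (λ u → ⟦ a == u ⟧ * k)) (cong (∑ f +_) (∑-pick a (λ _ → k)))

∑-mark : ∀ {n} (a : Fin n) (f : Fin n → ℕ) → ∑ (λ u → ⟦ a == u ⟧ + f u) ≡ suc (∑ f)
∑-mark a f = trans (∑-distrib-+ (λ u → ⟦ a == u ⟧) f) (cong (_+ ∑ f) (∑-δ a))

∑-marks : ∀ {n} (a b : Fin n) → ∑ (λ u → ⟦ a == u ⟧ + ⟦ b == u ⟧) ≡ 2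
∑-marks a b = trans (∑-mark a _) (cong suc (∑-δ b))

∑-term≤ : ∀ {n} (f : Fin n → ℕ) a → f a ≤ ∑ f
∑-term≤ {suc n} f zero    = m≤m+n _ _
∑-term≤ {suc n} f (suc a) = ≤-trans (∑-term≤ (f ∘ suc) a) (m≤n+m _ (f zero))

∑-<-witness : ∀ {n} (f g : Fin n → ℕ) → ∑ f < ∑ g → ∃ λ i → f i < g i
∑-<-witness f g lt with any? (λ i → f i <? g i)
... | yes w = w
... | no ¬w = contradiction (∑-mono (λ i → ≮⇒≥ (λ p → ¬w (i , p)))) (<⇒≱ lt)

sum-allFin : ∀ {n} (f : Fin n → ℕ) → sumˡ (map f (allFin n)) ≡ ∑ f
sum-allFin f = trans (cong sumˡ (map-tabulate id f)) (go f)
  where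
  go : ∀ {n} (f : Fin n → ℕ) → sumˡ (tabulate f) ≡ ∑ f
  go {zero}  f = refl
  go {suc n} f = cong (f zero +_) (go (f ∘ suc))

argmax : ∀ {n} (f : Fin (suc n) → ℕ) → ∃ λ i → ∀ j → f j ≤ f i
argmax {zero}  f = zero , λ { zero → ≤-refl }
argmax {suc n} f with argmax (f ∘ suc)
... | i , best with f zero ≤? f (suc i)
...   | yes le = suc i , λ { zero → le ; (suc j) → best j }
...   | no ¬le = zero , λ { zero → ≤-refl ; (suc j) → ≤-trans (best j) (<⇒≤ (≰⇒> ¬le)) }

-- Graphs, degrees and the switching of single edges

deg : ∀ {n} → Graph n → Fin n → ℕ
deg G u = # adj G u

degree≡deg : ∀ {n} (G : Graph n) u → degree G u ≡ deg G u
degree≡deg {n} G u = sum-allFin {n} _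

adj-≢ : ∀ {n} (G : Graph n) {u v} → adj G u v ≡ true → u ≢ v
adj-≢ G e refl = not-both e (irrefl G _)

adj-flip : ∀ {n} (G : Graph n) {u v b} → adj G u v ≡ b → adj G v u ≡ b
adj-flip G {u} {v} e = trans (Graph.sym G v u) e

deg< : ∀ {n} (G : Graph n) u → deg G u < n
deg< {n} G u = ≤-trans (+-monoˡ-≤ (deg G u) (≤-reflexive (sym (∑-δ u))))
  (≡-≤-trans (sym (∑-distrib-+ (λ v → ⟦ u == v ⟧) _))
  (≤-≡-trans (∑-mono bound) (trans (∑-const n 1) (*-identityʳ n))))
  where
  bound : ∀ v → ⟦ u == v ⟧ + ⟦ adj G u v ⟧ ≤ 1
  bound v with u ≟ v
  ... | yes refl rewrite irrefl G u = ≤-refl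
  ... | no _ = ⟦⟧≤1 (adj G u v)

relabel : ∀ {n} → Permutation′ n → Graph n → Graph n
relabel π G = record
  { adj    = λ u v → adj G (π ⟨$⟩ʳ u) (π ⟨$⟩ʳ v)
  ; sym    = λ u v → Graph.sym G _ _
  ; irrefl = λ u → irrefl G _ }

deg-relabel : ∀ {n} (π : Permutation′ n) (G : Graph n) u → deg (relabel π G) u ≡ deg G (π ⟨$⟩ʳ u)
deg-relabel π G u = sym (∑-permute (λ v → ⟦ adj G (π ⟨$⟩ʳ u) v ⟧) π)

behead : ∀ {n} → Graph (suc n) → Graph n
behead G = record
  { adj    = λ u v → adj G (suc u) (suc v)
  ; sym    = λ u v → Graph.sym G _ _
  ; irrefl = λ u → irrefl G _ }

deg-suc : ∀ {n} (G : Graph (suc n)) u → deg G (suc u) ≡ ⟦ adj G zero (suc u) ⟧ + deg (behead G) u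
deg-suc G u = cong (λ b → ⟦ b ⟧ + deg (behead G) u) (Graph.sym G (suc u) zero)

deg-zero : ∀ {n} (G : Graph (suc n)) → deg G zero ≡ ∑ (λ u → ⟦ adj G zero (suc u) ⟧)
deg-zero G rewrite irrefl G zero = refl

∑-deg-suc : ∀ {n} (G : Graph (suc n)) → ∑ (deg G) ≡ deg G zero + deg G zero + ∑ (deg (behead G))
∑-deg-suc G = trans (cong (deg G zero +_) (trans (∑-cong (deg-suc G))
    (trans (∑-distrib-+ (λ u → ⟦ adj G zero (suc u) ⟧) (deg (behead G)))
           (cong (_+ ∑ (deg (behead G))) (sym (deg-zero G))))))
  (sym (+-assoc (deg G zero) (deg G zero) _))

handshake : ∀ {n} (G : Graph n) → ∃ λ m → ∑ (deg G) ≡ m + m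
handshake {zero}  G = 0 , refl
handshake {suc n} G with handshake (behead G)
... | m , eq = deg G zero + m , trans (∑-deg-suc G)
      (trans (cong (deg G zero + deg G zero +_) eq) (shuffle (deg G zero) m))
  where
  shuffle : ∀ a m → a + a + (m + m) ≡ a + m + (a + m)
  shuffle = solve-∀

private
  toggled? : ∀ {n} (a b u v : Fin n) → Dec ((a ≡ u × b ≡ v) ⊎ (b ≡ u × a ≡ v))
  toggled? a b u v = ((a ≟ u) ×-dec (b ≟ v)) ⊎-dec ((b ≟ u) ×-dec (a ≟ v))

  toggled : ∀ {n} → Fin n → Fin n → Fin n → Fin n → Bool
  toggled a b u v = does (toggled? a b u v)

  toggled-sym : ∀ {n} (a b u v : Fin n) → toggled a b u v ≡ toggled a b v u
  toggled-sym a b u v = trans (∨-comm ((a == u) ∧ (b == v)) _)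
    (cong₂ _∨_ (∧-comm (b == u) (a == v)) (∧-comm (a == u) (b == v)))

setEdge : ∀ {n} → Graph n → (a b : Fin n) → a ≢ b → Bool → Graph n
setEdge G a b a≢b on = record
  { adj    = λ u v → if toggled a b u v then on else adj G u v
  ; sym    = λ u v → cong₂ (λ t e → if t then on else e) (toggled-sym a b u v) (Graph.sym G u v)
  ; irrefl = irr }
  where
  irr : ∀ u → (if toggled a b u u then on else adj G u u) ≡ false
  irr u with a ≟ u | b ≟ u
  ... | yes refl | yes refl = contradiction refl a≢b
  ... | yes refl | no _     = irrefl G u
  ... | no _     | yes refl = irrefl G u
  ... | no _     | no _     = irrefl G u

setEdge-other : ∀ {n} (G : Graph n) {a b} (ne : a ≢ b) on {u v} →
  ¬ (a ≡ u × b ≡ v) → ¬ (b ≡ u × a ≡ v) → adj (setEdge G a b ne on) u v ≡ adj G u v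
setEdge-other G {a} {b} ne on {u} {v} n₁ n₂ =
  cong (if_then on else adj G u v) (dec-false (toggled? a b u v) [ n₁ , n₂ ]′)

setEdge-row : ∀ {n} (G : Graph n) {a b} (ne : a ≢ b) on v →
  adj (setEdge G a b ne on) a v ≡ (if b == v then on else adj G a v)
setEdge-row G {a} {b} ne on v rewrite ==-refl a | ==-≢ (ne ∘ sym) with b == v
... | true  = refl
... | false = refl

setEdge-comm : ∀ {n} (G : Graph n) {a b} (ne : a ≢ b) on u v →
  adj (setEdge G a b ne on) u v ≡ adj (setEdge G b a (ne ∘ sym) on) u v
setEdge-comm G {a} {b} ne on u v = cong (λ t → if t then on else adj G u v) (∨-comm ((a == u) ∧ (b == v)) _)

setEdge-deg-end : ∀ {n} (G : Graph n) {a b} (ne : a ≢ b) on →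
  deg (setEdge G a b ne on) a + ⟦ adj G a b ⟧ ≡ deg G a + ⟦ on ⟧
setEdge-deg-end G {a} {b} ne on = begin
    deg G′ a + ⟦ adj G a b ⟧ ≡⟨ cong (deg G′ a +_) (∑-pick b (λ v → ⟦ adj G a v ⟧)) ⟨
    deg G′ a + ∑ (λ v → ⟦ b == v ⟧ * ⟦ adj G a v ⟧) ≡⟨ ∑-distrib-+ (λ v → ⟦ adj G′ a v ⟧) _ ⟨
    ∑ (λ v → ⟦ adj G′ a v ⟧ + ⟦ b == v ⟧ * ⟦ adj G a v ⟧) ≡⟨ ∑-cong (λ v → mix (b == v) (setEdge-row G ne on v)) ⟩
    ∑ (λ v → ⟦ adj G a v ⟧ + ⟦ b == v ⟧ * ⟦ on ⟧) ≡⟨ ∑-distrib-+ (λ v → ⟦ adj G a v ⟧) _ ⟩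
    deg G a + ∑ (λ v → ⟦ b == v ⟧ * ⟦ on ⟧) ≡⟨ cong (deg G a +_) (∑-pick b (λ _ → ⟦ on ⟧)) ⟩
    deg G a + ⟦ on ⟧ ∎
  where
  open ≡-Reasoning
  G′ = setEdge G a b ne on
  swap : ∀ x y → x + (y + 0) ≡ y + (x + 0)
  swap = solve-∀
  mix : ∀ t {x x′} → x′ ≡ (if t then on else x) → ⟦ x′ ⟧ + ⟦ t ⟧ * ⟦ x ⟧ ≡ ⟦ x ⟧ + ⟦ t ⟧ * ⟦ on ⟧
  mix true  {x} refl = swap ⟦ on ⟧ ⟦ x ⟧
  mix false     refl = refl

-- The additive form covers insertion, deletion and no change at once, without truncated
-- subtraction.
setEdge-deg : ∀ {n} (G : Graph n) {a b} (ne : a ≢ b) on u →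
  deg (setEdge G a b ne on) u + ⟦ adj G a b ⟧ * (⟦ a == u ⟧ + ⟦ b == u ⟧)
    ≡ deg G u + ⟦ on ⟧ * (⟦ a == u ⟧ + ⟦ b == u ⟧)
setEdge-deg G {a} {b} ne on u = by (a ≟ u) (b ≟ u)
  where
  one : ∀ {x y p q t} → x + p ≡ y + q → t ≡ 1 → x + p * t ≡ y + q * t
  one {x} {y} {p} {q} eq refl = trans (cong (x +_) (*-identityʳ p)) (trans eq (cong (y +_) (sym (*-identityʳ q))))
  by : Dec (a ≡ u) → Dec (b ≡ u) → deg (setEdge G a b ne on) u + ⟦ adj G a b ⟧ * (⟦ a == u ⟧ + ⟦ b == u ⟧)
    ≡ deg G u + ⟦ on ⟧ * (⟦ a == u ⟧ + ⟦ b == u ⟧)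
  by (yes refl) _ = one {p = ⟦ adj G a b ⟧} {q = ⟦ on ⟧} (setEdge-deg-end G ne on)
    (cong₂ (λ s t → ⟦ s ⟧ + ⟦ t ⟧) (==-refl a) (==-≢ (ne ∘ sym)))
  by (no _) (yes refl) = one {p = ⟦ adj G a b ⟧} {q = ⟦ on ⟧}
    (trans (cong₂ _+_ (∑-cong (λ v → cong ⟦_⟧ (setEdge-comm G ne on b v))) (cong ⟦_⟧ (Graph.sym G a b)))
           (setEdge-deg-end G (ne ∘ sym) on))
    (cong₂ (λ s t → ⟦ s ⟧ + ⟦ t ⟧) (==-≢ ne) (==-refl b))
  by (no a≢u) (no b≢u) rewrite ==-≢ a≢u | ==-≢ b≢u | *-zeroʳ ⟦ adj G a b ⟧ | *-zeroʳ ⟦ on ⟧ = refl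

-- Plans

infixr 5 _◂_
_◂_ : ∀ {A : Set} {n} → A → (Fin n → A) → Fin (suc n) → A
(a ◂ f) zero    = a
(a ◂ f) (suc i) = f i

-- Two steps are enough for every core: in the four-cycle the two perfect matchings carry different
-- labels, and opposite vertices exchange over one edge of each.
data Hub {n} (G : Graph n) (lab : Labeling n) (M N : ℕ) (u : Fin n) : Fin n → Set where
  here : Hub G lab M N u u
  edge : ∀ {w} → adj G u w ≡ true → M ≤ lab u w → lab u w ≤ N → Hub G lab M N u w
  via  : ∀ {z w} → adj G u z ≡ true → adj G z w ≡ true →
         M ≤ lab u z → lab u z < lab z w → lab z w ≤ N → Hub G lab M N u w

-- The values `E` and `D` replace explicit trees: `E` increases strictly along the chosen edges and
-- is bounded by `M`, so following them ends in the core; `D` decreases likewise towards `N`.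
Early Late : ∀ {n} → Graph n → Labeling n → (Fin n → ℕ) → Fin n → Set
Early G lab E v = ∃ λ a → adj G v a ≡ true × lab v a ≡ E v × E v < E a
Late  G lab D v = ∃ λ b → adj G v b ≡ true × lab v b ≡ D v × D b < D v

-- Every vertex outside the core has an edge, labelled E, towards the core that is used
-- for gathering, and an edge, labelled D, that is used for broadcasting; in between,
-- during [M , N], the core vertices exchange everything.
record Plan {n} (d : Fin n → ℕ) (core : Fin n → Bool) : Set where
  field
    graph    : Graph n
    realizes : ∀ u → deg graph u ≡ d u
    lab      : Labeling n
    lab-sym  : ∀ u v → lab u v ≡ lab v u
    E D      : Fin n → ℕ
    M N B    : ℕ
    M≤N      : M ≤ N
    E≤M      : ∀ u → E u ≤ M
    N≤D      : ∀ u → N ≤ D u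
    D≤B      : ∀ u → D u ≤ B
    early    : ∀ v → core v ≡ false → Early graph lab E v
    late     : ∀ v → core v ≡ false → Late graph lab D v
    hub      : ∀ u w → core u ≡ true → core w ≡ true → Hub graph lab M N u w

  -- This is how the two trees are known to share no edge: every label used for gathering lies below
  -- every label used for broadcasting.
  E<D : ∀ {u v w} → E u < E v → E u < D w
  E<D {u} {v} {w} lt = <-≤-trans lt (≤-trans (E≤M v) (≤-trans M≤N (N≤D w)))

-- Time reversal exchanges gathering and broadcasting, so only gathering edges need to be subdivided
-- by hand. The bound `B` is there because `B ∸_` reverses the order only up to `B`.
reverse-plan : ∀ {n} {d : Fin n → ℕ} {core} → Plan d core → Plan d core
reverse-plan {n} P = record
  { graph = graph ; realizes = realizes
  ; lab = λ u v → B ∸ lab u v ; lab-sym = λ u v → cong (B ∸_) (lab-sym u v)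
  ; E = λ u → B ∸ D u ; D = λ u → B ∸ E u ; M = B ∸ N ; N = B ∸ M ; B = B
  ; M≤N = ∸-monoʳ-≤ B M≤N
  ; E≤M = λ u → ∸-monoʳ-≤ B (N≤D u) ; N≤D = λ u → ∸-monoʳ-≤ B (E≤M u) ; D≤B = λ u → m∸n≤m B (E u)
  ; early = λ v nc → let (b , e , l , lt) = late v nc in b , e , cong (B ∸_) l , ∸-monoʳ-< lt (D≤B v)
  ; late = λ v nc → let (a , e , l , lt) = early v nc in
      a , e , cong (B ∸_) l , ∸-monoʳ-< lt (≤-trans (E≤M a) (≤-trans M≤N (≤-trans (N≤D a) (D≤B a))))
  ; hub = λ u w cu cw → back (≤-trans (N≤D u) (D≤B u)) (hub w u cw cu) }
  where
  open Plan P
  lab′ = λ u v → B ∸ lab u v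
  lower : ∀ {u v l} → l ≤ lab u v → lab′ v u ≤ B ∸ l
  lower {u} {v} le = ∸-monoʳ-≤ B (≤-≡-trans le (lab-sym u v))
  upper : ∀ {u v l} → lab u v ≤ l → B ∸ l ≤ lab′ v u
  upper {u} {v} le = ∸-monoʳ-≤ B (≡-≤-trans (lab-sym v u) le)
  back : ∀ {u w} → N ≤ B → Hub graph lab M N w u → Hub graph lab′ (B ∸ N) (B ∸ M) u w
  back _ here = here
  back {u} {w} _ (edge e lo hi) = edge (adj-flip graph e) (upper hi) (lower lo)
  back {u} {w} N≤B (via {z} e₁ e₂ lo lt hi) = via (adj-flip graph e₂) (adj-flip graph e₁) (upper hi)
    (subst₂ (λ p q → B ∸ p < B ∸ q) (lab-sym z u) (lab-sym w z) (∸-monoʳ-< lt (≤-trans hi N≤B))) (lower lo)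

plan-cong : ∀ {n} {d d′ : Fin n → ℕ} {core} → (∀ u → d u ≡ d′ u) → Plan d core → Plan d′ core
plan-cong eq P = record { Plan P ; realizes = λ u → trans (Plan.realizes P u) (eq u) }

permute-plan : ∀ {n} {d : Fin n → ℕ} {core} (π : Permutation′ n) →
  Plan d core → Plan (λ u → d (π ⟨$⟩ʳ u)) (λ u → core (π ⟨$⟩ʳ u))
permute-plan {n} {d} {core} π P = record
  { graph = relabel π graph ; realizes = λ u → trans (deg-relabel π graph u) (realizes (π ⟨$⟩ʳ u))
  ; lab = λ u v → lab (f u) (f v) ; lab-sym = λ u v → lab-sym (f u) (f v)
  ; E = λ u → E (f u) ; D = λ u → D (f u) ; M = M ; N = N ; B = B
  ; M≤N = M≤N ; E≤M = λ u → E≤M (f u) ; N≤D = λ u → N≤D (f u) ; D≤B = λ u → D≤B (f u)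
  ; early = λ v nc → let (a , r) = early (f v) nc in
      π ⟨$⟩ˡ a , subst (λ a → adj graph (f v) a ≡ true × lab (f v) a ≡ E (f v) × E (f v) < E a) (sym (inverseʳ π)) r
  ; late = λ v nc → let (a , r) = late (f v) nc in
      π ⟨$⟩ˡ a , subst (λ a → adj graph (f v) a ≡ true × lab (f v) a ≡ D (f v) × D a < D (f v)) (sym (inverseʳ π)) r
  ; hub = λ u w cu cw → pull (hub (f u) (f w) cu cw) refl }
  where
  open Plan P
  f = π ⟨$⟩ʳ_
  pull : ∀ {u w fw} → Hub graph lab M N (f u) fw → fw ≡ f w → Hub (relabel π graph) (λ u v → lab (f u) (f v)) M N u w
  pull {u} {w} here eq = subst (Hub _ _ _ _ u) (trans (sym (inverseˡ π)) (trans (cong (π ⟨$⟩ˡ_) eq) (inverseˡ π))) here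
  pull (edge e lo hi) refl = edge e lo hi
  pull {u} {w} (via {z} e₁ e₂ lo lt hi) refl = relay (sym (inverseʳ π)) e₁ e₂ lo lt hi
    where
    relay : ∀ {z z′} → z ≡ f z′ → adj graph (f u) z ≡ true → adj graph z (f w) ≡ true → M ≤ lab (f u) z →
      lab (f u) z < lab z (f w) → lab z (f w) ≤ N → Hub (relabel π graph) (λ u v → lab (f u) (f v)) M N u w
    relay {z′ = z′} refl = via {z = z′}

cone : ∀ {n} → (Fin n → Bool) → Graph n → Graph (suc n)
cone {n} S G = record { adj = a ; sym = s ; irrefl = i }
  where
  a : Fin (suc n) → Fin (suc n) → Bool
  a zero    = false ◂ S
  a (suc u) = S u ◂ adj G u
  s : ∀ u v → a u v ≡ a v u
  s zero    zero    = refl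
  s zero    (suc v) = refl
  s (suc u) zero    = refl
  s (suc u) (suc v) = Graph.sym G u v
  i : ∀ u → a u u ≡ false
  i zero    = refl
  i (suc u) = irrefl G u

cone-labels : ∀ {n} → (Fin n → ℕ) → Labeling n → Labeling (suc n)
cone-labels l lab zero    = 0 ◂ l
cone-labels l lab (suc u) = l u ◂ lab u

cone-labels-sym : ∀ {n} (l : Fin n → ℕ) (lab : Labeling n) → (∀ u v → lab u v ≡ lab v u) →
  ∀ u v → cone-labels l lab u v ≡ cone-labels l lab v u
cone-labels-sym l lab sy zero    zero    = refl
cone-labels-sym l lab sy zero    (suc v) = refl
cone-labels-sym l lab sy (suc u) zero    = refl
cone-labels-sym l lab sy (suc u) (suc v) = sy u v

private
  if-true : ∀ {A : Set} {b} {x y : A} → b ≡ true → (if b then x else y) ≡ x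
  if-true refl = refl
  if-false : ∀ {A : Set} {b} {x y : A} → b ≡ false → (if b then x else y) ≡ y
  if-false refl = refl

-- `H` may lack edges of `G` with labels below `M`: subdividing removes a gathering edge, which the
-- core does not use in its exchange.
lift-hub : ∀ {n} {G H : Graph n} {lab : Labeling n} {M N} {S : Fin n → Bool} {l : Fin n → ℕ} (φ : ℕ → ℕ) →
  (∀ {i j} → i < j → φ i < φ j) → (∀ {u v} → adj G u v ≡ true → M ≤ lab u v → adj H u v ≡ true) →
  ∀ {u w} → Hub G lab M N u w → Hub (cone S H) (cone-labels l (λ u v → φ (lab u v))) (φ M) (φ N) (suc u) (suc w)
lift-hub φ φ-< keep = λ
  { here → here
  ; (edge e lo hi) → edge (keep e lo) (φ-≤ lo) (φ-≤ hi)
  ; (via {z} e₁ e₂ lo lt hi) → via {z = suc z} (keep e₁ lo) (keep e₂ (≤-trans lo (<⇒≤ lt))) (φ-≤ lo) (φ-< lt) (φ-≤ hi) }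
  where
  φ-≤ : ∀ {i j} → i ≤ j → φ i ≤ φ j
  φ-≤ le with m≤n⇒m<n∨m≡n le
  ... | inj₁ lt   = <⇒≤ (φ-< lt)
  ... | inj₂ refl = ≤-refl

extend : ∀ {n} {d : Fin n → ℕ} {core} (S : Fin n → Bool) {x y} → x ≢ y → S x ≡ true → S y ≡ true →
  Plan d core → Plan (# S ◂ (λ u → ⟦ S u ⟧ + d u)) (false ◂ core)
extend {n} {d} {core} S {x} {y} x≢y Sx Sy P = record
  { graph = cone S graph
  ; realizes = λ { zero → refl ; (suc u) → cong (⟦ S u ⟧ +_) (realizes u) }
  ; lab = lab⁺ ; lab-sym = cone-labels-sym l _ (λ u v → cong suc (lab-sym u v))
  ; E = E⁺ ; D = D⁺ ; M = suc M ; N = suc N ; B = 2 + B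
  ; M≤N = s≤s M≤N
  ; E≤M = λ { zero → z≤n ; (suc u) → s≤s (E≤M u) }
  ; N≤D = λ { zero → s≤s (m≤n⇒m≤1+n (≤-trans (N≤D x) (D≤B x))) ; (suc u) → s≤s (N≤D u) }
  ; D≤B = λ { zero → ≤-refl ; (suc u) → s≤s (m≤n⇒m≤1+n (D≤B u)) }
  ; early = early⁺ ; late = late⁺
  ; hub = λ { (suc u) (suc w) cu cw → lift-hub suc s≤s (λ e _ → e) (hub u w cu cw) } }
  where
  open Plan P
  -- Raising the old labels by one frees 0, and `2 + B` exceeds every raised `D`.
  l = λ u → if x == u then 0 else 2 + B
  lab⁺ = cone-labels l (λ u v → suc (lab u v))
  E⁺ = 0 ◂ (λ u → suc (E u))
  D⁺ = 2 + B ◂ (λ u → suc (D u))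
  early⁺ : ∀ v → (false ◂ core) v ≡ false → Early (cone S graph) lab⁺ E⁺ v
  early⁺ zero    _  = suc x , Sx , if-true (==-refl x) , s≤s z≤n
  early⁺ (suc v) nc = let (a , e , eq , lt) = early v nc in suc a , e , cong suc eq , s≤s lt
  late⁺ : ∀ v → (false ◂ core) v ≡ false → Late (cone S graph) lab⁺ D⁺ v
  late⁺ zero    _  = suc y , Sy , if-false (==-≢ x≢y) , s≤s (s≤s (D≤B y))
  late⁺ (suc v) nc = let (a , e , eq , lt) = late v nc in suc a , e , cong suc eq , s≤s lt
  lift : ∀ {u w} → Hub graph lab M N u w → Hub (cone S graph) lab⁺ (suc M) (suc N) (suc u) (suc w)
  lift here = here
  lift (edge e lo hi) = edge e (s≤s lo) (s≤s hi)
  lift (via {z} e₁ e₂ lo lt hi) = via {z = suc z} e₁ e₂ (s≤s lo) (s≤s lt) (s≤s hi)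

-- Outside the core the leaf would need an early and a late edge, but it has only one. So it becomes
-- a core vertex and exchanges with `c` at time `M`.
attach-leaf : ∀ {n} {d : Fin n → ℕ} {core} c → (∀ u → core u ≡ true → u ≡ c) →
  Plan d core → Plan (1 ◂ (λ u → ⟦ c == u ⟧ + d u)) (true ◂ core)
attach-leaf {n} {d} {core} c only P = record
  { graph = cone S graph
  ; realizes = λ { zero → ∑-δ c ; (suc u) → cong (⟦ S u ⟧ +_) (realizes u) }
  ; lab = lab⁺ ; lab-sym = cone-labels-sym l lab lab-sym
  ; E = M ◂ E ; D = N ◂ D ; M = M ; N = N ; B = B
  ; M≤N = M≤N
  ; E≤M = λ { zero → ≤-refl ; (suc u) → E≤M u }
  ; N≤D = λ { zero → ≤-refl ; (suc u) → N≤D u }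
  ; D≤B = λ { zero → ≤-trans (N≤D c) (D≤B c) ; (suc u) → D≤B u }
  ; early = λ { (suc v) nc → let (a , r) = early v nc in suc a , r }
  ; late = λ { (suc v) nc → let (a , r) = late v nc in suc a , r }
  ; hub = hub⁺ }
  where
  open Plan P
  S = λ u → c == u
  l = λ (_ : Fin n) → M
  lab⁺ = cone-labels l lab
  joined : ∀ {u} → core u ≡ true → S u ≡ true
  joined cu rewrite only _ cu = ==-refl c
  hub⁺ : ∀ u w → (true ◂ core) u ≡ true → (true ◂ core) w ≡ true → Hub (cone S graph) lab⁺ M N u w
  hub⁺ zero    zero    _  _  = here
  hub⁺ zero    (suc w) _  cw = edge (joined cw) ≤-refl M≤N
  hub⁺ (suc u) zero    cu _  = edge (joined cu) ≤-refl M≤N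
  hub⁺ (suc u) (suc w) cu cw = lift-hub id id (λ e _ → e) (hub u w cu cw)

private
  double< : ∀ {i j} → i < j → suc (2 * i) < 2 * j
  double< {i} {j} i<j = linear 0 (i<j ⊕ i<j) (eq i j)
    where
    eq : ∀ i j → (2 + 2 * i) + (j + j) + 0 ≡ 2 * j + (suc i + suc i)
    eq = solve-∀

  -- Doubling all labels frees the odd ones. The two halves of the edge from `b` to `a` get
  -- `2 * E b` and its successor, which is still below `2 * E a`; the edge to `c` comes last and
  -- tells the new vertex everything.
  subdivide-early : ∀ {n} {d : Fin n → ℕ} {core} (P : Plan d core) {a b c : Fin n} → let open Plan P in
    core b ≡ false → adj graph b a ≡ true → lab b a ≡ E b → E b < E a → c ≢ a → c ≢ b →
    Plan (3 ◂ (λ u → ⟦ c == u ⟧ + d u)) (false ◂ core)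
  subdivide-early {n} {d} {core} P {a} {b} {c} ncb e lab≡ lt c≢a c≢b = record
    { graph = G⁺
    ; realizes = λ { zero → deg-new ; (suc u) → deg-old u }
    ; lab = lab⁺ ; lab-sym = cone-labels-sym l _ (λ u v → cong (2 *_) (lab-sym u v))
    ; E = E⁺ ; D = D⁺ ; M = 2 * M ; N = 2 * N ; B = suc (2 * B)
    ; M≤N = *-monoʳ-≤ 2 M≤N
    ; E≤M = λ { zero → <⇒≤ (double< (<-≤-trans lt (E≤M a))) ; (suc u) → *-monoʳ-≤ 2 (E≤M u) }
    ; N≤D = λ { zero → m≤n⇒m≤1+n (*-monoʳ-≤ 2 (≤-trans (N≤D a) (D≤B a))) ; (suc u) → *-monoʳ-≤ 2 (N≤D u) }
    ; D≤B = λ { zero → ≤-refl ; (suc u) → m≤n⇒m≤1+n (*-monoʳ-≤ 2 (D≤B u)) }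
    ; early = early⁺ ; late = late⁺
    ; hub = λ { (suc u) (suc w) cu cw → lift-hub (2 *_) (<⇒≤ ∘ double<) (λ e lo → keep e (M<lab lo)) (hub u w cu cw) } }
    where
    open Plan P
    b≢a : b ≢ a
    b≢a = adj-≢ graph e
    H = setEdge graph b a b≢a false
    S = λ u → (b == u) ∨ ((a == u) ∨ (c == u))
    G⁺ = cone S H
    l = λ u → if b == u then 2 * E b else if a == u then suc (2 * E b) else suc (2 * B)
    lab⁺ = cone-labels l (λ u v → 2 * lab u v)
    E⁺ = suc (2 * E b) ◂ (λ u → 2 * E u)
    D⁺ = suc (2 * B) ◂ (λ u → 2 * D u)
    S-split : ∀ u → ⟦ S u ⟧ ≡ ⟦ b == u ⟧ + (⟦ a == u ⟧ + ⟦ c == u ⟧)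
    S-split u with b ≟ u | a ≟ u | c ≟ u
    ... | yes p | yes q | _     = contradiction (trans p (sym q)) b≢a
    ... | yes p | no _  | yes q = contradiction (trans q (sym p)) c≢b
    ... | yes p | no _  | no _  = refl
    ... | no _  | yes p | yes q = contradiction (trans q (sym p)) c≢a
    ... | no _  | yes p | no _  = refl
    ... | no _  | no _  | yes q = refl
    ... | no _  | no _  | no _  = refl
    deg-new : # S ≡ 3
    deg-new = trans (∑-cong S-split) (trans (∑-mark b _) (cong suc (∑-marks a c)))
    deg-old : ∀ u → ⟦ S u ⟧ + deg H u ≡ ⟦ c == u ⟧ + d u
    deg-old u = begin
      ⟦ S u ⟧ + deg H u ≡⟨ cong (_+ deg H u) (S-split u) ⟩
      β + (α + γ) + deg H u ≡⟨ shuffle α β γ (deg H u) ⟩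
      γ + (deg H u + 1 * (β + α)) ≡⟨ cong (λ t → γ + (deg H u + t * (β + α))) (true⇒⟦⟧ e) ⟨
      γ + (deg H u + ⟦ adj graph b a ⟧ * (β + α)) ≡⟨ cong (γ +_) (setEdge-deg graph b≢a false u) ⟩
      γ + (deg graph u + 0) ≡⟨ cong (γ +_) (trans (+-identityʳ _) (realizes u)) ⟩
      γ + d u ∎
      where
      open ≡-Reasoning
      α = ⟦ a == u ⟧
      β = ⟦ b == u ⟧
      γ = ⟦ c == u ⟧
      shuffle : ∀ α β γ t → β + (α + γ) + t ≡ γ + (t + 1 * (β + α))
      shuffle = solve-∀
    -- The only deleted edge has label `E b`, so all edges with larger labels survive, in particular
    -- those for exchange and broadcasting.
    keep : ∀ {u v} → adj graph u v ≡ true → E b < lab u v → adj H u v ≡ true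
    keep {u} {v} e′ lt′ = trans (setEdge-other graph b≢a false
      (λ { (refl , refl) → <-irrefl (sym lab≡) lt′ })
      (λ { (refl , refl) → <-irrefl (trans (sym lab≡) (lab-sym b a)) lt′ })) e′
    M<lab : ∀ {m} → M ≤ m → E b < m
    M<lab le = <-≤-trans lt (≤-trans (E≤M a) le)
    early⁺ : ∀ v → (false ◂ core) v ≡ false → Early G⁺ lab⁺ E⁺ v
    early⁺ zero _ = suc a , Sa , trans (if-false (==-≢ b≢a)) (if-true (==-refl a)) , double< lt
      where
      Sa : S a ≡ true
      Sa rewrite ==-≢ b≢a | ==-refl a = refl
    early⁺ (suc v) nc = by (b ≟ v)
      where
      -- The deleted edge is not the gathering edge of `a` as well, since `E b < E a`.
      other : ∀ v p → lab v p ≡ E v → ¬ (a ≡ v × b ≡ p)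
      other v p eq (refl , refl) = <-irrefl (trans (sym lab≡) (trans (lab-sym b a) eq)) lt
      by : Dec (b ≡ v) → Early G⁺ lab⁺ E⁺ (suc v)
      by (yes refl) = zero , cong (_∨ ((a == b) ∨ (c == b))) (==-refl b) , if-true (==-refl b) , ≤-refl
      by (no b≢v) = let (p , e′ , eq , lt′) = early v nc in
        suc p , trans (setEdge-other graph b≢a false (b≢v ∘ proj₁) (other v p eq)) e′ , cong (2 *_) eq , <⇒≤ (double< lt′)
    late⁺ : ∀ v → (false ◂ core) v ≡ false → Late G⁺ lab⁺ D⁺ v
    late⁺ zero _ = suc c , Sc , trans (if-false (==-≢ (c≢b ∘ sym))) (if-false (==-≢ (c≢a ∘ sym))) , s≤s (*-monoʳ-≤ 2 (D≤B c))
      where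
      Sc : S c ≡ true
      Sc rewrite ==-≢ (c≢b ∘ sym) | ==-≢ (c≢a ∘ sym) = ==-refl c
    late⁺ (suc v) nc = let (p , e′ , eq , lt′) = late v nc in
      suc p , keep e′ (subst (E b <_) (sym eq) (E<D lt)) , cong (2 *_) eq , <⇒≤ (double< lt′)

-- The gathering and the broadcasting edge of b cannot both end in c, so one of them can be subdivided.
subdivide : ∀ {n} {d : Fin n → ℕ} {core} {b c : Fin n} → core b ≡ false → c ≢ b →
  Plan d core → Plan (3 ◂ (λ u → ⟦ c == u ⟧ + d u)) (false ◂ core)
subdivide {b = b} {c} nc c≢b P with Plan.early P b nc
... | a , e , eq , lt with c ≟ a
...   | no c≢a = subdivide-early P nc e eq lt c≢a c≢b
...   | yes refl = let (a′ , e′ , eq′ , lt′) = late b nc in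
  subdivide-early (reverse-plan P) nc e′ (cong (B ∸_) eq′) (∸-monoʳ-< lt′ (D≤B b))
    (λ { refl → <-irrefl (trans (sym eq) eq′) (E<D lt) }) c≢b
  where open Plan P

-- Strictly increasing walks and temporal paths

module _ {n} (G : Graph n) (lab : Labeling n) where

  -- Strict increase is what survives an arbitrary breaking of ties. Vertices may repeat until
  -- `simplify`.
  data Walk (s : ℕ) (x : Fin n) : Fin n → Set where
    stop : Walk s x x
    step : ∀ {z y} → adj G x z ≡ true → s ≤ lab x z → Walk (suc (lab x z)) z y → Walk s x y

module _ {n} {G : Graph n} {lab : Labeling n} where

  weaken : ∀ {s t x y} → s ≤ t → Walk G lab t x y → Walk G lab s x y
  weaken le stop          = stop
  weaken le (step e lo w) = step e (≤-trans le lo) w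

  verts : ∀ {s x y} → Walk G lab s x y → List (Fin n)
  verts {x = x} stop         = x ∷ []
  verts {x = x} (step _ _ w) = x ∷ verts w

  verts-weaken : ∀ {s t x y} (le : s ≤ t) (w : Walk G lab t x y) → verts (weaken le w) ≡ verts w
  verts-weaken le stop         = refl
  verts-weaken le (step _ _ w) = refl

  Simple : ℕ → Fin n → Fin n → Set
  Simple s x y = Σ (Walk G lab s x y) (Unique ∘ verts)

  weaken-simple : ∀ {s t x y} → s ≤ t → Simple t x y → Simple s x y
  weaken-simple le (w , u) = weaken le w , subst Unique (sym (verts-weaken le w)) u

  cut : ∀ {s z x y} (w : Walk G lab s z y) → Unique (verts w) → x ∈ verts w → Simple s x y
  cut stop           u       (here refl) = stop , u
  cut (step e lo w)  u       (here refl) = step e lo w , u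
  cut (step e lo w)  (_ ∷ u) (there m)   = weaken-simple (m≤n⇒m≤1+n lo) (cut w u m)

  -- If `x` recurs, the walk may as well start at that occurrence: departing later than required is
  -- always allowed.
  simplify : ∀ {s x y} → Walk G lab s x y → Simple s x y
  simplify stop = stop , ([] ∷ [])
  simplify {x = x} (step e lo w) with simplify w
  ... | w′ , u with DecMembership._∈?_ _≟_ x (verts w′)
  ...   | yes m = weaken-simple (m≤n⇒m≤1+n lo) (cut w′ u m)
  ...   | no ¬m = step e lo w′ , (¬Any⇒All¬ _ ¬m ∷ u)

  len : ∀ {s x y} → Walk G lab s x y → ℕ
  len stop         = 0
  len (step _ _ w) = suc (len w)

  vert : ∀ {s x y} (w : Walk G lab s x y) → Fin (suc (len w)) → Fin n
  vert {x = x} w            zero    = x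
  vert         (step _ _ w) (suc i) = vert w i

  vert∈ : ∀ {s x y} (w : Walk G lab s x y) i → vert w i ∈ verts w
  vert∈ stop         zero    = here refl
  vert∈ (step _ _ w) zero    = here refl
  vert∈ (step _ _ w) (suc i) = there (vert∈ w i)

  vert-end : ∀ {s x y} (w : Walk G lab s x y) → vert w (fromℕ (len w)) ≡ y
  vert-end stop         = refl
  vert-end (step _ _ w) = vert-end w

  vert-injective : ∀ {s x y} (w : Walk G lab s x y) → Unique (verts w) → ∀ i j → vert w i ≡ vert w j → i ≡ j
  vert-injective w            u       zero    zero    eq = refl
  vert-injective (step _ _ w) (f ∷ u) zero    (suc j) eq = contradiction eq (All.lookup f (vert∈ w j))
  vert-injective (step _ _ w) (f ∷ u) (suc i) zero    eq = contradiction (sym eq) (All.lookup f (vert∈ w i))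
  vert-injective (step _ _ w) (f ∷ u) (suc i) (suc j) eq = cong suc (vert-injective w u i j eq)

  vert-edges : ∀ {s x y} (w : Walk G lab s x y) (i : Fin (len w)) → adj G (vert w (inject₁ i)) (vert w (suc i)) ≡ true
  vert-edges (step e _ w) zero    = e
  vert-edges (step e _ w) (suc i) = vert-edges w i

  vert-labels : ∀ {s x y} (w : Walk G lab s x y) (i : Fin (len w)) → s ≤ lab (vert w (inject₁ i)) (vert w (suc i))
  vert-labels (step e lo w) zero    = lo
  vert-labels (step e lo w) (suc i) = ≤-trans (m≤n⇒m≤1+n lo) (vert-labels w i)

  vert-monotone : ∀ {s x y} (w : Walk G lab s x y) (i j : Fin (len w)) → i ≤ᶠ j →
    lab (vert w (inject₁ i)) (vert w (suc i)) ≤ lab (vert w (inject₁ j)) (vert w (suc j))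
  vert-monotone (step e lo w) zero    zero    _        = ≤-refl
  vert-monotone (step e lo w) zero    (suc j) _        = <⇒≤ (vert-labels w j)
  vert-monotone (step e lo w) (suc i) (suc j) (s≤s le) = vert-monotone w i j le

  walk⇒path : ∀ {s x y} → Walk G lab s x y → TemporalPath G lab x y
  walk⇒path w with simplify w
  ... | w′ , u = record
    { k = len w′ ; p = vert w′ ; start = refl ; end = vert-end w′
    ; distinct = λ {i} {j} → vert-injective w′ u i j
    ; edges = vert-edges w′ ; monotone = vert-monotone w′ }

module _ {n} (lab : Labeling n) (lab-sym : ∀ u v → lab u v ≡ lab v u) where

  private
    K = n * n

    code : Fin n → Fin n → ℕ
    code u v with toℕ u ≤? toℕ v
    ... | yes _ = toℕ (combine u v)
    ... | no  _ = toℕ (combine v u)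

    code<K : ∀ u v → code u v < K
    code<K u v with toℕ u ≤? toℕ v
    ... | yes _ = toℕ<n (combine u v)
    ... | no  _ = toℕ<n (combine v u)

    code-sym : ∀ u v → code u v ≡ code v u
    code-sym u v with toℕ u ≤? toℕ v | toℕ v ≤? toℕ u
    ... | yes p | yes q = cong (λ (x , y) → toℕ (combine x y)) (cong₂ _,_ u≡v (sym u≡v))
      where u≡v = toℕ-injective (≤-antisym p q)
    ... | yes p | no  _ = refl
    ... | no  _ | yes q = refl
    ... | no ¬p | no ¬q = contradiction (<⇒≤ (≰⇒> ¬q)) ¬p

    code-injective : ∀ u v w → code u v ≡ code u w → v ≡ w
    code-injective u v w eq with toℕ u ≤? toℕ v | toℕ u ≤? toℕ w
    ... | yes _ | yes _ = combine-injectiveʳ u v u w (toℕ-injective eq)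
    ... | no  _ | no  _ = combine-injectiveˡ v u w u (toℕ-injective eq)
    ... | yes _ | no  _ = trans (combine-injectiveʳ u v w u (toℕ-injective eq)) (combine-injectiveˡ u v w u (toℕ-injective eq))
    ... | no  _ | yes _ = trans (combine-injectiveˡ v u u w (toℕ-injective eq)) (combine-injectiveʳ v u u w (toℕ-injective eq))

    -- The lexicographic order: with remainders below `K`, a larger old label outweighs every
    -- tie-breaker.
    block< : ∀ {q q′ r r′} → q < q′ → r < K → q * K + r < q′ * K + r′
    block< {q} {q′} {r} {r′} q<q′ r<K = <-≤-trans (+-monoʳ-< (q * K) r<K)
      (≡-≤-trans (+-comm (q * K) K) (≤-trans (*-monoˡ-≤ K q<q′) (m≤m+n _ r′)))

  -- Ties between equally labelled edges are broken by the edge itself.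
  refined : Labeling n
  refined u v = suc (lab u v * K + code u v)

  refined-sym : ∀ u v → refined u v ≡ refined v u
  refined-sym u v = cong₂ (λ l c → suc (l * K + c)) (lab-sym u v) (code-sym u v)

  refined-injective : ∀ u v w → refined u v ≡ refined u w → v ≡ w
  refined-injective u v w eq with <-cmp (lab u v) (lab u w)
  ... | tri< lt _ _ = contradiction (suc-injective eq) (<⇒≢ (block< lt (code<K u v)))
  ... | tri> _ _ gt = contradiction (sym (suc-injective eq)) (<⇒≢ (block< gt (code<K u w)))
  ... | tri≈ _ l≡ _ = code-injective u v w (+-cancelˡ-≡ (lab u v * K) _ _
        (trans (suc-injective eq) (cong (λ l → l * K + code u w) (sym l≡))))

  refine-walk : ∀ {G : Graph n} {s x y} → Walk G lab s x y → Walk G refined (suc (s * K)) x y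
  refine-walk stop = stop
  refine-walk {x = x} (step {z} e lo w) = step e
    (s≤s (≤-trans (*-monoˡ-≤ K lo) (m≤m+n _ _)))
    (weaken (s≤s (≤-≡-trans (block< {r′ = 0} (≤-refl {suc (lab x z)}) (code<K x z)) (+-identityʳ _))) (refine-walk w))

-- Symmetry and increasing walks are all that a construction has to provide; `refined` makes the
-- labels positive and proper.
realized : ∀ {n} (d : Fin n → ℕ) (G : Graph n) → (∀ u → deg G u ≡ d u) → (lab : Labeling n) →
  (∀ u v → lab u v ≡ lab v u) → (∀ x y → Walk G lab 0 x y) → TCRealizable d
realized d G realizes lab lab-sym walks = G , (λ i → trans (degree≡deg G i) (realizes i)) ,
  refined lab lab-sym , ((λ u v _ → refined-sym lab lab-sym u v) , (λ u v _ → s≤s z≤n)) ,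
  (λ u v w _ _ v≢w eq → v≢w (refined-injective lab lab-sym u v w eq)) ,
  (λ x y → walk⇒path (refine-walk lab lab-sym (walks x y)))

plan⇒TC : ∀ {n} {d : Fin n → ℕ} {core} → Plan d core → TCRealizable d
plan⇒TC {n} {d} {core} P = realized d graph realizes lab lab-sym walks
  where
  open Plan P
  W = Walk graph lab
  -- The way into the core is returned as an operation that is put in front of a walk. The number
  -- `k` bounds `M ∸ E x`, which drops at every step.
  gather : ∀ k x → M ≤ k + E x → ∃ λ u → core u ≡ true × (∀ {y} → W M u y → W (E x) x y)
  gather k x le with core x in cx
  ... | true  = x , cx , weaken (E≤M x)
  gather zero x le | false = let (a , _ , _ , lt) = early x cx in
    contradiction (≤-trans lt (E≤M a)) (≤⇒≯ le)
  gather (suc k) x le | false =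
    let (a , e , l , lt) = early x cx
        (u , cu , w) = gather k a (≤-trans le (≡-≤-trans (sym (+-suc k (E x))) (+-monoʳ-≤ k lt)))
    in u , cu , λ w₀ → step e (≤-reflexive (sym l)) (weaken (≡-≤-trans (cong suc l) lt) (w w₀))
  -- The way out of the core is built from its end, along decreasing `D`.
  broadcast : ∀ k v {y} → D v ≤ k + N → W (suc (D v)) v y → ∃ λ u → core u ≡ true × W (suc N) u y
  broadcast k v le w with core v in cv
  ... | true  = v , cv , weaken (s≤s (N≤D v)) w
  broadcast zero v le w | false = let (b , _ , _ , lt) = late v cv in
    contradiction (≤-trans (s≤s (N≤D b)) lt) (≤⇒≯ le)
  broadcast (suc k) v le w | false =
    let (b , e , l , lt) = late v cv
        l′ = trans (lab-sym b v) l
    in broadcast k b (≤-pred (≤-trans lt le))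
         (step (adj-flip graph e) (≤-≡-trans lt (sym l′)) (weaken (≤-reflexive (cong suc l′)) w))
  exchange : ∀ {u u′ y} → Hub graph lab M N u u′ → W (suc N) u′ y → W M u y
  exchange here w = weaken (m≤n⇒m≤1+n M≤N) w
  exchange (edge e lo hi) w = step e lo (weaken (s≤s hi) w)
  exchange (via e₁ e₂ lo lt hi) w = step e₁ lo (step e₂ lt (weaken (s≤s hi) w))
  walks : ∀ x y → W 0 x y
  walks x y =
    let (u , cu , w) = gather M x (m≤m+n M (E x))
        (u′ , cu′ , w′) = broadcast (D y) y (m≤m+n (D y) N) stop
    in weaken z≤n (w (exchange (hub u u′ cu cu′) w′))

-- Explicit plans for small regular graphs

module _ {n} (T : Vec (Vec ℕ n) n) where

  tableLab : Labeling n
  tableLab u v = lookup (lookup T u) v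

  tableAdj : Fin n → Fin n → Bool
  tableAdj u v = 0 ℕ.<ᵇ tableLab u v

  module _ (core : Fin n → Bool) (E D : Vec ℕ n) where

    -- Label 0 in a table means that there is no edge. All tables share the window `M = 3`, `N = 4`
    -- and the bound `B = 7`.
    Valid : Set
    Valid = (∀ u v → tableLab u v ≡ tableLab v u) × (∀ u → tableAdj u u ≡ false) ×
      (∀ u → lookup E u ≤ 3 × 4 ≤ lookup D u × lookup D u ≤ 7) ×
      (∀ v → core v ≡ false → ∃ λ a → tableAdj v a ≡ true × tableLab v a ≡ lookup E v × lookup E v < lookup E a) ×
      (∀ v → core v ≡ false → ∃ λ b → tableAdj v b ≡ true × tableLab v b ≡ lookup D v × lookup D b < lookup D v) ×
      (∀ u w → core u ≡ true → core w ≡ true → u ≡ w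
        ⊎ (tableAdj u w ≡ true × 3 ≤ tableLab u w × tableLab u w ≤ 4)
        ⊎ ∃ λ z → tableAdj u z ≡ true × tableAdj z w ≡ true × 3 ≤ tableLab u z × tableLab u z < tableLab z w × tableLab z w ≤ 4)

    valid? : Dec Valid
    valid? = (all? λ u → all? λ v → tableLab u v ℕ.≟ tableLab v u) ×-dec (all? λ u → tableAdj u u Bool.≟ false) ×-dec
      (all? λ u → (lookup E u ≤? 3) ×-dec (4 ≤? lookup D u) ×-dec (lookup D u ≤? 7)) ×-dec
      (all? λ v → (core v Bool.≟ false) →-dec any? λ a →
        (tableAdj v a Bool.≟ true) ×-dec (tableLab v a ℕ.≟ lookup E v) ×-dec (lookup E v <? lookup E a)) ×-dec
      (all? λ v → (core v Bool.≟ false) →-dec any? λ b →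
        (tableAdj v b Bool.≟ true) ×-dec (tableLab v b ℕ.≟ lookup D v) ×-dec (lookup D b <? lookup D v)) ×-dec
      (all? λ u → all? λ w → (core u Bool.≟ true) →-dec (core w Bool.≟ true) →-dec ((u ≟ w)
        ⊎-dec ((tableAdj u w Bool.≟ true) ×-dec (3 ≤? tableLab u w) ×-dec (tableLab u w ≤? 4))
        ⊎-dec any? λ z → (tableAdj u z Bool.≟ true) ×-dec (tableAdj z w Bool.≟ true) ×-dec
          (3 ≤? tableLab u z) ×-dec (tableLab u z <? tableLab z w) ×-dec (tableLab z w ≤? 4)))

    table-plan : Valid → (∀ d → (∀ u → # tableAdj u ≡ d u) → Plan d core)
    table-plan (sy , ir , bd , ea , la , hb) d eq = record
      { graph = G ; realizes = eq
      ; lab = tableLab ; lab-sym = sy ; E = lookup E ; D = lookup D ; M = 3 ; N = 4 ; B = 7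
      ; M≤N = n≤1+n 3 ; E≤M = proj₁ ∘ bd ; N≤D = proj₁ ∘ proj₂ ∘ bd ; D≤B = proj₂ ∘ proj₂ ∘ bd
      ; early = ea ; late = la ; hub = λ u w cu cw → toHub (hb u w cu cw) }
      where
      G : Graph n
      G = record { adj = tableAdj ; sym = λ u v → cong (0 ℕ.<ᵇ_) (sy u v) ; irrefl = ir }
      toHub : ∀ {u w} → _ → Hub G tableLab 3 4 u w
      toHub (inj₁ refl) = here
      toHub (inj₂ (inj₁ (e , lo , hi))) = edge e lo hi
      toHub (inj₂ (inj₂ (z , e₁ , e₂ , lo , lt , hi))) = via e₁ e₂ lo lt hi

  regular-plan : ∀ k (core : Fin n → Bool) (E D : Vec ℕ n) → True (valid? core E D) →
    True (all? λ u → # tableAdj u ℕ.≟ k) → Plan (λ _ → k) core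
  regular-plan k core E D valid reg = table-plan core E D (toWitness valid) _ (toWitness reg)

below : ∀ {n} → ℕ → Fin n → Bool
below k u = toℕ u ℕ.<ᵇ k

point-plan : Plan {1} (λ _ → 0) (below 1)
point-plan = regular-plan ((0 ∷ []) ∷ []) 0 _ (3 ∷ []) (4 ∷ []) tt tt

triangle-plan : Plan {3} (λ _ → 2) (below 2)
triangle-plan = regular-plan
  ((0 ∷ 3 ∷ 2 ∷ []) ∷
   (3 ∷ 0 ∷ 5 ∷ []) ∷
   (2 ∷ 5 ∷ 0 ∷ []) ∷ []) 2 _ (3 ∷ 3 ∷ 2 ∷ []) (4 ∷ 4 ∷ 5 ∷ []) tt tt

square-plan : Plan {4} (λ _ → 2) (below 4)
square-plan = regular-plan
  ((0 ∷ 3 ∷ 0 ∷ 4 ∷ []) ∷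
   (3 ∷ 0 ∷ 4 ∷ 0 ∷ []) ∷
   (0 ∷ 4 ∷ 0 ∷ 3 ∷ []) ∷
   (4 ∷ 0 ∷ 3 ∷ 0 ∷ []) ∷ []) 2 _ (3 ∷ 3 ∷ 3 ∷ 3 ∷ []) (4 ∷ 4 ∷ 4 ∷ 4 ∷ []) tt tt

K₄-plan : Plan {4} (λ _ → 3) (below 1)
K₄-plan = regular-plan
  ((0 ∷ 2 ∷ 5 ∷ 2 ∷ []) ∷
   (2 ∷ 0 ∷ 1 ∷ 7 ∷ []) ∷
   (5 ∷ 1 ∷ 0 ∷ 6 ∷ []) ∷
   (2 ∷ 7 ∷ 6 ∷ 0 ∷ []) ∷ []) 3 _ (3 ∷ 2 ∷ 1 ∷ 2 ∷ []) (4 ∷ 7 ∷ 5 ∷ 6 ∷ []) tt tt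

K₃₃-plan : Plan {6} (λ _ → 3) (below 2)
K₃₃-plan = regular-plan
  ((0 ∷ 3 ∷ 2 ∷ 0 ∷ 2 ∷ 0 ∷ []) ∷
   (3 ∷ 0 ∷ 0 ∷ 5 ∷ 0 ∷ 5 ∷ []) ∷
   (2 ∷ 0 ∷ 0 ∷ 1 ∷ 0 ∷ 6 ∷ []) ∷
   (0 ∷ 5 ∷ 1 ∷ 0 ∷ 6 ∷ 0 ∷ []) ∷
   (2 ∷ 0 ∷ 0 ∷ 6 ∷ 0 ∷ 1 ∷ []) ∷
   (0 ∷ 5 ∷ 6 ∷ 0 ∷ 1 ∷ 0 ∷ []) ∷ []) 3 _ (3 ∷ 3 ∷ 2 ∷ 1 ∷ 2 ∷ 1 ∷ []) (4 ∷ 4 ∷ 6 ∷ 5 ∷ 6 ∷ 5 ∷ []) tt tt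

cube-plan : Plan {8} (λ _ → 3) (below 4)
cube-plan = regular-plan
  ((0 ∷ 3 ∷ 0 ∷ 4 ∷ 2 ∷ 0 ∷ 0 ∷ 0 ∷ []) ∷
   (3 ∷ 0 ∷ 4 ∷ 0 ∷ 0 ∷ 5 ∷ 0 ∷ 0 ∷ []) ∷
   (0 ∷ 4 ∷ 0 ∷ 3 ∷ 0 ∷ 0 ∷ 2 ∷ 0 ∷ []) ∷
   (4 ∷ 0 ∷ 3 ∷ 0 ∷ 0 ∷ 0 ∷ 0 ∷ 5 ∷ []) ∷
   (2 ∷ 0 ∷ 0 ∷ 0 ∷ 0 ∷ 1 ∷ 0 ∷ 6 ∷ []) ∷
   (0 ∷ 5 ∷ 0 ∷ 0 ∷ 1 ∷ 0 ∷ 6 ∷ 0 ∷ []) ∷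
   (0 ∷ 0 ∷ 2 ∷ 0 ∷ 0 ∷ 6 ∷ 0 ∷ 1 ∷ []) ∷
   (0 ∷ 0 ∷ 0 ∷ 5 ∷ 6 ∷ 0 ∷ 1 ∷ 0 ∷ []) ∷ []) 3 _
  (3 ∷ 3 ∷ 3 ∷ 3 ∷ 2 ∷ 1 ∷ 2 ∷ 1 ∷ []) (4 ∷ 4 ∷ 4 ∷ 4 ∷ 6 ∷ 5 ∷ 6 ∷ 5 ∷ []) tt tt

-- Tight sequences

⟨$⟩ʳ-injective : ∀ {n} (π : Permutation′ n) {i j} → π ⟨$⟩ʳ i ≡ π ⟨$⟩ʳ j → i ≡ j
⟨$⟩ʳ-injective π eq = trans (sym (inverseˡ π)) (trans (cong (π ⟨$⟩ˡ_) eq) (inverseˡ π))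

front : ∀ {n} → Fin (suc n) → Permutation′ (suc n)
front v = transpose zero v

front-other : ∀ {n} {v w : Fin (suc n)} → w ≢ v → ∃ λ j → front v ⟨$⟩ʳ suc j ≡ w
front-other {v = v} {w} w≢v with front v ⟨$⟩ˡ w in eq
... | zero  = contradiction (trans (sym (inverseʳ (front v))) (cong (front v ⟨$⟩ʳ_) eq)) w≢v
... | suc j = j , trans (cong (front v ⟨$⟩ʳ_) (sym eq)) (inverseʳ (front v))

unpermute-plan : ∀ {n} {d : Fin n → ℕ} {core} (π : Permutation′ n) →
  Plan (λ u → d (π ⟨$⟩ʳ u)) core → Plan d (λ u → core (π ⟨$⟩ˡ u))
unpermute-plan {d = d} π P = plan-cong (λ u → cong d (inverseʳ π)) (permute-plan (flip π) P)

CoreIn : ∀ {n} → Fin n → (Fin n → Bool) → Set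
CoreIn c core = ∀ u → core u ≡ true → u ≡ c

-- A subdivision needs a vertex outside the core that differs from the third neighbour; of two such
-- vertices at least one does.
Spare : ∀ {n} → (Fin n → Bool) → Set
Spare core = ∃₂ λ b b′ → b ≢ b′ × core b ≡ false × core b′ ≡ false

coreIn-unpermute : ∀ {n} {c core} (v : Fin (suc n)) {j : Fin n} → front v ⟨$⟩ʳ suc j ≡ c → CoreIn j core →
  CoreIn c (λ u → (false ◂ core) (front v ⟨$⟩ˡ u))
coreIn-unpermute v eq only u cu with front v ⟨$⟩ˡ u in eq′
... | suc k with only k cu
...   | refl = trans (sym (inverseʳ (front v))) (trans (cong (front v ⟨$⟩ʳ_) eq′) eq)

spare-unpermute : ∀ {n} {core} (π : Permutation′ (suc n)) → Spare {n} core → Spare (λ u → (false ◂ core) (π ⟨$⟩ˡ u))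
spare-unpermute {core = core} π (b , b′ , ne , nb , nb′) = π ⟨$⟩ʳ suc b , π ⟨$⟩ʳ suc b′ ,
  (λ eq → ne (sucᶠ-injective (⟨$⟩ʳ-injective π eq))) ,
  trans (cong (false ◂ core) (inverseˡ π)) nb , trans (cong (false ◂ core) (inverseˡ π)) nb′

-- `Rooted` is `⊤` when the core has to be the prescribed vertex and `⊥` when its place does not
-- matter; in this way one induction serves all three values of `q`.
CubicPlan : Set → ∀ {n} → (Fin n → ℕ) → Fin n → Set
CubicPlan Rooted d c = ∃ λ core → Plan d core × (Rooted → CoreIn c core) × Spare core

-- Shrinking a degree ≥ 4 together with a degree 3 preserves Σ (d u − 4), so everything is reduced
-- to the cubic base by inverse subdivisions.
module _ (Rooted : Set) (q : ℕ) (4≤q : 4 ≤ q) (base : ∀ c → CubicPlan Rooted {q} (λ _ → 3) c) where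

  min-degree-3-plan : ∀ n (d : Fin n → ℕ) c → (∀ u → 3 ≤ d u) → ∑ d + q ≡ 4 * n → CubicPlan Rooted d c
  min-degree-3-plan (suc n) d c d≥3 total with any? (λ u → 4 ≤? d u)
  ... | no ¬big = recast q≡ base
    where
    d≡3 : ∀ u → 3 ≡ d u
    d≡3 u = ≤-antisym (d≥3 u) (≤-pred (≰⇒> (λ le → ¬big (u , le))))
    q≡ : q ≡ suc n
    q≡ = arith q (suc n) (trans (cong (_+ q) (trans (sym (∑-const (suc n) 3)) (∑-cong d≡3))) total)
      where
      arith : ∀ q n → n * 3 + q ≡ 4 * n → q ≡ n
      arith q n eq = +-cancelˡ-≡ (n * 3) q n (trans eq (ring n))
        where
        ring : ∀ n → 4 * n ≡ n * 3 + n
        ring = solve-∀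
    recast : q ≡ suc n → (∀ c → CubicPlan Rooted {q} (λ _ → 3) c) → CubicPlan Rooted d c
    recast refl b = let (core , P , rest) = b c in core , plan-cong d≡3 P , rest
  ... | yes (c′ , big) with any? (λ v → ¬? (v ≟ c) ×-dec (d v ℕ.≟ 3))
  -- If only `c` can have degree 3, the sum is at least 4n - 1, which `4 ≤ q` excludes.
  ...   | no ¬three = contradiction sum≥ (λ le → <-irrefl refl (linear {p = suc (4 * suc n)} {q = 4 * suc n} 2
            (le ⊕ 4≤q ⊕ ≤-reflexive total) (ring (4 * suc n) (∑ d) q)))
    where
    ring : ∀ m s q → suc m + (suc s + q + m) + 2 ≡ m + (m + 4 + (s + q))
    ring = solve-∀
    pointwise : ∀ u → 4 ≤ ⟦ c == u ⟧ + d u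
    pointwise u = by (c ≟ u)
      where
      by : Dec (c ≡ u) → 4 ≤ ⟦ c == u ⟧ + d u
      by (yes refl) = subst (λ b → 4 ≤ ⟦ b ⟧ + d u) (sym (==-refl c)) (s≤s (d≥3 u))
      by (no c≢u) = ≤-trans (≤∧≢⇒< (d≥3 u) (λ eq → ¬three (u , (c≢u ∘ sym) , sym eq))) (m≤n+m _ _)
    sum≥ : 4 * suc n ≤ suc (∑ d)
    sum≥ = ≡-≤-trans (trans (*-comm 4 (suc n)) (sym (∑-const (suc n) 4))) (≤-≡-trans (∑-mono pointwise) (∑-mark c d))
  -- `v` is going to be the subdividing vertex and `c′` its third neighbour, so `v` is removed and
  -- `c′` loses one. Since `v` is not `c`, the root stays.
  ...   | yes (v , v≢c , dv≡3) =
    let (jc , jc≡) = front-other {v = v} {c} (v≢c ∘ sym)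
        (core , P , root , spare@(b₁ , b₂ , b₁≢b₂ , nb₁ , nb₂)) = min-degree-3-plan n r jc r≥3 r-total
        P⁺ = case j ≟ b₁ of λ
          { (no ne)  → subdivide nb₁ ne P
          ; (yes eq) → subdivide nb₂ (b₁≢b₂ ∘ trans (sym eq)) P }
    in (λ u → (false ◂ core) (π ⟨$⟩ˡ u)) ,
       unpermute-plan π (plan-cong (λ { zero → sym dv≡3 ; (suc u) → restore u }) P⁺) ,
       (λ r → coreIn-unpermute v jc≡ (root r)) , spare-unpermute π spare
    where
    π = front v
    j,≡ = front-other {v = v} {c′} (λ { refl → <-irrefl (sym dv≡3) big })
    j = proj₁ j,≡
    e = λ u → d (π ⟨$⟩ʳ suc u)
    r = λ u → e u ∸ ⟦ j == u ⟧
    room : ∀ u → 3 + ⟦ j == u ⟧ ≤ e u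
    room u = by (j ≟ u)
      where
      by : Dec (j ≡ u) → 3 + ⟦ j == u ⟧ ≤ e u
      by (yes refl) = ≡-≤-trans (cong (λ b → 3 + ⟦ b ⟧) (==-refl j)) (subst (λ w → 4 ≤ d w) (sym (proj₂ j,≡)) big)
      by (no ne) = ≡-≤-trans (cong (λ b → 3 + ⟦ b ⟧) (==-≢ ne)) (d≥3 _)
    restore : ∀ u → ⟦ j == u ⟧ + r u ≡ e u
    restore u = m+[n∸m]≡n (≤-trans (m≤n+m _ 3) (room u))
    r≥3 : ∀ u → 3 ≤ r u
    r≥3 u = ≡-≤-trans (sym (m+n∸n≡m 3 ⟦ j == u ⟧)) (∸-monoˡ-≤ ⟦ j == u ⟧ (room u))
    r-total : ∑ r + q ≡ 4 * n
    r-total = +-cancelˡ-≡ 4 _ _ (trans (cong (λ t → 3 + (t + q)) (trans (sym (∑-mark j r)) (∑-cong restore)))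
      (trans (cong (λ t → t + ∑ e + q) (sym dv≡3)) (trans (cong (_+ q) (sym (∑-permute d π))) (trans total (*-suc 4 n)))))

pair-split : ∀ {n} {x y : Fin n} → x ≢ y → ∀ u → ⟦ (x == u) ∨ (y == u) ⟧ ≡ ⟦ x == u ⟧ + ⟦ y == u ⟧
pair-split {x = x} {y} x≢y u with x ≟ u | y ≟ u
... | yes p | yes q = contradiction (trans p (sym q)) x≢y
... | yes _ | no _  = refl
... | no _  | yes _ = refl
... | no _  | no _  = refl

∑-pair : ∀ {n} {x y : Fin n} → x ≢ y → ∑ (λ u → ⟦ (x == u) ∨ (y == u) ⟧) ≡ 2
∑-pair {x = x} {y} x≢y = trans (∑-cong (pair-split x≢y)) (∑-marks x y)

two-largest : ∀ n → 2 ≤ n → (f : Fin n → ℕ) → ∃₂ λ x y → x ≢ y × (∀ u → f u ≤ f x) × (∀ u → x ≢ u → f u ≤ f y)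
two-largest (suc (suc n)) _ f with argmax f
... | x , x-max with argmax (f ∘ punchIn x)
...   | i , best = x , punchIn x i , (punchInᵢ≢i x i ∘ sym) , x-max ,
  λ u x≢u → ≡-≤-trans (cong f (sym (punchIn-punchOut x≢u))) (best (punchOut x≢u))
two-largest (suc zero) (s≤s ())

module _ (r : ℕ)
  (cubic : ∀ n (d : Fin n → ℕ) → Fin n → (∀ u → 3 ≤ d u) → ∑ d + (2 * r + 4) ≡ 4 * n → ∃ (Plan d))
  (base : ∃ (Plan {r + 2} (λ _ → 2))) where

  -- `r = 1` belongs to the edge as core, `r = 2` to the four-cycle. Joining a vertex of degree 2 to
  -- the two largest degrees preserves the upper bound on degrees, until only the cycle on `r + 2`
  -- vertices is left or the minimum degree is 3.
  tight-plan : ∀ n (d : Fin n → ℕ) → (∀ u → 2 ≤ d u) → (∀ u → d u + r ≤ n) →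
    ∑ d + (2 * r + 4) ≡ 4 * n → ∃ (Plan d)
  tight-plan zero d d≥2 d≤ total = contradiction (trans (+-comm 4 (2 * r)) total) (λ ())
  tight-plan (suc n) d d≥2 d≤ total with any? (λ u → d u ℕ.≟ 2)
  ... | no ¬two = cubic (suc n) d zero (λ u → ≤∧≢⇒< (d≥2 u) (λ eq → ¬two (u , sym eq))) total
  ... | yes (v , dv≡2) with r + 2 <? suc n
  ...   | no ≮ = recast n≡ base
    where
    n≡ : r + 2 ≡ suc n
    n≡ = ≤-antisym (≡-≤-trans (+-comm r 2) (≤-trans (+-monoˡ-≤ r (d≥2 v)) (d≤ v))) (≮⇒≥ ≮)
    d≡2 : ∀ u → 2 ≡ d u
    d≡2 u = ≤-antisym (d≥2 u) (+-cancelʳ-≤ r (d u) 2 (≤-≡-trans (d≤ u) (trans (sym n≡) (+-comm r 2))))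
    recast : ∀ {m} → m ≡ suc n → ∃ (Plan {m} (λ _ → 2)) → ∃ (Plan d)
    recast refl (core , P) = core , plan-cong d≡2 P
  ...   | yes r+2<n with two-largest n (≤-pred (≤-trans (s≤s (m≤n+m 2 r)) r+2<n)) (λ u → d (front v ⟨$⟩ʳ suc u))
  ...     | x , y , x≢y , x-max , y-max =
    let (core , P) = tight-plan n f f≥2 f≤ f-total
    in _ , unpermute-plan π (plan-cong (λ { zero → trans (∑-pair x≢y) (sym dv≡2) ; (suc u) → restore u })
             (extend S x≢y (cong (_∨ (y == x)) (==-refl x)) Sy P))
    where
    π = front v
    e = λ u → d (π ⟨$⟩ʳ suc u)
    e-total : 2 + ∑ e + (2 * r + 4) ≡ 4 * suc n
    e-total = trans (cong (λ t → t + ∑ e + (2 * r + 4)) (sym dv≡2)) (trans (cong (_+ (2 * r + 4)) (sym (∑-permute d π))) total)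
    S = λ u → (x == u) ∨ (y == u)
    Sy : S y ≡ true
    Sy rewrite ==-refl y | ==-≢ x≢y = refl
    e≤ : ∀ u → e u + r ≤ suc n
    e≤ u = d≤ _
    -- Otherwise all vertices but `x` have degree at most 2, and the prescribed total pushes `e x`
    -- above its bound.
    ey≥3 : 3 ≤ e y
    ey≥3 = ≰⇒> λ ey≤2 → <-irrefl refl (linear {p = suc n} {q = n} 0
        (≤-reflexive (sym e-total) ⊕ upper ey≤2 ⊕ e≤ x ⊕ r+2<n) (ring n r (∑ e) (e x)))
      where
      ring : ∀ n r s t → suc n + (2 + s + (2 * r + 4) + (n * 2 + t) + suc n + suc n) + 0
        ≡ n + (4 * suc n + (s + 2) + (t + r) + suc (r + 2))
      ring = solve-∀
      upper : e y ≤ 2 → ∑ e + 2 ≤ n * 2 + e x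
      upper ey≤2 = ≡-≤-trans (sym (∑-bump x 2 e))
        (≤-≡-trans (∑-mono pointwise) (trans (∑-shift 2 (λ u → ⟦ x == u ⟧ * e u)) (cong (n * 2 +_) (∑-pick x e))))
        where
        pointwise : ∀ u → e u + ⟦ x == u ⟧ * 2 ≤ 2 + ⟦ x == u ⟧ * e u
        pointwise u = by (x ≟ u)
          where
          by : Dec (x ≡ u) → e u + ⟦ x == u ⟧ * 2 ≤ 2 + ⟦ x == u ⟧ * e u
          by (yes refl) rewrite ==-refl x = ≤-reflexive (trans (+-comm (e x) 2) (cong (2 +_) (sym (+-identityʳ (e x)))))
          by (no ne) rewrite ==-≢ ne = +-monoˡ-≤ 0 (≤-trans (y-max u ne) ey≤2)
    f = λ u → e u ∸ ⟦ S u ⟧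
    room : ∀ u → 2 + ⟦ S u ⟧ ≤ e u
    room u = by (x ≟ u) (y ≟ u)
      where
      big : 3 ≤ e u → 2 + ⟦ S u ⟧ ≤ e u
      big le = ≤-trans (+-monoʳ-≤ 2 (⟦⟧≤1 (S u))) le
      by : Dec (x ≡ u) → Dec (y ≡ u) → 2 + ⟦ S u ⟧ ≤ e u
      by (yes refl) _ = big (≤-trans ey≥3 (x-max y))
      by (no _) (yes refl) = big ey≥3
      by (no p) (no q) = ≡-≤-trans (cong (λ b → 2 + ⟦ b ⟧) (cong₂ _∨_ (==-≢ p) (==-≢ q))) (d≥2 _)
    restore : ∀ u → ⟦ S u ⟧ + f u ≡ e u
    restore u = m+[n∸m]≡n (≤-trans (m≤n+m _ 2) (room u))
    f≥2 : ∀ u → 2 ≤ f u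
    f≥2 u = ≡-≤-trans (sym (m+n∸n≡m 2 ⟦ S u ⟧)) (∸-monoˡ-≤ ⟦ S u ⟧ (room u))
    f≤ : ∀ u → f u + r ≤ n
    f≤ u = by (x ≟ u) (y ≟ u)
      where
      small : S u ≡ true → f u + r ≤ n
      small Su = ≤-pred (≡-≤-trans (cong (_+ r) (trans (cong (λ b → ⟦ b ⟧ + f u) (sym Su)) (restore u))) (e≤ u))
      by : Dec (x ≡ u) → Dec (y ≡ u) → f u + r ≤ n
      by (yes refl) _ = small (cong (_∨ (y == u)) (==-refl u))
      by (no _) (yes refl) = small Sy
      -- A third vertex attaining the old bound would make three of the largest possible degree, and
      -- these exceed the total.
      by (no x≢u) (no y≢u) = ≮⇒≥ (λ gt → <-irrefl refl (linear {p = suc n} {q = n} 0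
          (lower (e u ∸ 2) (≤-reflexive (m+[n∸m]≡n (d≥2 _))) ⊕ gt′ gt ⊕ gt′ gt ⊕ gt′ gt ⊕ ≤-reflexive e-total ⊕ r+2<n) (ring n r (∑ e) (e u ∸ 2))))
        where
        ring : ∀ n r s k → suc n + (s + (2 + k + r) + (2 + k + r) + (2 + k + r) + 4 * suc n + suc n) + 0
          ≡ n + (n * 2 + 3 * k + suc n + suc n + suc n + (2 + s + (2 * r + 4)) + suc (r + 2))
        ring = solve-∀
        gt′ : suc n ≤ f u + r → suc n ≤ 2 + (e u ∸ 2) + r
        gt′ gt = ≤-trans gt (+-monoˡ-≤ r (≤-≡-trans (m∸n≤m (e u) ⟦ S u ⟧) (sym (m+[n∸m]≡n (d≥2 _)))))
        lower : ∀ k → 2 + k ≤ e u → n * 2 + 3 * k ≤ ∑ e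
        lower k le = ≡-≤-trans (sym (trans (∑-bump u k _) (trans (cong (_+ k) (trans (∑-bump y k _)
            (cong (_+ k) (trans (∑-bump x k _) (cong (_+ k) (∑-const n 2)))))) (ring₂ (n * 2) k)))) (∑-mono pointwise)
          where
          ring₂ : ∀ m k → m + k + k + k ≡ m + 3 * k
          ring₂ = solve-∀
          strip : ∀ k → 2 + (k + 0 + 0 + 0) ≡ 2 + k
          strip = solve-∀
          pointwise : ∀ w → 2 + ⟦ x == w ⟧ * k + ⟦ y == w ⟧ * k + ⟦ u == w ⟧ * k ≤ e w
          pointwise w with x ≟ w | y ≟ w | u ≟ w
          ... | yes p | yes q | _ = contradiction (trans p (sym q)) x≢y
          ... | yes p | no _ | yes q = contradiction (trans p (sym q)) x≢u
          ... | no _ | yes p | yes q = contradiction (trans p (sym q)) y≢u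
          ... | yes refl | no _ | no _ = ≡-≤-trans (strip k) (≤-trans le (x-max u))
          ... | no _ | yes refl | no _ = ≡-≤-trans (cong (2 +_) (trans (+-identityʳ _) (+-identityʳ k))) (≤-trans le (y-max u x≢u))
          ... | no _ | no _ | yes refl = ≡-≤-trans (cong (2 +_) (+-identityʳ k)) le
          ... | no _ | no _ | no _ = d≥2 _
    f-total : ∑ f + (2 * r + 4) ≡ 4 * n
    f-total = +-cancelˡ-≡ 4 _ _ (trans (cong (λ t → 2 + (t + (∑ f + (2 * r + 4)))) (sym (∑-pair x≢y)))
      (trans (cong (2 +_) (trans (sym (+-assoc (# S) (∑ f) (2 * r + 4)))
        (cong (_+ (2 * r + 4)) (trans (sym (∑-distrib-+ (λ u → ⟦ S u ⟧) f)) (∑-cong restore)))))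
      (trans e-total (*-suc 4 n))))

-- Havel–Hakimi

module _ {n} (v : Fin n) (w : Fin n → ℕ) where

  private
    weight : Graph n → ℕ
    weight G = ∑ (λ u → ⟦ adj G v u ⟧ * w u)

    weight≤ : ∀ G → weight G ≤ ∑ w
    weight≤ G = ∑-mono (λ u → ≤-≡-trans (*-monoˡ-≤ (w u) (⟦⟧≤1 (adj G v u))) (*-identityˡ (w u)))

    -- As `y` has the larger degree, it has a neighbour `z` that `x` lacks. Replacing the edges vx
    -- and yz by vy and xz preserves all degrees and increases the weight by `w y ∸ w x`.
    exchange : ∀ G → (∀ u → deg G u ≡ w u) → ∀ {x y} → adj G v x ≡ true → adj G v y ≡ false → y ≢ v → w x < w y →
      ∃ λ G′ → (∀ u → deg G′ u ≡ w u) × weight G < weight G′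
    exchange G realizes {x} {y} vx vy y≢v wx<wy = G₄ , (λ u → trans (deg₄ u) (realizes u)) , heavier
      where
      x≢y : x ≢ y
      x≢y refl = not-both vx vy
      v≢x = adj-≢ G vx
      -- Comparing the rows of y and x up to the transposition (x y) excludes z = x.
      found : ∃ λ z → ⟦ adj G x (transpose x y ⟨$⟩ʳ z) ⟧ < ⟦ adj G y z ⟧
      found = ∑-<-witness _ _ (≤-trans (s≤s (≤-reflexive (trans (sym (∑-permute (λ u → ⟦ adj G x u ⟧) (transpose x y))) (realizes x))))
        (≤-≡-trans wx<wy (sym (realizes y))))
      z = proj₁ found
      yz : adj G y z ≡ true
      yz with adj G y z | proj₂ found
      ... | true  | _ = refl
      ... | false | ()
      xτz : adj G x (transpose x y ⟨$⟩ʳ z) ≡ false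
      xτz with adj G x (transpose x y ⟨$⟩ʳ z) | adj G y z | proj₂ found
      ... | false | _     | _ = refl
      ... | true  | true  | s≤s ()
      ... | true  | false | ()
      y≢z = adj-≢ G yz
      z≢x : z ≢ x
      z≢x z≡x = not-both (adj-flip G (subst (λ t → adj G y t ≡ true) z≡x yz)) (trans (cong (adj G x) (sym τ)) xτz)
        where
        τ : transpose x y ⟨$⟩ʳ z ≡ y
        τ rewrite z≡x | ==-refl x = refl
      xz : adj G x z ≡ false
      xz = trans (cong (adj G x) (sym τ)) xτz
        where
        τ : transpose x y ⟨$⟩ʳ z ≡ z
        τ rewrite ==-≢ z≢x | ==-≢ (y≢z ∘ sym) = refl
      z≢v : z ≢ v
      z≢v z≡v = not-both (subst (λ t → adj G y t ≡ true) z≡v yz) (adj-flip G vy)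
      x≢z = z≢x ∘ sym
      v≢y = y≢v ∘ sym
      G₁ = setEdge G v x v≢x false
      G₂ = setEdge G₁ y z y≢z false
      G₃ = setEdge G₂ v y v≢y true
      G₄ = setEdge G₃ x z x≢z true
      yz₁ : adj G₁ y z ≡ true
      yz₁ = trans (setEdge-other G v≢x false (v≢y ∘ proj₁) (x≢y ∘ proj₁)) yz
      vy₂ : adj G₂ v y ≡ false
      vy₂ = trans (setEdge-other G₁ y≢z false (y≢v ∘ proj₁) (z≢v ∘ proj₁))
           (trans (setEdge-other G v≢x false (x≢y ∘ proj₂) (v≢x ∘ sym ∘ proj₁)) vy)
      xz₃ : adj G₃ x z ≡ false
      xz₃ = trans (setEdge-other G₂ v≢y true (v≢x ∘ proj₁) (x≢y ∘ sym ∘ proj₁))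
           (trans (setEdge-other G₁ y≢z false (x≢y ∘ sym ∘ proj₁) (z≢x ∘ proj₁))
           (trans (setEdge-other G v≢x false (v≢x ∘ proj₁) (z≢v ∘ sym ∘ proj₂)) xz))
      deg₄ : ∀ u → deg G₄ u ≡ deg G u
      deg₄ u = collect (deg G u) (deg G₁ u) (deg G₂ u) (deg G₃ u) (deg G₄ u) ⟦ v == u ⟧ ⟦ x == u ⟧ ⟦ y == u ⟧ ⟦ z == u ⟧
        (trans (cong (λ b → deg G₁ u + ⟦ b ⟧ * (⟦ v == u ⟧ + ⟦ x == u ⟧)) (sym vx)) (setEdge-deg G v≢x false u))
        (trans (cong (λ b → deg G₂ u + ⟦ b ⟧ * (⟦ y == u ⟧ + ⟦ z == u ⟧)) (sym yz₁)) (setEdge-deg G₁ y≢z false u))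
        (trans (cong (λ b → deg G₃ u + ⟦ b ⟧ * (⟦ v == u ⟧ + ⟦ y == u ⟧)) (sym vy₂)) (setEdge-deg G₂ v≢y true u))
        (trans (cong (λ b → deg G₄ u + ⟦ b ⟧ * (⟦ x == u ⟧ + ⟦ z == u ⟧)) (sym xz₃)) (setEdge-deg G₃ x≢z true u))
        where
        collect : ∀ d d₁ d₂ d₃ d₄ v x y z → d₁ + 1 * (v + x) ≡ d + 0 → d₂ + 1 * (y + z) ≡ d₁ + 0 →
          d₃ + 0 ≡ d₂ + 1 * (v + y) → d₄ + 0 ≡ d₃ + 1 * (x + z) → d₄ ≡ d
        collect d d₁ d₂ d₃ d₄ v x y z e₁ e₂ e₃ e₄ = begin
          d₄ ≡⟨ +-identityʳ d₄ ⟨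
          d₄ + 0 ≡⟨ e₄ ⟩
          d₃ + 1 * (x + z) ≡⟨ cong (_+ 1 * (x + z)) (trans (sym (+-identityʳ d₃)) e₃) ⟩
          d₂ + 1 * (v + y) + 1 * (x + z) ≡⟨ ring₁ d₂ v x y z ⟩
          d₂ + 1 * (y + z) + 1 * (v + x) ≡⟨ cong (_+ 1 * (v + x)) (trans e₂ (+-identityʳ d₁)) ⟩
          d₁ + 1 * (v + x) ≡⟨ trans e₁ (+-identityʳ d) ⟩
          d ∎
          where
          open ≡-Reasoning
          ring₁ : ∀ d v x y z → d + 1 * (v + y) + 1 * (x + z) ≡ d + 1 * (y + z) + 1 * (v + x)
          ring₁ = solve-∀
      row : ∀ u → adj G₄ v u ≡ (if y == u then true else (if x == u then false else adj G v u))
      row u = trans (setEdge-other G₃ x≢z true (v≢x ∘ sym ∘ proj₁) (z≢v ∘ proj₁))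
        (trans (setEdge-row G₂ v≢y true u) (cong (λ b → if y == u then true else b)
        (trans (setEdge-other G₁ y≢z false (y≢v ∘ proj₁) (z≢v ∘ proj₁)) (setEdge-row G v≢x false u))))
      pointwise : ∀ u → ⟦ adj G₄ v u ⟧ * w u + ⟦ x == u ⟧ * w u ≡ ⟦ adj G v u ⟧ * w u + ⟦ y == u ⟧ * w u
      pointwise u = trans (cong (λ b → ⟦ b ⟧ * w u + ⟦ x == u ⟧ * w u) (row u)) (by (y ≟ u) (x ≟ u))
        where
        Goal = ⟦ if y == u then true else (if x == u then false else adj G v u) ⟧ * w u + ⟦ x == u ⟧ * w u ≡ ⟦ adj G v u ⟧ * w u + ⟦ y == u ⟧ * w u
        by : Dec (y ≡ u) → Dec (x ≡ u) → Goal
        by (yes refl) _ rewrite ==-refl y | ==-≢ x≢y | vy = +-comm (w y + 0) 0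
        by (no ne) (yes refl) rewrite ==-≢ ne | ==-refl x | vx = sym (+-identityʳ (w x + 0))
        by (no ne) (no ne′) rewrite ==-≢ ne | ==-≢ ne′ = refl
      weights : weight G₄ + w x ≡ weight G + w y
      weights = trans (cong (weight G₄ +_) (sym (∑-pick x w))) (trans (sym (∑-distrib-+ (λ u → ⟦ adj G₄ v u ⟧ * w u) _))
        (trans (∑-cong pointwise) (trans (∑-distrib-+ (λ u → ⟦ adj G v u ⟧ * w u) _) (cong (weight G +_) (∑-pick y w)))))
      heavier : weight G < weight G₄
      heavier = +-cancelʳ-< (w x) _ _ (<-≤-trans (+-monoʳ-< (weight G) wx<wy) (≤-reflexive (sym weights)))

  -- Havel–Hakimi: exchanges increase the total degree of the neighbours of v.
  havel-hakimi : ∀ G → (∀ u → deg G u ≡ w u) → ∃ λ G′ → (∀ u → deg G′ u ≡ w u) ×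
    (∀ x y → adj G′ v x ≡ true → adj G′ v y ≡ false → y ≢ v → w y ≤ w x)
  havel-hakimi G realizes = go (∑ w) G realizes (m≤m+n (∑ w) (weight G))
    where
    go : ∀ k G → (∀ u → deg G u ≡ w u) → ∑ w ≤ k + weight G → ∃ λ G′ → (∀ u → deg G′ u ≡ w u) ×
      (∀ x y → adj G′ v x ≡ true → adj G′ v y ≡ false → y ≢ v → w y ≤ w x)
    go k G realizes fuel with any? (λ x → any? (λ y → (adj G v x Bool.≟ true) ×-dec (adj G v y Bool.≟ false) ×-dec ¬? (y ≟ v) ×-dec (w x <? w y)))
    ... | no ¬bad = G , realizes , λ x y vx vy ne → ≮⇒≥ (λ lt → ¬bad (x , y , vx , vy , ne , lt))
    ... | yes (x , y , vx , vy , ne , lt) with exchange G realizes vx vy ne lt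
    go zero    G realizes fuel | _ | G′ , _ , heavier = contradiction (≤-trans heavier (weight≤ G′)) (≤⇒≯ fuel)
    go (suc k) G realizes fuel | _ | G′ , realizes′ , heavier = go k G′ realizes′
      (≤-trans fuel (≡-≤-trans (sym (+-suc k (weight G))) (+-monoʳ-≤ k heavier)))

-- How the degrees d change when v is deleted from a realization in which the neighbours of v, marked
-- by S, have the largest degrees; front v renames v to zero.
record Split {n} (d : Fin (suc n) → ℕ) (v : Fin (suc n)) : Set where
  field
    S     : Fin n → Bool
    rest  : Graph n
  e : Fin n → ℕ
  e u = d (front v ⟨$⟩ʳ suc u)
  field
    size  : # S ≡ d v
    split : ∀ u → ⟦ S u ⟧ + deg rest u ≡ e u
    dom   : ∀ x y → S x ≡ true → S y ≡ false → e y ≤ e x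

  total : ∑ d ≡ d v + (d v + ∑ (deg rest))
  total = trans (∑-permute d (front v)) (cong (d v +_)
    (trans (∑-cong (λ u → sym (split u))) (trans (∑-distrib-+ (λ u → ⟦ S u ⟧) (deg rest)) (cong (_+ ∑ (deg rest)) size))))

  split-in : ∀ {u} → S u ≡ true → suc (deg rest u) ≡ e u
  split-in {u} Su = trans (cong (λ b → ⟦ b ⟧ + deg rest u) (sym Su)) (split u)

  split-out : ∀ {u} → S u ≡ false → deg rest u ≡ e u
  split-out {u} Su = trans (cong (λ b → ⟦ b ⟧ + deg rest u) (sym Su)) (split u)

  rest≤e : ∀ u → deg rest u ≤ e u
  rest≤e u = ≤-≡-trans (m≤n+m _ ⟦ S u ⟧) (split u)

abstract
  split-off : ∀ {n} (G : Graph (suc n)) v → Split (deg G) v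
  split-off {n} G v with havel-hakimi v (deg G) G (λ _ → refl)
  ... | G′ , same , dom = record
    { S = λ u → adj H zero (suc u) ; rest = behead H
    ; size = trans (sym (deg-zero H)) (trans (deg-relabel π G′ zero) (same v))
    ; split = λ u → trans (sym (deg-suc H u)) (trans (deg-relabel π G′ (suc u)) (same _))
    ; dom = λ x y Sx Sy → dom _ _ Sx Sy (λ eq → 0≢suc (⟨$⟩ʳ-injective π (sym eq))) }
    where
    π : Permutation′ (suc n)
    π = front v
    H : Graph (suc n)
    H = relabel π G′
    0≢suc : ∀ {n} {j : Fin n} → Fin.zero ≢ suc j
    0≢suc ()

-- Plans whose core is a prescribed vertex

min-other : ∀ {n} → 1 ≤ n → (f : Fin (suc n) → ℕ) → ∀ c → ∃ λ v → v ≢ c × (∀ u → u ≢ c → f v ≤ f u)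
-- A minimum of `f` is a maximum of `∑ f ∸ f`, where nothing is truncated.
min-other {suc n} _ f c with argmax (λ i → ∑ f ∸ f (punchIn c i))
... | i , best = punchIn c i , punchInᵢ≢i c i , λ u u≢c →
  subst (λ w → f (punchIn c i) ≤ f w) (punchIn-punchOut (u≢c ∘ sym))
    (∸-cancelʳ-≤ (∑-term≤ f _) (best (punchOut (u≢c ∘ sym))))

two-members : ∀ {n} (S : Fin n → Bool) → 2 ≤ # S → ∃₂ λ x y → x ≢ y × S x ≡ true × S y ≡ true
two-members {n} S le with any? (λ x → S x Bool.≟ true)
... | no ¬x = contradiction (≤-trans le (≤-≡-trans (∑-mono none) (∑-zero n))) (λ ())
  where
  none : ∀ u → ⟦ S u ⟧ ≤ 0
  none u with S u in eq
  ... | true  = contradiction (u , eq) ¬x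
  ... | false = z≤n
... | yes (x , Sx) with any? (λ y → ¬? (x ≟ y) ×-dec (S y Bool.≟ true))
...   | yes (y , x≢y , Sy) = x , y , x≢y , Sx , Sy
...   | no ¬y = contradiction (≤-trans le (≤-≡-trans (∑-mono only) (∑-δ x))) (λ { (s≤s ()) })
  where
  only : ∀ u → ⟦ S u ⟧ ≤ ⟦ x == u ⟧
  only u with x ≟ u | S u in eq
  ... | yes _ | b     = ⟦⟧≤1 b
  ... | no ne | true  = contradiction (u , ne , eq) ¬y
  ... | no ne | false = z≤n

-- Parity: degree sums are even, so an odd slack can be rounded down.
even-bound : ∀ k m → 4 * k ≤ m + m + 5 → 4 * k ≤ m + m + 4
even-bound k m le = ≡-≤-trans (ring₁ k) (≤-≡-trans (half ⊕ half) (ring₂ m))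
  where
  ring₁ : ∀ k → 4 * k ≡ 2 * k + 2 * k
  ring₁ = solve-∀
  ring₂ : ∀ m → m + 2 + (m + 2) ≡ m + m + 4
  ring₂ = solve-∀
  half : 2 * k ≤ m + 2
  half = ≮⇒≥ λ lt → <-irrefl refl (linear {p = suc k} {q = k} 0 (le ⊕ lt ⊕ lt) (ring₃ k m))
    where
    ring₃ : ∀ k m → suc k + (m + m + 5 + 2 * k + 2 * k) + 0 ≡ k + (4 * k + suc (m + 2) + suc (m + 2))
    ring₃ = solve-∀

K₄-rooted : ∀ c → CubicPlan ⊤ {4} (λ _ → 3) c
K₄-rooted c = (λ u → below 1 (π ⟨$⟩ˡ u)) , unpermute-plan π K₄-plan , (λ _ u cu → root u _ refl cu) ,
  π ⟨$⟩ʳ suc zero , π ⟨$⟩ʳ suc (suc zero) , (λ eq → contradiction (⟨$⟩ʳ-injective π {suc zero} {suc (suc zero)} eq) (λ ())) ,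
  cong (below 1) (inverseˡ π {suc zero}) , cong (below 1) (inverseˡ π {suc (suc zero)})
  where
  π = front c
  root : ∀ u k → π ⟨$⟩ˡ u ≡ k → below 1 k ≡ true → u ≡ c
  root u zero eq _ = trans (sym (inverseʳ π)) (cong (π ⟨$⟩ʳ_) eq)
  root u (suc _) eq ()

RootedPlan : ∀ {n} → (Fin n → ℕ) → Fin n → Set
RootedPlan d c = ∃ λ core → Plan d core × CoreIn c core

-- With `d c ≤ 2` all degrees are at most 3 and the sum forces n ≤ 3; then all degrees are at most 2
-- and the sum forces n ≤ 2, too few vertices for degree 2.
root-degree≥3 : ∀ n (d : Fin n → ℕ) c → (∀ u → d u < n) → (∀ u → 2 ≤ d u) → (∀ u → d u ≤ suc (d c)) → 4 * n ≤ ∑ d + 4 → 3 ≤ d c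
root-degree≥3 n d c d< d≥2 d≤ enough = ≰⇒> λ dc≤2 → contradiction (n≤2 (n≤3 dc≤2)) (<⇒≱ (≤-<-trans (d≥2 c) (d< c)))
  where
  n≤3 : d c ≤ 2 → n ≤ 3
  n≤3 dc≤2 = linear 0 (enough ⊕ upper) (ring n (∑ d))
    where
    ring : ∀ n s → n + (s + 4 + n * 3) + 0 ≡ 3 + (4 * n + suc s)
    ring = solve-∀
    pointwise : ∀ u → ⟦ c == u ⟧ + d u ≤ 3
    pointwise u = by (c ≟ u)
      where
      by : Dec (c ≡ u) → ⟦ c == u ⟧ + d u ≤ 3
      by (yes refl) = ⟦⟧≤1 (c == c) ⊕ dc≤2
      by (no ne) rewrite ==-≢ ne = ≤-trans (d≤ u) (s≤s dc≤2)
    upper : suc (∑ d) ≤ n * 3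
    upper = ≡-≤-trans (sym (∑-mark c d)) (≤-≡-trans (∑-mono pointwise) (∑-const n 3))
  n≤2 : n ≤ 3 → n ≤ 2
  n≤2 n≤3 = *-cancelˡ-≤ 2 (linear 0 (enough ⊕ upper) (ring n (∑ d)))
    where
    ring : ∀ n s → 2 * n + (s + 4 + n * 2) + 0 ≡ 2 * 2 + (4 * n + s)
    ring = solve-∀
    upper : ∑ d ≤ n * 2
    upper = ≤-≡-trans (∑-mono (λ u → ≤-pred (≤-trans (d< u) n≤3))) (∑-const n 2)

-- The successor in the second clause leaves room for a root of largest degree that has just lost
-- its edge to a leaf. The third clause is m ≥ 2n - 2.
Admissible : ∀ {n} → Graph n → Fin n → Set
Admissible {n} G c = (∀ u → 2 ≤ deg G u) × (∀ u → deg G u ≤ suc (deg G c)) × 4 * n ≤ ∑ (deg G) + 4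

remove-vertex : ∀ {n} (G : Graph (suc n)) {c v} → Admissible G c → v ≢ c → (∀ u → u ≢ c → deg G v ≤ deg G u) →
  (3 ≤ deg G v → ∑ (deg G) + 4 ≢ 4 * suc n) →
  (∀ (F : Graph n) j → Admissible F j → RootedPlan (deg F) j) → RootedPlan (deg G) c
remove-vertex {n} G {c} {v} (d≥2 , d≤ , enough) v≢c v-min slack recurse =
    let (core , P , root) = recurse rest j (rest≥2 , rest≤ , rest-enough)
        (x , y , x≢y , Sx , Sy) = two-members S (≤-≡-trans (d≥2 v) (sym size))
    in _ , unpermute-plan (front v) (plan-cong (λ { zero → size ; (suc u) → split u }) (extend S x≢y Sx Sy P)) ,
       coreIn-unpermute v j≡ root
  where
  open Split (split-off G v)
  k = deg G v
  j,≡ = front-other {v = v} {c} (v≢c ∘ sym)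
  j = proj₁ j,≡
  j≡ : front v ⟨$⟩ʳ suc j ≡ c
  j≡ = proj₂ j,≡
  dc≥3 = root-degree≥3 (suc n) (deg G) c (deg< G) d≥2 d≤ enough
  ej≥3 : 3 ≤ e j
  ej≥3 = subst (λ w → 3 ≤ deg G w) (sym j≡) dc≥3
  e≥k : ∀ u → j ≢ u → k ≤ e u
  e≥k u ne = v-min _ (λ eq → ne (sucᶠ-injective (⟨$⟩ʳ-injective (front v) (trans j≡ (sym eq)))))
  enough′ : 4 * suc n ≤ k + (k + ∑ (deg rest)) + 4
  enough′ = subst (λ t → 4 * suc n ≤ t + 4) total enough
  n≥2 : 2 ≤ n
  n≥2 = ≤-trans (d≥2 v) (≤-pred (deg< G v))
  e-total : k + ∑ (deg rest) ≡ ∑ e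
  e-total = +-cancelˡ-≡ k _ _ (trans (sym total) (∑-permute (deg G) (front v)))
  e≥3-in : ∀ u → S u ≡ true → 3 ≤ e u
  e≥3-in u Su with 3 ≤? k
  ... | yes k≥3 with j ≟ u
  ...   | yes refl = ej≥3
  ...   | no ne = ≤-trans k≥3 (e≥k u ne)
  -- Here `v` has degree 2. If its neighbour `u` had degree at most 2, so would all non-neighbours,
  -- and only the other neighbour of `v` could be large: too few edges.
  e≥3-in u Su | no k≱3 = ≰⇒> λ eu≤2 → arith n k (∑ (deg rest)) (n ∸ 2) (sym (m+[n∸m]≡n n≥2))
      (≤-antisym (≤-pred (≰⇒> k≱3)) (d≥2 v)) enough′ (upper eu≤2)
    where
    arith : ∀ n k F t → n ≡ 2 + t → k ≡ 2 → 4 * suc n ≤ k + (k + F) + 4 → k + F + t ≤ n * 2 + k * t → ⊥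
    arith _ _ F t refl refl h₁ h₂ = contradiction (linear {p = 1} {q = 0} (suc t) (h₁ ⊕ h₂) (ring F t)) (λ ())
      where
      ring : ∀ F t → 1 + (2 + (2 + F) + 4 + ((2 + t) * 2 + 2 * t)) + suc t ≡ 4 * suc (2 + t) + (2 + F + t)
      ring = solve-∀
    upper : e u ≤ 2 → k + ∑ (deg rest) + (n ∸ 2) ≤ n * 2 + k * (n ∸ 2)
    upper eu≤2 = begin
      k + ∑ (deg rest) + t ≡⟨ trans (cong (_+ t) e-total) (sym (∑-bump u t e)) ⟩
      ∑ (λ w → e w + ⟦ u == w ⟧ * t) ≤⟨ ∑-mono pointwise ⟩
      ∑ (λ w → 2 + ⟦ S w ⟧ * t) ≡⟨ trans (∑-shift 2 (λ w → ⟦ S w ⟧ * t)) (cong (n * 2 +_) (∑-*ʳ (λ w → ⟦ S w ⟧) t)) ⟩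
      n * 2 + # S * t ≡⟨ cong (λ s → n * 2 + s * t) size ⟩
      n * 2 + k * t ∎
      where
      open ≤-Reasoning
      t = n ∸ 2
      pointwise : ∀ w → e w + ⟦ u == w ⟧ * t ≤ 2 + ⟦ S w ⟧ * t
      pointwise w = by (u ≟ w)
        where
        by : Dec (u ≡ w) → e w + ⟦ u == w ⟧ * t ≤ 2 + ⟦ S w ⟧ * t
        by (yes refl) rewrite ==-refl u | Su = +-monoˡ-≤ (t + 0) eu≤2
        by (no ne) rewrite ==-≢ ne with S w in Sw
        ... | true  = ≡-≤-trans (+-identityʳ (e w)) (≤-≡-trans (≤-pred (deg< G _))
                        (trans (sym (m+[n∸m]≡n n≥2)) (cong (2 +_) (sym (+-identityʳ t)))))
        ... | false = +-monoˡ-≤ 0 (≤-trans (dom u w Su Sw) eu≤2)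
  rest≥2 : ∀ u → 2 ≤ deg rest u
  rest≥2 u with S u in Su
  ... | true  = ≤-pred (≤-≡-trans (e≥3-in u Su) (sym (split-in Su)))
  ... | false = ≤-≡-trans (d≥2 _) (sym (split-out Su))
  rest≤ : ∀ u → deg rest u ≤ suc (deg rest j)
  rest≤ u with S j in Sj | S u in Su
  ... | false | _ = ≤-trans (rest≤e u) (≤-trans e≤ (s≤s (≤-reflexive (sym (split-out Sj)))))
    where
    e≤ : e u ≤ suc (e j)
    e≤ = subst (λ w → e u ≤ suc (deg G w)) (sym j≡) (d≤ _)
  -- The root loses an edge and `u` does not; the bound holds because neighbours of `v` have the
  -- larger degrees.
  ... | true | false = ≤-trans (rest≤e u) (≤-≡-trans (dom j u Sj Su) (sym (split-in Sj)))
  ... | true | true = ≤-pred (≡-≤-trans (split-in Su) (≤-trans e≤ (s≤s (≤-reflexive (sym (split-in Sj))))))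
    where
    e≤ : e u ≤ suc (e j)
    e≤ = subst (λ w → e u ≤ suc (deg G w)) (sym j≡) (d≤ _)
  rest-enough : 4 * n ≤ ∑ (deg rest) + 4
  rest-enough with 3 ≤? k
  ... | no k≱3 = let k≤2 = ≤-pred (≰⇒> k≱3) in linear 0 (enough′ ⊕ k≤2 ⊕ k≤2) (ring n k (∑ (deg rest)))
    where
    ring : ∀ n k F → 4 * n + (k + (k + F) + 4 + 2 + 2) + 0 ≡ F + 4 + (4 * suc n + k + k)
    ring = solve-∀
  -- The estimates below fall short by one; the evenness of the degree sum makes up for it.
  ... | yes k≥3 with handshake rest
  ...   | m , F≡ = subst (λ t → 4 * n ≤ t + 4) (sym F≡) (even-bound n m (subst (λ t → 4 * n ≤ t + 5) F≡ almost))
    where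
    almost : 4 * n ≤ ∑ (deg rest) + 5
    almost with 4 ≤? k
    ... | no k≱4 = let k≤3 = ≤-pred (≰⇒> k≱4) in linear 0 (strict ⊕ k≤3 ⊕ k≤3) (ring n k (∑ (deg rest)))
      where
      strict : suc (4 * suc n) ≤ k + (k + ∑ (deg rest)) + 4
      strict = ≤∧≢⇒< enough′ (λ eq → slack k≥3 (trans (cong (_+ 4) total) (sym eq)))
      ring : ∀ n k F → 4 * n + (k + (k + F) + 4 + 3 + 3) + 0 ≡ F + 5 + (suc (4 * suc n) + k + k)
      ring = solve-∀
    -- No tightness matters here: all degrees but that of the root are at least `k`, the root has at
    -- least 3, so what remains sums to at least (n-2)k + 3.
    ... | yes k≥4 = arith n k (∑ (deg rest)) (n ∸ 2) (sym (m+[n∸m]≡n n≥2)) k≥4 lower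
      where
      arith : ∀ n k F t → n ≡ 2 + t → 4 ≤ k → n * k + 3 ≤ k + F + k → 4 * n ≤ F + 5
      arith _ k F t refl h₁ h₂ = linear 0 (h₂ ⊕ *-monoʳ-≤ t h₁) (ring k F t)
        where
        ring : ∀ k F t → 4 * (2 + t) + (k + F + k + t * k) + 0 ≡ F + 5 + ((2 + t) * k + 3 + t * 4)
        ring = solve-∀
      pointwise : ∀ u → k + ⟦ j == u ⟧ * 3 ≤ e u + ⟦ j == u ⟧ * k
      pointwise u = by (j ≟ u)
        where
        by : Dec (j ≡ u) → k + ⟦ j == u ⟧ * 3 ≤ e u + ⟦ j == u ⟧ * k
        by (yes refl) rewrite ==-refl j = ≡-≤-trans (+-comm k 3) (ej≥3 ⊕ ≤-reflexive (sym (+-identityʳ k)))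
        by (no ne) rewrite ==-≢ ne = +-monoˡ-≤ 0 (e≥k u ne)
      lower : n * k + 3 ≤ k + ∑ (deg rest) + k
      lower = begin
        n * k + 3 ≡⟨ trans (cong (_+ 3) (sym (∑-const n k))) (sym (∑-bump j 3 (λ _ → k))) ⟩
        ∑ (λ u → k + ⟦ j == u ⟧ * 3) ≤⟨ ∑-mono pointwise ⟩
        ∑ (λ u → e u + ⟦ j == u ⟧ * k) ≡⟨ trans (∑-bump j k e) (cong (_+ k) (sym e-total)) ⟩
        k + ∑ (deg rest) + k ∎
        where open ≤-Reasoning

-- Deletion fails only if the sequence is tight and all degrees other than that of the root are at
-- least 3; the root then has degree at least 3 too, and the cubic reduction applies.
rooted-plan : ∀ n (G : Graph n) c → Admissible G c → RootedPlan (deg G) c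
rooted-plan (suc n) G c adm@(d≥2 , d≤ , enough) with min-other (≤-trans (<⇒≤ (d≥2 c)) (≤-pred (deg< G c))) (deg G) c
... | v , v≢c , v-min with 3 ≤? deg G v | ∑ (deg G) + 4 ℕ.≟ 4 * suc n
...   | yes dv≥3 | yes tight =
    let (core , P , root , _) = min-degree-3-plan ⊤ 4 ≤-refl K₄-rooted (suc n) (deg G) c d≥3 tight
    in core , P , root tt
  where
  d≥3 : ∀ u → 3 ≤ deg G u
  d≥3 u with u ≟ c
  ... | yes refl = root-degree≥3 (suc n) (deg G) c (deg< G) d≥2 d≤ enough
  ... | no ne    = ≤-trans dv≥3 (v-min u ne)
...   | no dv≱3 | _ = remove-vertex G adm v≢c v-min (λ le → contradiction le dv≱3) (rooted-plan n)
...   | yes _ | no slack = remove-vertex G adm v≢c v-min (λ _ → slack) (rooted-plan n)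

-- Havel-Hakimi lets the leaf hang on a vertex of largest degree, which is what `Admissible` asks of
-- the root. Deleting vertex and edge turns m ≥ 2n - 3 into the bound m ≥ 2n - 2 for the rest.
leaf-plan : ∀ n (G : Graph (suc n)) ℓ → 2 ≤ n → deg G ℓ ≡ 1 → (∀ u → u ≢ ℓ → 2 ≤ deg G u) →
  4 * suc n ≤ ∑ (deg G) + 6 → ∃ (Plan (deg G))
leaf-plan n G ℓ n≥2 one d≥2 enough with any? (λ c → Split.S (split-off G ℓ) c Bool.≟ true)
... | no ¬c = contradiction (trans (sym one) (trans (sym size) (trans (∑-cong none) (∑-zero n)))) (λ ())
  where
  open Split (split-off G ℓ)
  none : ∀ u → ⟦ S u ⟧ ≡ 0
  none u with S u in Su
  ... | true  = contradiction (u , Su) ¬c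
  ... | false = refl
... | yes (c , Sc) =
    let (core , P , root) = rooted-plan n rest c (rest≥2 , (λ u → ≤-trans (rest≤e u) (≤-≡-trans (c-max u) (sym (split-in Sc)))) , rest-enough)
    in _ , unpermute-plan (front ℓ) (plan-cong (λ { zero → sym one ; (suc u) → trans (cong (_+ deg rest u) (only u)) (split u) })
             (attach-leaf c root P))
  where
  open Split (split-off G ℓ)
  only : ∀ u → ⟦ c == u ⟧ ≡ ⟦ S u ⟧
  only u with c ≟ u | S u in Su
  ... | yes refl | _     = sym (cong ⟦_⟧ (trans (sym Su) Sc))
  ... | no _     | false = refl
  ... | no c≢u   | true  = contradiction (≤-≡-trans two-terms (trans size one)) (λ { (s≤s ()) })
    where
    two-terms : 2 ≤ # S
    two-terms = ≡-≤-trans (sym (∑-pair c≢u)) (∑-mono pointwise)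
      where
      pointwise : ∀ w → ⟦ (c == w) ∨ (u == w) ⟧ ≤ ⟦ S w ⟧
      pointwise w with c ≟ w | u ≟ w
      ... | yes refl | _        = ≤-reflexive (sym (cong ⟦_⟧ Sc))
      ... | no _     | yes refl = ≤-reflexive (sym (cong ⟦_⟧ Su))
      ... | no _     | no _     = z≤n
  c-max : ∀ u → e u ≤ e c
  c-max u with S u in Su
  ... | false = dom c u Sc Su
  ... | true  = ≤-reflexive (cong e (same u Su))
    where
    same : ∀ u → S u ≡ true → u ≡ c
    same u Su with c ≟ u | only u
    ... | yes c≡u | _ = sym c≡u
    ... | no _ | eq = contradiction (trans eq (cong ⟦_⟧ Su)) (λ ())
  e≥2 : ∀ u → 2 ≤ e u
  e≥2 u = d≥2 _ (λ eq → contradiction (⟨$⟩ʳ-injective (front ℓ) {suc u} {zero} eq) (λ ()))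
  total′ : ∑ (deg G) ≡ 2 + ∑ (deg rest)
  total′ = trans total (cong (λ t → t + (t + ∑ (deg rest))) one)
  -- `e c` is the maximum; were it at most 2, the degree sum would be too small.
  ec≥3 : 3 ≤ e c
  ec≥3 = ≰⇒> λ ec≤2 → contradiction n≥2 (<⇒≱ (s≤s (half n (linear 0 (subst (λ t → 4 * suc n ≤ t + 6) total′ enough ⊕ upper ec≤2) (ring n (∑ (deg rest)))))))
    where
    ring : ∀ n F → 2 * n + (2 + F + 6 + n * 2) + 0 ≡ 3 + (4 * suc n + (1 + F))
    ring = solve-∀
    half : ∀ n → 2 * n ≤ 3 → n ≤ 1
    half zero _ = z≤n
    half (suc zero) _ = ≤-refl
    half (suc (suc n)) (s≤s le) = contradiction (≡-≤-trans (sym (ring₂ n)) le) (λ { (s≤s (s≤s ())) })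
      where
      ring₂ : ∀ n → suc n + suc (suc n + 0) ≡ 3 + 2 * n
      ring₂ = solve-∀
    upper : e c ≤ 2 → 1 + ∑ (deg rest) ≤ n * 2
    upper ec≤2 = ≡-≤-trans (+-cancelˡ-≡ 1 _ _ (trans (sym total′) (trans (∑-permute (deg G) (front ℓ)) (cong (_+ ∑ e) one))))
      (≤-≡-trans (∑-mono (λ u → ≤-trans (c-max u) ec≤2)) (∑-const n 2))
  rest≥2 : ∀ u → 2 ≤ deg rest u
  rest≥2 u with S u in Su
  ... | false = ≤-≡-trans (e≥2 u) (sym (split-out Su))
  ... | true with c ≟ u | only u
  ...   | yes refl | _ = ≤-pred (≤-≡-trans ec≥3 (sym (split-in Sc)))
  ...   | no _ | eq = contradiction (trans eq (cong ⟦_⟧ Su)) (λ ())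
  rest-enough : 4 * n ≤ ∑ (deg rest) + 4
  rest-enough = linear 0 (subst (λ t → 4 * suc n ≤ t + 6) total′ enough) (ring n (∑ (deg rest)))
    where
    ring : ∀ n F → 4 * n + (2 + F + 6) + 0 ≡ F + 4 + 4 * suc n
    ring = solve-∀

-- Sequences of calls

Call : ℕ → Set
Call n = Fin n × Fin n

Joins : ∀ {n} → Call n → Fin n → Fin n → Set
Joins c u v = c ≡ (u , v) ⊎ c ≡ (v , u)

joins-sym : ∀ {n} {c : Call n} {u v} → Joins c u v → Joins c v u
joins-sym (inj₁ e) = inj₂ e
joins-sym (inj₂ e) = inj₁ e

joins-cases : ∀ {n} {c : Call n} {u v s t} → Joins c u v → Joins c s t → (s ≡ u × t ≡ v) ⊎ (s ≡ v × t ≡ u)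
joins-cases (inj₁ refl) (inj₁ refl) = inj₁ (refl , refl)
joins-cases (inj₁ refl) (inj₂ refl) = inj₂ (refl , refl)
joins-cases (inj₂ refl) (inj₁ refl) = inj₂ (refl , refl)
joins-cases (inj₂ refl) (inj₂ refl) = inj₁ (refl , refl)

joins-unique : ∀ {n} {c : Call n} {u v w} → Joins c u v → Joins c u w → v ≡ w
joins-unique j j′ with joins-cases j j′
... | inj₁ (_ , eq)    = sym eq
... | inj₂ (refl , eq) = sym eq

joins-map : ∀ {m n} (f : Fin m → Fin n) {c u v} → Joins c u v → Joins (Product.map f f c) (f u) (f v)
joins-map f (inj₁ refl) = inj₁ refl
joins-map f (inj₂ refl) = inj₂ refl

-- L ⊢ x ⇝ y: after the calls of L, made in that order, y knows what x knew at the beginning.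
infix 4 _⊢_⇝_
data _⊢_⇝_ {n} : List (Call n) → Fin n → Fin n → Set where
  done : ∀ {x} → [] ⊢ x ⇝ x
  skip : ∀ {c L x y} → L ⊢ x ⇝ y → c ∷ L ⊢ x ⇝ y
  hop  : ∀ {c L x v y} → Joins c x v → L ⊢ v ⇝ y → c ∷ L ⊢ x ⇝ y

Complete : ∀ {n} → List (Call n) → Set
Complete L = ∀ x y → L ⊢ x ⇝ y

stay : ∀ {n} (L : List (Call n)) {x} → L ⊢ x ⇝ x
stay []      = done
stay (c ∷ L) = skip (stay L)

start-≡ : ∀ {n} {L : List (Call n)} {s t y} → s ≡ t → L ⊢ s ⇝ y → L ⊢ t ⇝ y
start-≡ refl p = p

infixr 5 _+⇝+_
_+⇝+_ : ∀ {n} {L L′ : List (Call n)} {x y z} → L ⊢ x ⇝ y → L′ ⊢ y ⇝ z → L ++ L′ ⊢ x ⇝ z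
done    +⇝+ q = q
skip p  +⇝+ q = skip (p +⇝+ q)
hop j p +⇝+ q = hop j (p +⇝+ q)

unappend : ∀ {n} (L : List (Call n)) {L′ x z} → L ++ L′ ⊢ x ⇝ z → ∃ λ y → L ⊢ x ⇝ y × L′ ⊢ y ⇝ z
unappend []      p         = _ , done , p
unappend (_ ∷ L) (skip p)  = Product.map₂ (Product.map₁ skip) (unappend L p)
unappend (_ ∷ L) (hop j p) = Product.map₂ (Product.map₁ (hop j)) (unappend L p)

map-⇝ : ∀ {m n} (f : Fin m → Fin n) {L x y} → L ⊢ x ⇝ y → map (Product.map f f) L ⊢ f x ⇝ f y
map-⇝ f done      = done
map-⇝ f (skip p)  = skip (map-⇝ f p)
map-⇝ f (hop j p) = hop (joins-map f j) (map-⇝ f p)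

reach? : ∀ {n} (L : List (Call n)) x y → Dec (L ⊢ x ⇝ y)
reach? [] x y = map′ (λ { refl → done }) (λ { done → refl }) (x ≟ y)
reach? ((a , b) ∷ L) x y = map′ to from (reach? L x y ⊎-dec ((x ≟ a) ×-dec reach? L b y) ⊎-dec ((x ≟ b) ×-dec reach? L a y))
  where
  to : L ⊢ x ⇝ y ⊎ (x ≡ a × L ⊢ b ⇝ y) ⊎ (x ≡ b × L ⊢ a ⇝ y) → (a , b) ∷ L ⊢ x ⇝ y
  to (inj₁ p)                 = skip p
  to (inj₂ (inj₁ (refl , p))) = hop (inj₁ refl) p
  to (inj₂ (inj₂ (refl , p))) = hop (inj₂ refl) p
  from : (a , b) ∷ L ⊢ x ⇝ y → L ⊢ x ⇝ y ⊎ (x ≡ a × L ⊢ b ⇝ y) ⊎ (x ≡ b × L ⊢ a ⇝ y)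
  from (skip p)            = inj₁ p
  from (hop (inj₁ refl) p) = inj₂ (inj₁ (refl , p))
  from (hop (inj₂ refl) p) = inj₂ (inj₂ (refl , p))

LoopFree : ∀ {n} → List (Call n) → Set
LoopFree = All (λ (a , b) → a ≢ b)

-- Identifying two participants can create calls of somebody with himself; they transmit nothing.
unloop : ∀ {n} (L : List (Call n)) → ∃ λ L′ → LoopFree L′ × length L′ ≤ length L × (∀ {x y} → L ⊢ x ⇝ y → L′ ⊢ x ⇝ y)
unloop [] = [] , [] , z≤n , id
unloop ((a , b) ∷ L) with unloop L | a ≟ b
... | L′ , lf , le , f | yes refl = L′ , lf , m≤n⇒m≤1+n le , λ { (skip p) → f p ; (hop (inj₁ refl) p) → f p ; (hop (inj₂ refl) p) → f p }
... | L′ , lf , le , f | no ne = (a , b) ∷ L′ , ne ∷ lf , s≤s le , λ { (skip p) → skip (f p) ; (hop j p) → hop j (f p) }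

-- Information has to leave `x` by a call to some `y` and to come back by later calls; information
-- that merely stays at `x` does not count.
data Hears {n} (x : Fin n) : List (Call n) → Set where
  now   : ∀ {c y L} → Joins c x y → y ≢ x → L ⊢ y ⇝ x → Hears x (c ∷ L)
  later : ∀ {c L} → Hears x L → Hears x (c ∷ L)

hears? : ∀ {n} (x : Fin n) L → Dec (Hears x L)
hears? x [] = no λ ()
hears? x ((a , b) ∷ L) = map′ to from (hears? x L ⊎-dec
    ((a ≟ x) ×-dec ¬? (b ≟ x) ×-dec reach? L b x) ⊎-dec ((b ≟ x) ×-dec ¬? (a ≟ x) ×-dec reach? L a x))
  where
  Head = Hears x L ⊎ (a ≡ x × b ≢ x × L ⊢ b ⇝ x) ⊎ (b ≡ x × a ≢ x × L ⊢ a ⇝ x)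
  to : Head → Hears x ((a , b) ∷ L)
  to (inj₁ h) = later h
  to (inj₂ (inj₁ (refl , ne , p))) = now (inj₁ refl) ne p
  to (inj₂ (inj₂ (refl , ne , p))) = now (inj₂ refl) ne p
  from : Hears x ((a , b) ∷ L) → Head
  from (now (inj₁ refl) ne p) = inj₂ (inj₁ (refl , ne , p))
  from (now (inj₂ refl) ne p) = inj₂ (inj₂ (refl , ne , p))
  from (later h)              = inj₁ h

round-trip : ∀ {n} {x a : Fin n} {L₁ L₂} → L₁ ⊢ x ⇝ a → L₂ ⊢ a ⇝ x → a ≢ x → Hears x (L₁ ++ L₂)
round-trip done     q ne = contradiction refl ne
round-trip (skip p) q ne = later (round-trip p q ne)
round-trip {x = x} (hop {v = b} j p) q ne with b ≟ x
... | yes refl = later (round-trip p q ne)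
... | no b≢x   = now j b≢x (p +⇝+ q)

sub : ∀ {n} → Fin n → Fin n → Fin n → Fin n
sub x y u with u ≟ x
... | yes _ = y
... | no  _ = u

sub-same : ∀ {n} (x y : Fin n) → sub x y x ≡ y
sub-same x y with x ≟ x
... | yes _ = refl
... | no ne = contradiction refl ne

sub-other : ∀ {n} {x u : Fin n} y → u ≢ x → sub x y u ≡ u
sub-other {x = x} {u} y ne with u ≟ x
... | yes eq = contradiction eq ne
... | no _   = refl

subCall : ∀ {n} → Fin n → Fin n → Call n → Call n
subCall x y = Product.map (sub x y) (sub x y)

-- L′ simulates L, with x played at the start by y.
Simulates : ∀ {n} → Fin n → Fin n → List (Call n) → List (Call n) → Set
Simulates x y L L′ = ∀ {u w} → w ≢ x → L ⊢ u ⇝ w → L′ ⊢ sub x y u ⇝ w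

simulate-∷ : ∀ {n} {x y : Fin n} {L L′} c → Simulates x y L L′ → Simulates x y (c ∷ L) (subCall x y c ∷ L′)
simulate-∷         _ sim ne (skip p)  = skip (sim ne p)
simulate-∷ {x = x} _ sim ne (hop j p) = hop (joins-map (sub x _) j) (sim ne p)

simulate-drop : ∀ {n} {x y : Fin n} {c L L′} → y ≢ x → Joins c y x → Simulates x y L L′ → Simulates x y (c ∷ L) L′
simulate-drop                 ne j sim w≢x (skip p) = sim w≢x p
simulate-drop {x = x} {y = y} ne j sim w≢x (hop j′ p) with joins-cases j j′
... | inj₁ (refl , refl) = start-≡ (trans (sub-same x y) (sym (sub-other y ne))) (sim w≢x p)
... | inj₂ (refl , refl) = start-≡ (trans (sub-other y ne) (sym (sub-same x y))) (sim w≢x p)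

-- Wherever the information of x travels on its way back to x, its carrier can play the part of x;
-- the call by which it returns to x becomes superfluous.
close : ∀ {n} {x y : Fin n} {L} → y ≢ x → L ⊢ y ⇝ x → ∃ λ L′ → length L ≡ suc (length L′) × Simulates x y L L′
close ne done = contradiction refl ne
close {x = x} {y} ne (skip {c} p) with close ne p
... | L′ , len , sim = subCall x y c ∷ L′ , cong suc len , simulate-∷ c sim
close {x = x} {y} ne (hop {c} {L} {v = v} j p) with v ≟ x
... | yes refl = map (subCall x y) L , cong suc (sym (length-map _ L)) ,
      simulate-drop ne j (λ w≢x p → subst (λ t → map (subCall x y) L ⊢ _ ⇝ t) (sub-other y w≢x) (map-⇝ (sub x y) p))
... | no v≢x with close v≢x p
...   | L′ , len , sim₀ = c ∷ L′ , cong suc len , sim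
  where
  sim : Simulates x y (c ∷ L) (c ∷ L′)
  sim w≢x (hop j′ p) with joins-cases j j′
  ... | inj₁ (refl , refl) = start-≡ (sym (sub-other y ne)) (hop j (start-≡ (sub-other v v≢x) (sim₀ w≢x p)))
  ... | inj₂ (refl , refl) = start-≡ (sym (sub-other y v≢x)) (hop (joins-sym j) (start-≡ (sub-other v ne) (sim₀ w≢x p)))
  sim {u} w≢x (skip p) with u ≟ x
  ... | yes refl = hop j (start-≡ (sub-same x v) (sim₀ w≢x p))
  ... | no u≢x   = skip (start-≡ (sub-other v u≢x) (sim₀ w≢x p))

-- Two calls are saved: the one from `x` to `y`, as `y` plays both parts up to it, and the one by
-- which the information returns.
bypass : ∀ {n} {x : Fin n} {L} → Hears x L → ∃₂ λ y L′ → y ≢ x × length L ≡ 2 + length L′ × Simulates x y L L′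
bypass {x = x} (now {y = y} j ne p) with close ne p
... | L′ , len , sim = y , L′ , ne , cong suc len , simulate-drop ne (joins-sym j) sim
bypass {x = x} (later {c} h) with bypass h
... | y , L′ , ne , len , sim = y , subCall x y c ∷ L′ , ne , cong suc len , simulate-∷ c sim

-- The shortened list may still mention `x`; `r` identifies `x` with its substitute `y`, which
-- leaves one vertex fewer.
delete-vertex : ∀ {n} {x : Fin (suc n)} {L} → Complete L → Hears x L →
  ∃ λ (L′ : List (Call n)) → Complete L′ × length L ≡ 2 + length L′
delete-vertex {n} {x} {L} complete h with bypass h
... | y , L′ , y≢x , len , sim = map (Product.map r r) L′ ,
    (λ i j → subst₂ (λ s t → map (Product.map r r) L′ ⊢ s ⇝ t)
       (trans (cong r (sub-other y (punchInᵢ≢i x i))) (r-punchIn i)) (r-punchIn j)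
       (map-⇝ r (sim (punchInᵢ≢i x j) (complete (punchIn x i) (punchIn x j))))) ,
    trans len (cong (2 +_) (sym (length-map _ L′)))
  where
  r : Fin (suc n) → Fin n
  r u with x ≟ u
  ... | yes _  = punchOut (y≢x ∘ sym)
  ... | no x≢u = punchOut x≢u
  r-punchIn : ∀ i → r (punchIn x i) ≡ i
  r-punchIn i with x ≟ punchIn x i
  ... | yes eq = contradiction (sym eq) (punchInᵢ≢i x i)
  ... | no ne  = trans (punchOut-cong x refl) (punchOut-punchIn x)

-- Counting over positions in a list of calls; components

module _ {n : ℕ} where

  private
    Calls = List (Call n)
    SplitFun = Calls → Call n → Calls → ℕ

  -- The sum of g over all ways to write L as p ++ e ∷ q, the prefix pre being prepended to p.
  Sp : SplitFun → Calls → Calls → ℕ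
  Sp g pre []      = 0
  Sp g pre (e ∷ L) = g pre e L + Sp g (pre ++ e ∷ []) L

  tally : (Calls → Call n → Calls → Bool) → Calls → ℕ
  tally g L = Sp (λ p c q → ⟦ g p c q ⟧) [] L

  AllS : (Calls → Call n → Calls → Set) → Calls → Calls → Set
  AllS Q pre []      = ⊤
  AllS Q pre (e ∷ L) = Q pre e L × AllS Q (pre ++ e ∷ []) L

  allS : ∀ {Q} pre L → (∀ p e q → p ++ e ∷ q ≡ pre ++ L → Q p e q) → AllS Q pre L
  allS pre []      f = tt
  allS pre (e ∷ L) f = f pre e L refl , allS (pre ++ e ∷ []) L (λ p e′ q eq → f p e′ q (trans eq (++-assoc pre (e ∷ []) L)))

  allS-at : ∀ {Q} pre p {e q} → AllS Q pre (p ++ e ∷ q) → Q (pre ++ p) e q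
  allS-at {Q} pre []      {e} {q} (h , _) = subst (λ r → Q r e q) (sym (++-identityʳ pre)) h
  allS-at {Q} pre (c ∷ p) {e} {q} (_ , h) = subst (λ r → Q r e q) (++-assoc pre (c ∷ []) p) (allS-at (pre ++ c ∷ []) p h)

  Sp-mono : ∀ {g h} pre L → AllS (λ p e q → g p e q ≤ h p e q) pre L → Sp g pre L ≤ Sp h pre L
  Sp-mono pre []      _        = z≤n
  Sp-mono pre (e ∷ L) (le , r) = le ⊕ Sp-mono (pre ++ e ∷ []) L r

  Sp-+ : ∀ g h pre L → Sp (λ p e q → g p e q + h p e q) pre L ≡ Sp g pre L + Sp h pre L
  Sp-+ g h pre []      = refl
  Sp-+ g h pre (e ∷ L) = trans (cong (g pre e L + h pre e L +_) (Sp-+ g h (pre ++ e ∷ []) L))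
    (shuffle (g pre e L) (h pre e L) (Sp g (pre ++ e ∷ []) L) (Sp h (pre ++ e ∷ []) L))
    where
    shuffle : ∀ a b c d → a + b + (c + d) ≡ a + c + (b + d)
    shuffle = solve-∀

  Sp-double : ∀ g pre L → Sp (λ p e q → 2 * g p e q) pre L ≡ 2 * Sp g pre L
  Sp-double g pre []      = refl
  Sp-double g pre (e ∷ L) = trans (cong (2 * g pre e L +_) (Sp-double g (pre ++ e ∷ []) L)) (sym (*-distribˡ-+ 2 (g pre e L) _))

  Sp-1 : ∀ pre L → Sp (λ _ _ _ → 1) pre L ≡ length L
  Sp-1 pre []      = refl
  Sp-1 pre (e ∷ L) = cong suc (Sp-1 (pre ++ e ∷ []) L)

  Sp-∑ : ∀ {m} (g : Fin m → SplitFun) pre L → Sp (λ p e q → ∑ (λ v → g v p e q)) pre L ≡ ∑ (λ v → Sp (g v) pre L)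
  Sp-∑ {m} g pre []      = sym (∑-zero m)
  Sp-∑ {m} g pre (e ∷ L) = trans (cong (∑ (λ v → g v pre e L) +_) (Sp-∑ g (pre ++ e ∷ []) L))
    (sym (∑-distrib-+ (λ v → g v pre e L) (λ v → Sp (g v) (pre ++ e ∷ []) L)))

  Sp-term : ∀ g pre p {e q} → g (pre ++ p) e q ≤ Sp g pre (p ++ e ∷ q)
  Sp-term g pre [] {e} {q} = ≡-≤-trans (cong (λ r → g r e q) (++-identityʳ pre)) (m≤m+n _ _)
  Sp-term g pre (c ∷ p) {e} {q} = ≡-≤-trans (cong (λ r → g r e q) (sym (++-assoc pre (c ∷ []) p)))
    (≤-trans (Sp-term g (pre ++ c ∷ []) p) (m≤n+m _ _))

  Sp-positive : ∀ g pre L → 1 ≤ Sp g pre L → ∃ λ p → ∃₂ λ e q → p ++ e ∷ q ≡ pre ++ L × 1 ≤ g p e q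
  Sp-positive g pre (e ∷ L) le with 1 ≤? g pre e L
  ... | yes pos = pre , e , L , refl , pos
  ... | no ¬pos with Sp-positive g (pre ++ e ∷ []) L (≤-≡-trans le (cong (_+ Sp g (pre ++ e ∷ []) L) (n<1⇒n≡0 (≰⇒> ¬pos))))
  ...   | p , e′ , q , eq , pos = p , e′ , q , trans eq (++-assoc pre (e ∷ []) L) , pos

  private
    gain : ∀ (K K′ : Fin n → Bool) a b → (∀ v → v ≢ a → v ≢ b → K′ v ≡ true → K v ≡ true) →
      # K′ ≤ # K + (⟦ K′ a ∧ not (K a) ⟧ + ⟦ K′ b ∧ not (K b) ⟧)
    gain K K′ a b old = ≤-≡-trans (∑-mono pointwise) (trans (∑-distrib-+ (λ v → ⟦ K v ⟧) _)
      (cong (# K +_) (trans (∑-distrib-+ (λ v → ⟦ a == v ⟧ * A v) _)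
        (cong₂ _+_ (∑-pick a A) (∑-pick b A)))))
      where
      A = λ v → ⟦ K′ v ∧ not (K v) ⟧
      pointwise : ∀ v → ⟦ K′ v ⟧ ≤ ⟦ K v ⟧ + (⟦ a == v ⟧ * A v + ⟦ b == v ⟧ * A v)
      pointwise v with K′ v in K′v | K v in Kv
      ... | false | _     = z≤n
      ... | true  | true  = s≤s z≤n
      ... | true  | false with a ≟ v | b ≟ v
      ...   | yes _ | _     = s≤s z≤n
      ...   | no _  | yes _ = s≤s z≤n
      ...   | no p  | no q  = contradiction (old v (p ∘ sym) (q ∘ sym) K′v) (λ Kv′ → not-both Kv′ Kv)

  module _ (K : Calls → Fin n → Bool) where

    forwardGain backwardGain : SplitFun
    forwardGain p (a , b) q = ⟦ K (p ++ (a , b) ∷ []) a ∧ not (K p a) ⟧ + ⟦ K (p ++ (a , b) ∷ []) b ∧ not (K p b) ⟧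
    backwardGain p (a , b) q = ⟦ K ((a , b) ∷ q) a ∧ not (K q a) ⟧ + ⟦ K ((a , b) ∷ q) b ∧ not (K q b) ⟧

    -- A set depending on the calls made so far, to which a call can add only its two ends, is paid
    -- for by the gains at the single calls.
    forward-growth : (∀ p a b v → v ≢ a → v ≢ b → K (p ++ (a , b) ∷ []) v ≡ true → K p v ≡ true) →
      ∀ pre L → ∑ (λ v → ⟦ K (pre ++ L) v ⟧) ≤ # K pre + Sp forwardGain pre L
    forward-growth old pre [] = ≤-reflexive (trans (cong (λ r → # K r) (++-identityʳ pre)) (sym (+-identityʳ _)))
    forward-growth old pre (e@(a , b) ∷ L) = begin
      ∑ (λ v → ⟦ K (pre ++ e ∷ L) v ⟧) ≡⟨ cong (λ r → # K r) (++-assoc pre (e ∷ []) L) ⟨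
      ∑ (λ v → ⟦ K ((pre ++ e ∷ []) ++ L) v ⟧) ≤⟨ forward-growth old (pre ++ e ∷ []) L ⟩
      ∑ (λ v → ⟦ K (pre ++ e ∷ []) v ⟧) + Sp forwardGain (pre ++ e ∷ []) L
        ≤⟨ +-monoˡ-≤ _ (gain (K pre) (K (pre ++ e ∷ [])) a b (old pre a b)) ⟩
      # K pre + forwardGain pre e L + Sp forwardGain (pre ++ e ∷ []) L ≡⟨ +-assoc (# K pre) _ _ ⟩
      # K pre + Sp forwardGain pre (e ∷ L) ∎
      where open ≤-Reasoning

    backward-growth : (∀ a b q v → v ≢ a → v ≢ b → K ((a , b) ∷ q) v ≡ true → K q v ≡ true) →
      ∀ pre L → # K L ≤ # K [] + Sp backwardGain pre L
    backward-growth old pre [] = ≤-reflexive (sym (+-identityʳ _))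
    backward-growth old pre (e@(a , b) ∷ L) = begin
      ∑ (λ v → ⟦ K (e ∷ L) v ⟧) ≤⟨ gain (K L) (K (e ∷ L)) a b (old a b L) ⟩
      # K L + backwardGain pre e L ≤⟨ +-monoˡ-≤ _ (backward-growth old (pre ++ e ∷ []) L) ⟩
      # K [] + Sp backwardGain (pre ++ e ∷ []) L + backwardGain pre e L ≡⟨ shuffle (# K []) _ _ ⟩
      # K [] + Sp backwardGain pre (e ∷ L) ∎
      where
      open ≤-Reasoning
      shuffle : ∀ a b c → a + b + c ≡ a + (c + b)
      shuffle = solve-∀

  module _ (μ : Calls → Call n → Calls → Bool) where

    -- Below, κ names the connected components formed by the calls satisfying μ.
    classCalls : (Fin n → Fin n) → (Fin n → Bool) → SplitFun
    classCalls κ τ p (a , b) q = ⟦ μ p (a , b) q ⟧ * ⟦ τ (κ a) ⟧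

    -- The second clause is the forest inequality: vertices number at most components plus calls.
    -- Quantifying over `τ` gives it inside any choice of components, which is needed for three of
    -- them and for a single one.
    Components : Calls → Calls → Set
    Components pre L = ∃ λ (κ : Fin n → Fin n) →
      AllS (λ p (a , b) q → μ p (a , b) q ≡ true → κ a ≡ κ b) pre L ×
      (∀ (τ : Fin n → Bool) → ∑ (λ v → ⟦ τ (κ v) ⟧) ≤ # τ + Sp (classCalls κ τ) pre L)

    merge : ∀ pre a b L m → μ pre (a , b) L ≡ m → Components (pre ++ (a , b) ∷ []) L → Components pre ((a , b) ∷ L)
    merge pre a b L false eq (κ , const , count) = κ , ((λ t → contradiction (trans (sym t) eq) (λ ())) , const) , count′
      where
      e = a , b
      count′ : ∀ (τ : Fin n → Bool) → ∑ (λ v → ⟦ τ (κ v) ⟧) ≤ # τ + (⟦ μ pre e L ⟧ * ⟦ τ (κ a) ⟧ + Sp (classCalls κ τ) (pre ++ e ∷ []) L)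
      count′ τ = ≤-trans (count τ) (+-monoʳ-≤ (# τ) (m≤n+m _ (⟦ μ pre e L ⟧ * ⟦ τ (κ a) ⟧)))
    merge pre a b L true eq (κ , const , count) = σ ∘ κ ,
        ((λ _ → trans σa (sym (sub-same (κ b) (κ a)))) , lift (pre ++ e ∷ []) L const) , count′
      where
      e = a , b
      σ = sub (κ b) (κ a)
      σa : σ (κ a) ≡ κ a
      σa with κ a ≟ κ b
      ... | yes _ = refl
      ... | no _  = refl
      lift : ∀ pre L → AllS (λ p (a , b) q → μ p (a , b) q ≡ true → κ a ≡ κ b) pre L →
        AllS (λ p (a , b) q → μ p (a , b) q ≡ true → σ (κ a) ≡ σ (κ b)) pre L
      lift pre []      _       = tt
      lift pre (e ∷ L) (h , r) = (cong σ ∘ h) , lift (pre ++ e ∷ []) L r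
      count′ : ∀ (τ : Fin n → Bool) → ∑ (λ v → ⟦ τ (σ (κ v)) ⟧) ≤ # τ + (⟦ μ pre e L ⟧ * ⟦ τ (σ (κ a)) ⟧ + Sp (classCalls (σ ∘ κ) τ) (pre ++ e ∷ []) L)
      -- Choosing by `τ` after the merger is choosing by `τ ∘ σ` before it. This can add only the
      -- name `κ b`, and only if `κ a` is chosen, in which case the merging call pays for it.
      count′ τ = ≤-trans (count (τ ∘ σ)) (≤-≡-trans (+-monoˡ-≤ _ merged) (+-assoc (# τ) _ _))
        where
        pointwise : ∀ k → ⟦ τ (σ k) ⟧ ≤ ⟦ τ k ⟧ + ⟦ κ b == k ⟧ * ⟦ τ (κ a) ⟧
        pointwise k with k ≟ κ b
        ... | yes refl rewrite ==-refl (κ b) = ≡-≤-trans (sym (+-identityʳ _)) (m≤n+m _ ⟦ τ (κ b) ⟧)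
        ... | no _ = m≤m+n _ _
        merged : ∑ (λ k → ⟦ τ (σ k) ⟧) ≤ # τ + ⟦ μ pre e L ⟧ * ⟦ τ (σ (κ a)) ⟧
        merged = ≤-≡-trans (∑-mono pointwise) (trans (∑-distrib-+ (λ k → ⟦ τ k ⟧) _)
          (cong (# τ +_) (trans (∑-pick (κ b) (λ _ → ⟦ τ (κ a) ⟧)) (trans (cong (λ t → ⟦ τ t ⟧) (sym σa)) (trans (sym (*-identityˡ _)) (cong (λ m → ⟦ m ⟧ * ⟦ τ (σ (κ a)) ⟧) (sym eq)))))))

    components : ∀ pre L → Components pre L
    components pre []            = id , tt , λ τ → ≤-reflexive (sym (+-identityʳ _))
    components pre ((a , b) ∷ L) = merge pre a b L _ refl (components (pre ++ (a , b) ∷ []) L)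

-- The gossip theorem

does-true : ∀ {P : Set} (d : Dec P) → does d ≡ true → P
does-true (yes p) _ = p

does-false : ∀ {P : Set} (d : Dec P) → does d ≡ false → ¬ P
does-false (no ¬p) _ = ¬p

inc : ∀ {n} → Fin n → Call n → Bool
inc v (a , b) = (v == a) ∨ (v == b)

occ : ∀ {n} → Fin n → List (Call n) → Bool
occ v []      = false
occ v (c ∷ L) = inc v c ∨ occ v L

inc-joins : ∀ {n} {v : Fin n} c → inc v c ≡ true → ∃ (Joins c v)
inc-joins {v = v} (a , b) i with v ≟ a | v ≟ b
... | yes refl | _        = b , inj₁ refl
... | no _     | yes refl = a , inj₂ refl

joins-inc : ∀ {n} {c : Call n} {u v} → Joins c u v → inc u c ≡ true
joins-inc {u = u} (inj₁ refl) rewrite ==-refl u = refl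
joins-inc {u = u} {v} (inj₂ refl) rewrite ==-refl u with u == v
... | true  = refl
... | false = refl

∨-true : ∀ {a b} → a ∨ b ≡ true → a ≡ true ⊎ b ≡ true
∨-true {true}  _ = inj₁ refl
∨-true {false} e = inj₂ e

∨-trueʳ : ∀ a {b} → b ≡ true → a ∨ b ≡ true
∨-trueʳ true  _ = refl
∨-trueʳ false e = e

∨-false : ∀ {a b} → a ∨ b ≡ false → a ≡ false × b ≡ false
∨-false {false} e = refl , e

occ-++ˡ : ∀ {n} {v : Fin n} L {L′} → occ v L ≡ true → occ v (L ++ L′) ≡ true
occ-++ˡ {v = v} (c ∷ L) o with inc v c
... | true  = refl
... | false = occ-++ˡ L o

occ-++ʳ : ∀ {n} {v : Fin n} L {L′} → occ v L′ ≡ true → occ v (L ++ L′) ≡ true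
occ-++ʳ [] o = o
occ-++ʳ {v = v} (c ∷ L) o = ∨-trueʳ (inc v c) (occ-++ʳ L o)

occ-at : ∀ {n} {c : Call n} {u v} L {L′} → Joins c u v → occ u (L ++ c ∷ L′) ≡ true
occ-at L j = occ-++ʳ L (cong (_∨ _) (joins-inc j))

occ-split : ∀ {n} {v : Fin n} L → occ v L ≡ true → ∃₂ λ p q → ∃₂ λ c z → L ≡ p ++ c ∷ q × Joins c v z
occ-split {v = v} (c ∷ L) o with ∨-true {inc v c} o
... | inj₁ i = let (z , j) = inc-joins c i in [] , L , c , z , refl , j
... | inj₂ o′ = let (p , q , c′ , z , eq , j) = occ-split L o′ in c ∷ p , q , c′ , z , cong (c ∷_) eq , j

idle-start : ∀ {n} {a y : Fin n} {L} → occ a L ≡ false → L ⊢ a ⇝ y → y ≡ a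
idle-start o done = refl
idle-start {a = a} o (skip {c} p)  = idle-start (proj₂ (∨-false {inc a c} o)) p
idle-start {a = a} o (hop {c} j p) = contradiction (proj₁ (∨-false {inc a c} o)) (not-both (joins-inc j))

idle-end : ∀ {n} {a y : Fin n} {L} → occ a L ≡ false → L ⊢ y ⇝ a → y ≡ a
idle-end o done = refl
idle-end {a = a} o (skip {c} p) = idle-end (proj₂ (∨-false {inc a c} o)) p
idle-end {a = a} o (hop {c} j p) with idle-end (proj₂ (∨-false {inc a c} o)) p
... | refl = contradiction (proj₁ (∨-false {inc a c} o)) (not-both (joins-inc (joins-sym j)))

hop-inv : ∀ {n} {c : Call n} {u y L} → c ∷ L ⊢ u ⇝ y → L ⊢ u ⇝ y ⊎ ∃ λ v → Joins c u v × L ⊢ v ⇝ y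
hop-inv (skip p)  = inj₁ p
hop-inv (hop j p) = inj₂ (_ , j , p)

pass : ∀ {n} (p : List (Call n)) {q c u v} → Joins c u v → p ++ c ∷ q ⊢ u ⇝ v
pass p {q} j = stay p +⇝+ hop j (stay q)

count-all : ∀ {n} {K : Fin n → Bool} → (∀ v → K v ≡ true) → # K ≡ n
count-all {n} all = trans (∑-cong (λ v → true⇒⟦⟧ (all v))) (trans (∑-const n 1) (*-identityʳ n))

count-none : ∀ {n} {K : Fin n → Bool} → (∀ v → K v ≡ false) → # K ≡ 0
count-none {n} none = trans (∑-cong (λ v → cong ⟦_⟧ (none v))) (∑-zero n)

private
  gain≤xor : ∀ {K′a K′b Ka Kb} → (K′a ≡ true → Ka ≡ false → Kb ≡ true) → (K′b ≡ true → Kb ≡ false → Ka ≡ true) →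
    ⟦ K′a ∧ not Ka ⟧ + ⟦ K′b ∧ not Kb ⟧ ≤ ⟦ Ka xor Kb ⟧
  gain≤xor {K′a} {K′b} {true}  {true}  f g rewrite ∧-zeroʳ K′a | ∧-zeroʳ K′b = z≤n
  gain≤xor {K′a} {K′b} {true}  {false} f g rewrite ∧-zeroʳ K′a = ⟦⟧≤1 _
  gain≤xor {K′a} {K′b} {false} {true}  f g rewrite ∧-zeroʳ K′b | +-identityʳ ⟦ K′a ∧ true ⟧ = ⟦⟧≤1 _
  gain≤xor {true}  {K′b}   {false} {false} f g = contradiction (f refl refl) (λ ())
  gain≤xor {false} {true}  {false} {false} f g = contradiction (g refl refl) (λ ())
  gain≤xor {false} {false} {false} {false} f g = z≤n

  gain≤ : ∀ βa βb {K′a K′b Ka Kb} → (K′a ≡ true → Ka ≡ false → Kb ≡ true) → (K′b ≡ true → Kb ≡ false → Ka ≡ true) →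
    ⟦ (βa ∧ K′a) ∧ not (βa ∧ Ka) ⟧ + ⟦ (βb ∧ K′b) ∧ not (βb ∧ Kb) ⟧ ≤ ⟦ (βa ∨ βb) ∧ (Ka xor Kb) ⟧
  gain≤ true  true  f g = gain≤xor f g
  gain≤ true  false f g = ≤-trans (≡-≤-trans (+-identityʳ _) (m≤m+n _ _)) (gain≤xor f g)
  gain≤ false true  f g = ≤-trans (m≤n+m _ _) (gain≤xor f g)
  gain≤ false false f g = z≤n

module _ {n} (x : Fin n) where

  knows : List (Call n) → Fin n → Bool
  knows p v = does (reach? p x v)

  tells : List (Call n) → Fin n → Bool
  tells q v = does (reach? q v x)

  -- A call spreads if it enlarges the set of those informed by `x`, and collects if, read
  -- backwards, it enlarges the set of those whose information will reach `x`; in both cases exactly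
  -- one end belongs to the set already.
  spreads collects useless : List (Call n) → Call n → List (Call n) → Bool
  spreads  p (a , b) q = knows p a xor knows p b
  collects p (a , b) q = tells q a xor tells q b
  useless p c q = not (spreads p c q) ∧ not (collects p c q)

  informed : ∀ {p q} c → spreads p c q ≡ true → ∃₂ λ u u′ → Joins c u u′ × p ⊢ x ⇝ u
  informed {p} (a , b) s with reach? p x a | reach? p x b
  ... | yes r | _     = a , b , inj₁ refl , r
  ... | no _  | yes r = b , a , inj₂ refl , r

  informing : ∀ {p q} c → collects p c q ≡ true → ∃₂ λ u u′ → Joins c u u′ × q ⊢ u ⇝ x
  informing {q = q} (a , b) s with reach? q a x | reach? q b x
  ... | yes r | _     = a , b , inj₁ refl , r
  ... | no _  | yes r = b , a , inj₂ refl , r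

  calls : List (Call n) → ℕ
  calls L = Sp (λ p c q → ⟦ inc x c ⟧) [] L

  -- A newly informed vertex learns from a partner who knew before, so a call adds at most one
  -- vertex. The filter `β` charges only the calls touching it.
  spread-growth : ∀ (β : Fin n → Bool) pre L → ∑ (λ v → ⟦ β v ∧ knows (pre ++ L) v ⟧) ≤
    ∑ (λ v → ⟦ β v ∧ knows pre v ⟧) + Sp (λ p (a , b) q → ⟦ (β a ∨ β b) ∧ spreads p (a , b) q ⟧) pre L
  spread-growth β pre L = ≤-trans (forward-growth (λ p v → β v ∧ knows p v) old pre L)
    (+-monoʳ-≤ (∑ (λ v → ⟦ β v ∧ knows pre v ⟧)) (Sp-mono pre L (allS pre L (λ p (a , b) q _ → gain≤ (β a) (β b) (other p (inj₁ refl)) (other p (inj₂ refl))))))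
    where
    old : ∀ p a b v → v ≢ a → v ≢ b → β v ∧ knows (p ++ (a , b) ∷ []) v ≡ true → β v ∧ knows p v ≡ true
    old p a b v v≢a v≢b k with β v
    ... | true with unappend p (does-true (reach? (p ++ (a , b) ∷ []) x v) k)
    ...   | y , before , skip done = dec-true (reach? p x v) before
    ...   | y , before , hop (inj₁ refl) done = contradiction refl v≢b
    ...   | y , before , hop (inj₂ refl) done = contradiction refl v≢a
    other : ∀ p {c u v} → Joins c u v → knows (p ++ c ∷ []) u ≡ true → knows p u ≡ false → knows p v ≡ true
    other p {c} {u} j k ¬k with unappend p (does-true (reach? (p ++ c ∷ []) x u) k)
    ... | y , before , skip done = contradiction before (does-false (reach? p x u) ¬k)
    ... | y , before , hop j′ done with joins-unique (joins-sym j′) j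
    ...   | refl = dec-true (reach? p x y) before

  collect-growth : ∀ (β : Fin n → Bool) pre L → ∑ (λ v → ⟦ β v ∧ tells L v ⟧) ≤
    ∑ (λ v → ⟦ β v ∧ tells [] v ⟧) + Sp (λ p (a , b) q → ⟦ (β a ∨ β b) ∧ collects p (a , b) q ⟧) pre L
  collect-growth β pre L = ≤-trans (backward-growth (λ q v → β v ∧ tells q v) old pre L)
    (+-monoʳ-≤ (∑ (λ v → ⟦ β v ∧ tells [] v ⟧)) (Sp-mono pre L (allS pre L (λ p (a , b) q _ → gain≤ (β a) (β b) (other q (inj₁ refl)) (other q (inj₂ refl))))))
    where
    old : ∀ a b q v → v ≢ a → v ≢ b → β v ∧ tells ((a , b) ∷ q) v ≡ true → β v ∧ tells q v ≡ true
    old a b q v v≢a v≢b t with β v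
    ... | true with does-true (reach? ((a , b) ∷ q) v x) t
    ...   | skip r = dec-true (reach? q v x) r
    ...   | hop (inj₁ refl) r = contradiction refl v≢a
    ...   | hop (inj₂ refl) r = contradiction refl v≢b
    other : ∀ q {c u v} → Joins c u v → tells (c ∷ q) u ≡ true → tells q u ≡ false → tells q v ≡ true
    other q {c} {u} j t ¬t with does-true (reach? (c ∷ q) u x) t
    ... | skip r = contradiction r (does-false (reach? q u x) ¬t)
    ... | hop {v = w} j′ r with joins-unique j′ j
    ...   | refl = dec-true (reach? q w x) r

module NoOwn {n} {L : List (Call n)} (complete : Complete L) (loopfree : LoopFree L) (noho : ∀ x → ¬ Hears x L) where

  loopless : ∀ {p c q u v} → p ++ c ∷ q ≡ L → Joins c u v → u ≢ v
  loopless {p} refl j with all-++⁻ʳ p loopfree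
  loopless refl (inj₁ refl) | ne ∷ _ = ne
  loopless refl (inj₂ refl) | ne ∷ _ = ne ∘ sym

  no-round-trip : ∀ {p q x a} → p ++ q ≡ L → p ⊢ x ⇝ a → q ⊢ a ⇝ x → a ≡ x
  no-round-trip {x = x} {a} refl p q with a ≟ x
  ... | yes eq = eq
  ... | no ne  = contradiction (round-trip p q ne) (noho x)

  -- If c is the first call of a but b has called z before, then whatever brings the information
  -- of a to z also brings z its own.
  first-mutual : ∀ {p c q a b} → p ++ c ∷ q ≡ L → Joins c a b → occ a p ≡ false → occ b p ≡ false
  first-mutual {p} {c} {q} {a} {b} eq j oa with occ b p in ob
  ... | false = refl
  ... | true with occ-split p ob
  ...   | p₁ , p₂ , c′ , z , refl , j′ with unappend p (subst (_⊢ a ⇝ z) (sym eq) (complete a z))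
  ...     | y , before , after with idle-start oa before
  ...       | refl = contradiction (sym (no-round-trip eq (pass p₁ (joins-sym j′)) (back (hop-inv after)))) b≢z
    where
    b≢z : z ≢ b
    b≢z z≡b = loopless (trans (sym (++-assoc p₁ (c′ ∷ p₂) (c ∷ q))) eq) j′ (sym z≡b)
    back : q ⊢ a ⇝ z ⊎ (∃ λ v → Joins c a v × q ⊢ v ⇝ z) → c ∷ q ⊢ b ⇝ z
    back (inj₁ r) = hop (joins-sym j) r
    back (inj₂ (v , j″ , r)) = skip (start-≡ (joins-unique j″ j) r)

  -- The reverse in time: if `b` calls `z` after the last call of `a`, the information of `z` bound
  -- for `a` has to be at `a` or `b` before `c`, and the later call returns it to `z`.
  last-mutual : ∀ {p c q a b} → p ++ c ∷ q ≡ L → Joins c a b → occ a q ≡ false → occ b q ≡ false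
  last-mutual {p} {c} {q} {a} {b} eq j oa with occ b q in ob
  ... | false = refl
  ... | true with occ-split q ob
  ...   | q₁ , q₂ , c′ , z , refl , j′ with unappend p (subst (_⊢ z ⇝ a) (sym eq) (complete z a))
  ...     | y , before , after = arrive (hop-inv after)
    where
    z≢b : z ≢ b
    z≢b z≡b = loopless {p ++ c ∷ q₁} (trans (++-assoc p (c ∷ q₁) (c′ ∷ q₂)) eq) j′ (sym z≡b)
    z≢a : z ≢ a
    z≢a refl = contradiction (trans (sym oa) (occ-at q₁ (joins-sym j′))) (λ ())
    fromB : p ⊢ z ⇝ b → true ≡ false
    fromB r = contradiction (sym (no-round-trip eq r (skip (pass q₁ j′)))) z≢b
    fromA : p ⊢ z ⇝ a → true ≡ false
    fromA r = contradiction (sym (no-round-trip eq r (hop j (pass q₁ j′)))) z≢a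
    arrive : q ⊢ y ⇝ a ⊎ (∃ λ v → Joins c y v × q ⊢ v ⇝ a) → true ≡ false
    arrive (inj₁ r) with idle-end oa r
    ... | refl = fromA before
    arrive (inj₂ (v , j″ , r)) with idle-end oa r
    ... | refl with joins-unique (joins-sym j″) j
    ...   | refl = fromB before

  bool-≡ : ∀ {s t} → (s ≡ false → t ≡ false) → (t ≡ false → s ≡ false) → s ≡ t
  bool-≡ {true}  {true}  _ _ = refl
  bool-≡ {true}  {false} _ g = contradiction (g refl) (λ ())
  bool-≡ {false} {true}  f _ = contradiction (f refl) (λ ())
  bool-≡ {false} {false} _ _ = refl

  first-≡ : ∀ {p c q a b} → p ++ c ∷ q ≡ L → Joins c a b → occ a p ≡ occ b p
  first-≡ eq j = bool-≡ (first-mutual eq j) (first-mutual eq (joins-sym j))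

  last-≡ : ∀ {p c q a b} → p ++ c ∷ q ≡ L → Joins c a b → occ a q ≡ occ b q
  last-≡ eq j = bool-≡ (last-mutual eq j) (last-mutual eq (joins-sym j))

  module _ (x : Fin n) where

    spreads-count : n ≤ 1 + tally (spreads x) L
    spreads-count = begin
      n ≡⟨ count-all (λ v → dec-true (reach? L x v) (complete x v)) ⟨
      # knows x L ≤⟨ spread-growth x (λ _ → true) [] L ⟩
      ∑ (λ v → ⟦ x == v ⟧) + tally (spreads x) L ≡⟨ cong (_+ tally (spreads x) L) (∑-δ x) ⟩
      1 + tally (spreads x) L ∎
      where open ≤-Reasoning

    collects-count : n ≤ 1 + tally (collects x) L
    collects-count = begin
      n ≡⟨ count-all (λ v → dec-true (reach? L v x) (complete v x)) ⟨
      # tells x L ≤⟨ collect-growth x (λ _ → true) [] L ⟩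
      ∑ (λ v → ⟦ v == x ⟧) + tally (collects x) L ≡⟨ cong (_+ tally (collects x) L) (trans (∑-cong (λ v → cong ⟦_⟧ (==-sym v x))) (∑-δ x)) ⟩
      1 + tally (collects x) L ∎
      where open ≤-Reasoning

    -- A call that both spreads the information of x and collects information for x is made by x,
    -- since otherwise x hears its own information.
    own-call : ∀ {p c q} → p ++ c ∷ q ≡ L → spreads x p c q ≡ true → collects x p c q ≡ true → inc x c ≡ true
    own-call {p} {c} {q} eq s t with informed x {p} {q} c s | informing x {p} {q} c t
    ... | u , _ , j , r | v , _ , j′ , r′ with joins-cases j j′
    ...   | inj₁ (refl , _) = subst (λ w → inc w c ≡ true) (no-round-trip eq r (skip r′)) (joins-inc j)
    ...   | inj₂ (refl , _) = subst (λ w → inc w c ≡ true) (no-round-trip eq r (hop j r′)) (joins-inc j)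

    usefulness : ∀ p c q → p ++ c ∷ q ≡ L → ⟦ spreads x p c q ⟧ + ⟦ collects x p c q ⟧ + ⟦ useless x p c q ⟧ ≤ 1 + ⟦ inc x c ⟧
    usefulness p c q eq with spreads x p c q in s | collects x p c q in t
    ... | true  | true  = s≤s (≤-reflexive (sym (true⇒⟦⟧ (own-call eq s t))))
    ... | true  | false = s≤s z≤n
    ... | false | true  = s≤s z≤n
    ... | false | false = s≤s z≤n

    -- At least n - 1 calls spread and n - 1 collect, and only the calls made by `x` can do both.
    useless-count : 2 * n + tally (useless x) L ≤ 2 + length L + calls x L
    useless-count = begin
      2 * n + U ≡⟨ cong (λ t → n + t + U) (+-identityʳ n) ⟩
      n + n + U ≤⟨ +-monoˡ-≤ U (spreads-count ⊕ collects-count) ⟩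
      1 + A + (1 + B) + U ≡⟨ ring A B U ⟩
      2 + (A + B + U) ≡⟨ cong (2 +_) (trans (cong (_+ U) (sym (Sp-+ _ _ [] L))) (sym (Sp-+ _ _ [] L))) ⟩
      2 + Sp (λ p c q → ⟦ spreads x p c q ⟧ + ⟦ collects x p c q ⟧ + ⟦ useless x p c q ⟧) [] L ≤⟨ +-monoʳ-≤ 2 (Sp-mono [] L (allS [] L usefulness)) ⟩
      2 + Sp (λ p c q → 1 + ⟦ inc x c ⟧) [] L ≡⟨ cong (2 +_) (trans (Sp-+ (λ _ _ _ → 1) _ [] L) (cong (_+ calls x L) (Sp-1 [] L))) ⟩
      2 + (length L + calls x L) ∎
      where
      open ≤-Reasoning
      A = tally (spreads x) L
      B = tally (collects x) L
      U = tally (useless x) L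
      ring : ∀ a b u → 1 + a + (1 + b) + u ≡ 2 + (a + b + u)
      ring = solve-∀

∧-true : ∀ {s t} → s ∧ t ≡ true → s ≡ true × t ≡ true
∧-true {true} e = refl , e

compare-splits : ∀ {A : Set} (l₁ : List A) {l₂ p e q} → l₁ ++ l₂ ≡ p ++ e ∷ q →
  (∃ λ k → p ≡ l₁ ++ k) ⊎ (∃ λ k → l₁ ≡ p ++ e ∷ k × q ≡ k ++ l₂)
compare-splits []       {p = p}     eq   = inj₁ (p , refl)
compare-splits (x ∷ l₁) {p = []}    refl = inj₂ (l₁ , refl , refl)
compare-splits (x ∷ l₁) {p = y ∷ p} eq with ∷-injective eq
... | refl , eq′ with compare-splits l₁ eq′
...   | inj₁ (k , refl) = inj₁ (k , refl)
...   | inj₂ (k , refl , refl) = inj₂ (k , refl , refl)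

-- Information resting at `u` until `r` means that `u` is `v`; otherwise it leaves `u` by a call.
busy-later : ∀ {n} {q : List (Call n)} {u v} {r} → q ⊢ u ⇝ v → occ v r ≡ true → occ u (q ++ r) ≡ true
busy-later done o = o
busy-later {u = u} (skip {c} p) o = ∨-trueʳ (inc u c) (busy-later p o)
busy-later {u = u} (hop {L = L} j p) o = cong (_∨ occ u (L ++ _)) (joins-inc j)

module _ {n} (v : Fin n) where

  firsts≤1 : ∀ pre L → Sp (λ p c q → ⟦ inc v c ∧ not (occ v p) ⟧) pre L ≤ ⟦ not (occ v pre) ⟧
  firsts≤1 pre [] = z≤n
  firsts≤1 pre (c ∷ L) with inc v c in i | occ v pre in o | firsts≤1 (pre ++ c ∷ []) L
  ... | true  | true  | ih rewrite occ-++ˡ {v = v} pre {c ∷ []} o = ih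
  ... | false | true  | ih rewrite occ-++ˡ {v = v} pre {c ∷ []} o = ih
  ... | false | false | ih = ≤-trans ih (⟦⟧≤1 _)
  ... | true  | false | ih rewrite occ-at {u = v} pre {[]} (proj₂ (inc-joins c i)) = s≤s ih

  lasts≤1 : ∀ pre L → Sp (λ p c q → ⟦ inc v c ∧ not (occ v q) ⟧) pre L ≤ ⟦ occ v L ⟧
  lasts≤1 pre [] = z≤n
  lasts≤1 pre (c ∷ L) with inc v c | occ v L | lasts≤1 (pre ++ c ∷ []) L
  ... | true  | true  | ih = ih
  ... | true  | false | ih = s≤s ih
  ... | false | true  | ih = ih
  ... | false | false | ih = ih

  IsFirstPartner IsLastPartner : Fin n → List (Call n) → Call n → List (Call n) → Set
  IsFirstPartner y p c q = ∀ w → Joins c v w → occ v p ≡ false → w ≡ y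
  IsLastPartner  z p c q = ∀ w → Joins c v w → occ v q ≡ false → w ≡ z

  first-partner : ∀ pre L → ∃ λ y → AllS (IsFirstPartner y) pre L
  -- No calls remain, so the value is arbitrary.
  first-partner pre [] = v , tt
  first-partner pre (c ∷ L) with inc v c in i
  ... | true = let (y , j) = inc-joins c i in y , (λ w j′ _ → joins-unique j′ j) , vacuous (pre ++ c ∷ []) L (occ-at pre j)
    where
    vacuous : ∀ {y} pre L → occ v pre ≡ true → AllS (IsFirstPartner y) pre L
    vacuous pre []      o = tt
    vacuous pre (c ∷ L) o = (λ w _ o′ → contradiction o′ (λ o′ → not-both o o′)) , vacuous (pre ++ c ∷ []) L (occ-++ˡ pre o)
  ... | false = let (y , h) = first-partner (pre ++ c ∷ []) L in
        y , (λ w j _ → contradiction (joins-inc j) (λ t → not-both t i)) , h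

  last-partner : ∀ pre L → ∃ λ z → AllS (IsLastPartner z) pre L
  last-partner pre [] = v , tt
  last-partner pre (c ∷ L) with occ v L in o
  ... | true = let (z , h) = last-partner (pre ++ c ∷ []) L in z , (λ w _ ()) , h
  ... | false with inc v c in i
  ...   | true = let (z , j) = inc-joins c i in z , (λ w j′ _ → joins-unique j′ j) , vacuous (pre ++ c ∷ []) L o
    where
    vacuous : ∀ {z} pre L → occ v L ≡ false → AllS (IsLastPartner z) pre L
    vacuous pre []      o = tt
    vacuous pre (c ∷ L) o = (λ w j _ → contradiction (joins-inc j) (λ t → not-both t (proj₁ (∨-false {inc v c} o)))) ,
      vacuous (pre ++ c ∷ []) L (proj₂ (∨-false {inc v c} o))
  ...   | false = let (z , h) = last-partner (pre ++ c ∷ []) L in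
          z , (λ w j _ → contradiction (joins-inc j) (λ t → not-both t i)) , h

module Few {n} {L : List (Call n)} (complete : Complete L) (loopfree : LoopFree L) (noho : ∀ x → ¬ Hears x L)
  (few : length L + 5 ≤ 2 * n) where

  open NoOwn complete loopfree noho

  degree-bound : ∀ x → 3 + tally (useless x) L ≤ calls x L
  degree-bound x = linear 0 (few ⊕ useless-count x) (ring (length L) (2 * n) (tally (useless x) L) (calls x L))
    where
    ring : ∀ l n u c → 3 + u + (n + (2 + l + c)) + 0 ≡ c + (l + 5 + (n + u))
    ring = solve-∀

  -- Looking at one end suffices, because first and last calls are mutual. A middle call is neither.
  mid : List (Call n) → Call n → List (Call n) → Bool
  mid p (a , b) q = occ a p ∧ occ a q

  mid-joins : ∀ {p c q u v} → p ++ c ∷ q ≡ L → Joins c u v → mid p c q ≡ occ u p ∧ occ u q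
  mid-joins eq (inj₁ refl) = refl
  mid-joins eq (inj₂ refl) = cong₂ _∧_ (first-≡ eq (inj₁ refl)) (last-≡ eq (inj₁ refl))

  firstCall lastCall : List (Call n) → Call n → List (Call n) → Bool
  firstCall p (a , b) q = not (occ a p)
  lastCall  p (a , b) q = not (occ a q)

  midcalls : Fin n → ℕ
  midcalls v = Sp (λ p c q → ⟦ inc v c ⟧ * ⟦ mid p c q ⟧) [] L

  Mid = tally mid L

  calls≤ : ∀ v → calls v L ≤ midcalls v + 2
  calls≤ v = begin
    calls v L ≤⟨ Sp-mono [] L (allS [] L pointwise) ⟩
    Sp (λ p c q → ⟦ inc v c ⟧ * ⟦ mid p c q ⟧ + (⟦ inc v c ∧ not (occ v p) ⟧ + ⟦ inc v c ∧ not (occ v q) ⟧)) [] L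
      ≡⟨ trans (Sp-+ _ _ [] L) (cong (midcalls v +_) (Sp-+ _ _ [] L)) ⟩
    midcalls v + (Sp (λ p c q → ⟦ inc v c ∧ not (occ v p) ⟧) [] L + Sp (λ p c q → ⟦ inc v c ∧ not (occ v q) ⟧) [] L)
      ≤⟨ +-monoʳ-≤ (midcalls v) (firsts≤1 v [] L ⊕ ≤-trans (lasts≤1 v [] L) (⟦⟧≤1 _)) ⟩
    midcalls v + 2 ∎
    where
    open ≤-Reasoning
    pointwise : ∀ p c q → p ++ c ∷ q ≡ L → ⟦ inc v c ⟧ ≤ ⟦ inc v c ⟧ * ⟦ mid p c q ⟧ + (⟦ inc v c ∧ not (occ v p) ⟧ + ⟦ inc v c ∧ not (occ v q) ⟧)
    pointwise p c q eq with inc v c in i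
    ... | false = z≤n
    ... | true rewrite mid-joins {u = v} eq (proj₂ (inc-joins c i)) with occ v p | occ v q
    ...   | true  | true  = s≤s z≤n
    ...   | true  | false = s≤s z≤n
    ...   | false | _     = s≤s z≤n

  midcalls≥1 : ∀ v → 1 ≤ midcalls v
  midcalls≥1 v = linear 0 (degree-bound v ⊕ calls≤ v ⊕ z≤n {U}) (ring (calls v L) (midcalls v) U)
    where
    U = tally (useless v) L
    ring : ∀ c m u → 1 + (c + (m + 2) + u) + 0 ≡ m + (3 + u + c + 0)
    ring = solve-∀

  abstract
    mid-witness : ∀ v → ∃ λ p → ∃₂ λ c q → p ++ c ∷ q ≡ L × mid p c q ≡ true × inc v c ≡ true
    mid-witness v with Sp-positive _ [] L (midcalls≥1 v)
    ... | p , c , q , eq , pos with mid p c q in m | inc v c in i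
    ...   | true | true = p , c , q , eq , m , i

  appears : ∀ v → occ v L ≡ true
  appears v with mid-witness v
  ... | p , c , q , refl , _ , i = occ-at p (proj₂ (inc-joins c i))

  private
    ends : ∀ {t t′} → t ≡ t′ → ⟦ t ⟧ + ⟦ t′ ⟧ ≡ 2 * ⟦ t ⟧
    ends {t} refl = cong (⟦ t ⟧ +_) (sym (+-identityʳ ⟦ t ⟧))

    ∧≤ʳ : ∀ s t → ⟦ s ∧ t ⟧ ≤ ⟦ t ⟧
    ∧≤ʳ true  t = ≤-refl
    ∧≤ʳ false t = z≤n

  -- Everybody makes a call, and each first call brings in its two ends together.
  firsts : n ≤ 2 * tally firstCall L
  firsts = begin
    n ≡⟨ count-all appears ⟨
    ∑ (λ v → ⟦ occ v L ⟧) ≤⟨ forward-growth (λ p v → occ v p) old [] L ⟩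
    ∑ {n} (λ _ → 0) + Sp (forwardGain (λ p v → occ v p)) [] L ≤⟨ ≤-reflexive (∑-zero n) ⊕ Sp-mono [] L (allS [] L pointwise) ⟩
    Sp (λ p c q → 2 * ⟦ firstCall p c q ⟧) [] L ≡⟨ Sp-double _ [] L ⟩
    2 * tally firstCall L ∎
    where
    open ≤-Reasoning
    old : ∀ p a b v → v ≢ a → v ≢ b → occ v (p ++ (a , b) ∷ []) ≡ true → occ v p ≡ true
    old [] a b v v≢a v≢b o rewrite ==-≢ v≢a | ==-≢ v≢b = contradiction o (λ ())
    old (c ∷ p) a b v v≢a v≢b o with inc v c
    ... | true  = refl
    ... | false = old p a b v v≢a v≢b o
    pointwise : ∀ p c q → p ++ c ∷ q ≡ L → forwardGain (λ p v → occ v p) p c q ≤ 2 * ⟦ firstCall p c q ⟧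
    pointwise p (a , b) q eq = ≤-≡-trans (∧≤ʳ (occ a (p ++ (a , b) ∷ [])) _ ⊕ ∧≤ʳ (occ b (p ++ (a , b) ∷ [])) _)
      (ends (cong not (first-≡ eq (inj₁ refl))))

  lasts : n ≤ 2 * tally lastCall L
  lasts = begin
    n ≡⟨ count-all appears ⟨
    ∑ (λ v → ⟦ occ v L ⟧) ≤⟨ backward-growth (λ p v → occ v p) old [] L ⟩
    ∑ {n} (λ _ → 0) + Sp (backwardGain (λ p v → occ v p)) [] L ≤⟨ ≤-reflexive (∑-zero n) ⊕ Sp-mono [] L (allS [] L pointwise) ⟩
    Sp (λ p c q → 2 * ⟦ lastCall p c q ⟧) [] L ≡⟨ Sp-double _ [] L ⟩
    2 * tally lastCall L ∎
    where
    open ≤-Reasoning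
    old : ∀ a b q v → v ≢ a → v ≢ b → occ v ((a , b) ∷ q) ≡ true → occ v q ≡ true
    old a b q v v≢a v≢b o rewrite ==-≢ v≢a | ==-≢ v≢b = o
    pointwise : ∀ p c q → p ++ c ∷ q ≡ L → backwardGain (λ p v → occ v p) p c q ≤ 2 * ⟦ lastCall p c q ⟧
    pointwise p (a , b) q eq = ≤-≡-trans (∧≤ʳ (occ a ((a , b) ∷ q)) _ ⊕ ∧≤ʳ (occ b ((a , b) ∷ q)) _)
      (ends (cong not (last-≡ eq (inj₁ refl))))

  -- Everybody has a middle call, so first and last calls are different.
  not-only-call : ∀ {p c q a b} → p ++ c ∷ q ≡ L → Joins c a b → occ a p ≡ false → occ a q ≡ false → ⊥
  not-only-call {p} {c} {q} {a} eq j op oq with mid-witness a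
  ... | p′ , c′ , q′ , eq′ , m , i with compare-splits p′ (trans eq′ (sym eq))
  ...   | inj₁ (k , refl) = not-both (occ-++ˡ p′ (proj₁ (∧-true (trans (sym (mid-joins eq′ (proj₂ (inc-joins c′ i)))) m)))) op
  ...   | inj₂ (k , _ , refl) = not-both (occ-at k (proj₂ (inc-joins c′ i))) oq

  -- First calls and last calls number at least n/2 each and are disjoint, which leaves at most n -
  -- 5 of the 2n - 5 calls.
  mid-count : Mid + 5 ≤ n
  mid-count = *-cancelˡ-≤ 2 (linear 0 (firsts ⊕ lasts ⊕ (total ⊕ total) ⊕ (few ⊕ few)) (ring Mid F Z (length L) n))
    where
    F = tally firstCall L
    Z = tally lastCall L
    ring : ∀ m f z l n → 2 * (m + 5) + (2 * f + 2 * z + (l + l) + (2 * n + 2 * n)) + 0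
      ≡ 2 * n + (n + n + (f + z + m + (f + z + m)) + (l + 5 + (l + 5)))
    ring = solve-∀
    pointwise : ∀ p c q → p ++ c ∷ q ≡ L → ⟦ firstCall p c q ⟧ + ⟦ lastCall p c q ⟧ + ⟦ mid p c q ⟧ ≤ 1
    pointwise p (a , b) q eq with occ a p in op | occ a q in oq
    ... | true  | true  = ≤-refl
    ... | true  | false = ≤-refl
    ... | false | true  = ≤-refl
    ... | false | false = contradiction oq (not-only-call eq (inj₁ refl) op)
    total : F + Z + Mid ≤ length L
    total = ≡-≤-trans (trans (cong (_+ Mid) (sym (Sp-+ _ _ [] L))) (sym (Sp-+ _ _ [] L)))
      (≤-≡-trans (Sp-mono [] L (allS [] L pointwise)) (Sp-1 [] L))

  -- Each of the fewer than n middle calls is counted at no more than two vertices.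
  quiet : ∃ λ x → midcalls x < 2
  quiet = ∑-<-witness midcalls (λ _ → 2) (begin-strict
    ∑ midcalls ≡⟨ Sp-∑ (λ v p c q → ⟦ inc v c ⟧ * ⟦ mid p c q ⟧) [] L ⟨
    Sp (λ p c q → ∑ (λ v → ⟦ inc v c ⟧ * ⟦ mid p c q ⟧)) [] L ≤⟨ Sp-mono [] L (allS [] L (λ p c q _ → pointwise p c q)) ⟩
    Sp (λ p c q → 2 * ⟦ mid p c q ⟧) [] L ≡⟨ Sp-double _ [] L ⟩
    2 * Mid <⟨ *-monoʳ-< 2 (≤-trans (≡-≤-trans (+-comm 1 Mid) (+-monoʳ-≤ Mid (s≤s z≤n))) mid-count) ⟩
    2 * n ≡⟨ trans (*-comm 2 n) (sym (∑-const n 2)) ⟩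
    ∑ {n} (λ _ → 2) ∎)
    where
    open ≤-Reasoning
    two : ∀ (c : Call n) → ∑ (λ v → ⟦ inc v c ⟧) ≤ 2
    two (a , b) = ≤-≡-trans (∑-mono (λ v → or v)) (∑-marks a b)
      where
      or : ∀ v → ⟦ inc v (a , b) ⟧ ≤ ⟦ a == v ⟧ + ⟦ b == v ⟧
      or v rewrite ==-sym v a | ==-sym v b with a == v
      ... | true  = s≤s z≤n
      ... | false = ≤-refl
    pointwise : ∀ p c q → ∑ (λ v → ⟦ inc v c ⟧ * ⟦ mid p c q ⟧) ≤ 2 * ⟦ mid p c q ⟧
    pointwise p c q = ≡-≤-trans (∑-*ʳ (λ v → ⟦ inc v c ⟧) ⟦ mid p c q ⟧) (*-monoˡ-≤ ⟦ mid p c q ⟧ (two c))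

  module Confined (x : Fin n) (x-quiet : midcalls x < 2) (comps : Components mid [] L)
    (y : Fin n) (y-first : AllS (IsFirstPartner x y) [] L) (z : Fin n) (z-last : AllS (IsLastPartner x z) [] L) where

    κ = proj₁ comps

    -- With one middle call `x` has at most three calls, while `degree-bound` asks for three plus
    -- the useless ones.
    all-useful : ∀ {p c q} → p ++ c ∷ q ≡ L → useless x p c q ≡ false
    all-useful {p} {c} {q} refl with useless x p c q in u
    ... | false = refl
    ... | true = contradiction (linear {p = 1} {q = 0} 0 (degree-bound x ⊕ calls≤ x ⊕ ≤-pred x-quiet ⊕ one) (ring (calls x L) (midcalls x) U)) (λ ())
      where
      U = tally (useless x) L
      one : 1 ≤ U
      one = ≡-≤-trans (sym (true⇒⟦⟧ u)) (Sp-term _ [] p)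
      ring : ∀ c m u → 1 + (c + (m + 2) + 1 + u) + 0 ≡ 0 + (3 + u + c + m + 1)
      ring = solve-∀

    κ-const : ∀ {p c q u v} → p ++ c ∷ q ≡ L → Joins c u v → occ u p ≡ true → occ u q ≡ true → κ u ≡ κ v
    κ-const {p} refl j op oq with trans (mid-joins refl j) (cong₂ _∧_ op oq) | allS-at [] p (proj₁ (proj₂ comps))
    κ-const refl (inj₁ refl) op oq | m | h = h m
    κ-const refl (inj₂ refl) op oq | m | h = sym (h m)

    first-is-y : ∀ {p c q v} → p ++ c ∷ q ≡ L → Joins c x v → occ x p ≡ false → v ≡ y
    first-is-y {p} refl j o = allS-at [] p y-first _ j o

    last-is-z : ∀ {p c q v} → p ++ c ∷ q ≡ L → Joins c x v → occ x q ≡ false → v ≡ z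
    last-is-z {p} refl j o = allS-at [] p z-last _ j o

    Among : Fin n → Fin n → Set
    Among t k = k ≡ κ x ⊎ k ≡ κ t

    -- Until its last call, the information of x can leave the component of x only by the first call of x.
    spread-confined : ∀ p₀ {q r u v} → p₀ ++ q ++ r ≡ L → q ⊢ u ⇝ v → occ v r ≡ true →
      u ≡ x ⊎ occ u p₀ ≡ true → Among y (κ u) → Among y (κ v)
    spread-confined p₀ eq done o start near = near
    spread-confined p₀ eq (skip {c} {q} p) o start near = spread-confined (p₀ ++ c ∷ []) (trans (++-assoc p₀ (c ∷ []) _) eq) p o
      (Sum.map₂ (occ-++ˡ p₀) start) near
    spread-confined p₀ {u = u} eq (hop {c} {v = u′} j p) o start near =
        spread-confined (p₀ ++ c ∷ []) (trans (++-assoc p₀ (c ∷ []) _) eq) p o (inj₂ (occ-at p₀ (joins-sym j))) (near′ (occ u p₀) refl start)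
      where
      near′ : ∀ b → occ u p₀ ≡ b → u ≡ x ⊎ occ u p₀ ≡ true → Among y (κ u′)
      near′ true op _ = Sum.map (trans (sym same)) (trans (sym same)) near
        where same = κ-const eq j op (trans (last-≡ eq j) (busy-later p o))
      near′ false op (inj₁ u≡x) = inj₂ (cong κ (first-is-y eq (subst (λ t → Joins c t u′) u≡x j) (subst (λ t → occ t p₀ ≡ false) u≡x op)))
      near′ false op (inj₂ o′)  = contradiction op (not-both o′)

    -- Dually, information held by somebody after his first call can enter the component of `x` only
    -- by the last call of `x`, since every other call on its way is a middle call.
    collect-confined : ∀ p₀ {q u} → p₀ ++ q ≡ L → q ⊢ u ⇝ x → occ u p₀ ≡ true → Among z (κ u)
    collect-confined p₀ eq done o = inj₁ refl
    collect-confined p₀ eq (skip {c} p) o = collect-confined (p₀ ++ c ∷ []) (trans (++-assoc p₀ (c ∷ []) _) eq) p (occ-++ˡ p₀ o)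
    collect-confined p₀ {u = u} eq (hop {c} {q} j p) o with occ u q in oq
    ... | true = Sum.map (trans same) (trans same)
          (collect-confined (p₀ ++ c ∷ []) (trans (++-assoc p₀ (c ∷ []) _) eq) p (occ-at p₀ (joins-sym j)))
      where same = κ-const eq j o oq
    ... | false with idle-start (trans (sym (last-≡ eq j)) oq) p
    ...   | refl = inj₂ (cong κ (last-is-z eq (joins-sym j) (trans (sym (last-≡ eq j)) oq)))

    τ : Fin n → Bool
    τ k = (κ x == k) ∨ ((κ y == k) ∨ (κ z == k))

    τ-y : ∀ {k} → Among y k → τ k ≡ true
    τ-y (inj₁ refl) rewrite ==-refl (κ x) = refl
    τ-y (inj₂ refl) rewrite ==-refl (κ y) = ∨-trueʳ (κ x == κ y) refl

    τ-z : ∀ {k} → Among z k → τ k ≡ true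
    τ-z (inj₁ refl) rewrite ==-refl (κ x) = refl
    τ-z (inj₂ refl) rewrite ==-refl (κ z) = ∨-trueʳ (κ x == κ z) (∨-trueʳ (κ y == κ z) refl)

    -- Each call spreads or collects for `x`, so one of its ends has information from `x` or for
    -- `x`, and confinement applies to that end.
    τ-call : ∀ {p c q} → p ++ c ∷ q ≡ L → ∃₂ λ u u′ → Joins c u u′ × τ (κ u) ≡ true
    τ-call {p} {c} {q} eq with spreads x p c q in s | collects x p c q in t | all-useful eq
    ... | true | _ | _ = let (u , u′ , j , r) = informed x {p} {q} c s in
          u , u′ , j , τ-y (spread-confined [] eq r (occ-at [] {q} j) (inj₁ refl) (inj₁ refl))
    ... | false | true | _ = let (u , u′ , j , r) = informing x {p} {q} c t in
          u , u′ , j , τ-z (collect-confined (p ++ c ∷ []) (trans (++-assoc p _ q) eq) r (occ-at p j))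

    -- Everybody has a middle call, whose two ends lie in the same component.
    τ-all : ∀ w → τ (κ w) ≡ true
    τ-all w with mid-witness w
    ... | p , c , q , eq , m , i with inc-joins c i | τ-call eq
    ...   | _ , j | u , u′ , j′ , t with joins-cases j j′
    ...     | inj₁ (refl , _) = t
    ...     | inj₂ (refl , _) = trans (cong τ (κ-const eq j op oq)) t
      where
      occs = ∧-true (trans (sym (mid-joins eq j)) m)
      op = proj₁ occs
      oq = proj₂ occs

    contradictory : ⊥
    contradictory = contradiction (linear {p = 1} {q = 0} 1 (bound ⊕ mid-count) (ring Mid n)) (λ ())
      where
      ring : ∀ m n → 1 + (3 + m + n) + 1 ≡ 0 + (n + (m + 5))
      ring = solve-∀
      three : # τ ≤ 3
      three = ≤-≡-trans (∑-mono or) (trans (∑-mark (κ x) _) (cong suc (∑-marks (κ y) (κ z))))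
        where
        or : ∀ k → ⟦ τ k ⟧ ≤ ⟦ κ x == k ⟧ + (⟦ κ y == k ⟧ + ⟦ κ z == k ⟧)
        or k with κ x == k | κ y == k
        ... | true  | _     = s≤s z≤n
        ... | false | true  = s≤s z≤n
        ... | false | false = ≤-refl
      bound : n ≤ 3 + Mid
      bound = begin
        n ≡⟨ count-all τ-all ⟨
        ∑ (λ v → ⟦ τ (κ v) ⟧) ≤⟨ proj₂ (proj₂ comps) τ ⟩
        # τ + Sp (classCalls mid κ τ) [] L
          ≤⟨ three ⊕ Sp-mono [] L (allS [] L (λ p (a , b) q _ → ≤-≡-trans (*-monoʳ-≤ ⟦ mid p (a , b) q ⟧ (⟦⟧≤1 (τ (κ a)))) (*-identityʳ _))) ⟩
        3 + Mid ∎
        where open ≤-Reasoning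

  absurd : ⊥
  absurd =
    let (x , x-quiet) = quiet
        (y , y-first) = first-partner x [] L
        (z , z-last) = last-partner x [] L
    in Confined.contradictory x x-quiet (components mid [] L) y y-first z z-last

-- The bound increases by two per vertex, exactly the number of calls saved by deleting one.
gossip-bound : ∀ n {L : List (Call n)} → Complete L → 2 * n ≤ length L + 4
gossip-bound zero    complete = z≤n
gossip-bound (suc n) {L} complete with unloop L
... | L₁ , loopfree , shorter , keep with any? (λ x → hears? x L₁)
...   | yes (x , h) = let (L₂ , complete₂ , len) = delete-vertex (λ x y → keep (complete x y)) h in
        linear 0 (gossip-bound n complete₂ ⊕ ≤-reflexive (sym len) ⊕ shorter) (ring n (length L₂) (length L₁) (length L))
    where
    ring : ∀ n l₂ l₁ l → 2 * suc n + (l₂ + 4 + l₁ + l) + 0 ≡ l + 4 + (2 * n + (2 + l₂) + l₁)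
    ring = solve-∀
...   | no noho = ≮⇒≥ λ lt → Few.absurd (λ x y → keep (complete x y)) loopfree (λ x h → noho (x , h))
        (linear 0 (lt ⊕ shorter) (ring (length L₁) (length L) (2 * suc n)))
    where
    ring : ∀ l₁ l m → l₁ + 5 + (m + l) + 0 ≡ m + (suc (l + 4) + l₁)
    ring = solve-∀

-- Pendant and universal vertices

csum : ∀ {n} → (Call n → ℕ) → List (Call n) → ℕ
csum f []      = 0
csum f (c ∷ L) = f c + csum f L

Sp-csum : ∀ {n} (f : Call n → ℕ) pre L → Sp (λ _ c _ → f c) pre L ≡ csum f L
Sp-csum f pre []      = refl
Sp-csum f pre (c ∷ L) = cong (f c +_) (Sp-csum f (pre ++ c ∷ []) L)

csum-++ : ∀ {n} (f : Call n → ℕ) L L′ → csum f (L ++ L′) ≡ csum f L + csum f L′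
csum-++ f []      L′ = refl
csum-++ f (c ∷ L) L′ = trans (cong (f c +_) (csum-++ f L L′)) (sym (+-assoc (f c) _ _))

csum-∑ : ∀ {n m} (f : Fin m → Call n → ℕ) L → csum (λ c → ∑ (λ v → f v c)) L ≡ ∑ (λ v → csum (f v) L)
csum-∑ {m = m} f []      = sym (∑-zero m)
csum-∑ {m = m} f (c ∷ L) = trans (cong (∑ (λ v → f v c) +_) (csum-∑ f L)) (sym (∑-distrib-+ (λ v → f v c) (λ v → csum (f v) L)))

callsOf : ∀ {n} → Fin n → List (Call n) → ℕ
callsOf v = csum (λ c → ⟦ inc v c ⟧)

callsOf-0 : ∀ {n} {v : Fin n} L → callsOf v L ≡ 0 → occ v L ≡ false
callsOf-0 []      _ = refl
callsOf-0 {v = v} (c ∷ L) eq with inc v c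
... | false = callsOf-0 L eq

occ-callsOf : ∀ {n} {v : Fin n} L → occ v L ≡ true → 1 ≤ callsOf v L
occ-callsOf {v = v} (c ∷ L) o with inc v c
... | true  = s≤s z≤n
... | false = occ-callsOf L o

handshake-calls : ∀ {n} {L : List (Call n)} → LoopFree L → ∑ (λ v → callsOf v L) ≡ length L + length L
handshake-calls {L = L} lf = trans (sym (csum-∑ (λ v c → ⟦ inc v c ⟧) L)) (go L lf)
  where
  two : ∀ {n} {a b : Fin n} → a ≢ b → ∑ (λ v → ⟦ inc v (a , b) ⟧) ≡ 2
  two {a = a} {b} ne = trans (∑-cong or) (∑-marks a b)
    where
    or : ∀ v → ⟦ inc v (a , b) ⟧ ≡ ⟦ a == v ⟧ + ⟦ b == v ⟧
    or v rewrite ==-sym v a | ==-sym v b with a ≟ v | b ≟ v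
    ... | yes refl | yes refl = contradiction refl ne
    ... | yes _    | no _     = refl
    ... | no _     | _        = refl
  go : ∀ L → LoopFree L → csum (λ c → ∑ (λ v → ⟦ inc v c ⟧)) L ≡ length L + length L
  go []      []        = refl
  go (c ∷ L) (ne ∷ lf) = trans (cong₂ _+_ (two ne) (go L lf)) (cong suc (sym (+-suc (length L) (length L))))

all-but-one : ∀ {n} {K : Fin n → Bool} u → (∀ v → v ≢ u → K v ≡ true) → n ≤ 1 + # K
all-but-one {n} {K} u all = begin
  n ≡⟨ trans (∑-const n 1) (*-identityʳ n) ⟨
  ∑ {n} (λ _ → 1) ≤⟨ ∑-mono pointwise ⟩
  ∑ (λ v → ⟦ u == v ⟧ + ⟦ K v ⟧) ≡⟨ ∑-mark u _ ⟩
  1 + # K ∎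
  where
  open ≤-Reasoning
  pointwise : ∀ v → 1 ≤ ⟦ u == v ⟧ + ⟦ K v ⟧
  pointwise v with u ≟ v
  ... | yes _ = s≤s z≤n
  ... | no ne = ≤-reflexive (sym (true⇒⟦⟧ (all v (ne ∘ sym))))

module Pendant {n} {p q : List (Call n)} {c u a} (complete : Complete (p ++ c ∷ q)) (j : Joins c u a)
  (op : occ u p ≡ false) (oq : occ u q ≡ false) where

  -- `u` learns everything in its single call, so `a` has to know it before.
  gather : ∀ w → w ≢ u → p ⊢ w ⇝ a
  gather w w≢u with unappend p (complete w u)
  ... | y , before , after with hop-inv after
  ...   | inj₁ r with idle-end oq r
  ...     | refl = contradiction (idle-end op before) w≢u
  gather w w≢u | y , before , after | inj₂ (v , j′ , r) with idle-end oq r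
  ...     | refl with joins-unique (joins-sym j′) j
  ...       | refl = before

  broadcast : ∀ w → w ≢ u → q ⊢ a ⇝ w
  broadcast w w≢u with unappend p (complete u w)
  ... | y , before , after with idle-start op before
  ...   | refl with hop-inv after
  ...     | inj₁ r = contradiction (idle-start oq r) w≢u
  ...     | inj₂ (v , j′ , r) = start-≡ (joins-unique j′ j) r

  -- Gathering at `a` takes n - 2 calls before `c`, and broadcasting from `a` takes n - 2 after it.
  pendant-bound : 2 * n ≤ length (p ++ c ∷ q) + 3
  pendant-bound = linear 0 (before ⊕ after ⊕ ≤-reflexive (sym (length-++ p {c ∷ q}))) (ring n (length p) (length q) (length (p ++ c ∷ q)))
    where
    open ≤-Reasoning
    ring : ∀ n p q l → 2 * n + (2 + p + (2 + q) + l) + 0 ≡ l + 3 + (n + n + (p + suc q))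
    ring = solve-∀
    unit : ∀ (g : List (Call n) → Call n → List (Call n) → Bool) L → tally g L ≤ length L
    unit g L = ≤-≡-trans (Sp-mono [] L (allS [] L (λ p c q _ → ⟦⟧≤1 (g p c q)))) (Sp-1 [] L)
    before : n ≤ 2 + length p
    before = begin
      n ≤⟨ all-but-one u (λ w ne → dec-true (reach? p w a) (gather w ne)) ⟩
      1 + # tells a p ≤⟨ s≤s (collect-growth a (λ _ → true) [] p) ⟩
      1 + (∑ (λ v → ⟦ v == a ⟧) + tally (collects a) p)
        ≤⟨ s≤s (≤-reflexive (trans (∑-cong (λ v → cong ⟦_⟧ (==-sym v a))) (∑-δ a)) ⊕ unit (collects a) p) ⟩
      2 + length p ∎
    after : n ≤ 2 + length q
    after = begin
      n ≤⟨ all-but-one u (λ w ne → dec-true (reach? q a w) (broadcast w ne)) ⟩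
      1 + # knows a q ≤⟨ s≤s (spread-growth a (λ _ → true) [] q) ⟩
      1 + (∑ (λ v → ⟦ a == v ⟧) + tally (spreads a) q)
        ≤⟨ s≤s (≤-reflexive (∑-δ a) ⊕ unit (spreads a) q) ⟩
      2 + length q ∎

  private
    used-end : ∀ {L : List (Call n)} {s t} → s ≢ t → L ⊢ s ⇝ t → occ t L ≡ true
    used-end {L} {s} {t} ne r with occ t L in o
    ... | true  = refl
    ... | false = contradiction (idle-end o r) ne

    used-start : ∀ {L : List (Call n)} {s t} → s ≢ t → L ⊢ s ⇝ t → occ s L ≡ true
    used-start {L} {s} {t} ne r with occ s L in o
    ... | true  = refl
    ... | false = contradiction (sym (idle-start o r)) ne

  -- Everybody else gives before `c` and receives after it. The vertex `a` makes `c` itself and, as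
  -- n > 2, hears from a third vertex before.
  two-calls : 2 < n → ∀ v → v ≢ u → 2 ≤ callsOf v (p ++ c ∷ q)
  two-calls n>2 v v≢u = ≤-≡-trans counted (sym (csum-++ _ p (c ∷ q)))
    where
    counted : 2 ≤ callsOf v p + callsOf v (c ∷ q)
    counted with v ≟ a
    ... | no v≢a = occ-callsOf p (used-start v≢a (gather v v≢u))
                     ⊕ occ-callsOf (c ∷ q) (∨-trueʳ (inc v c) (used-end (v≢a ∘ sym) (broadcast v v≢u)))
    ... | yes refl with any? (λ w → ¬? (w ≟ u) ×-dec ¬? (w ≟ v))
    ...   | yes (w , w≢u , w≢v) = occ-callsOf p (used-end w≢v (gather w w≢u)) ⊕ occ-callsOf (c ∷ q) (occ-at [] {q} (joins-sym j))
    ...   | no ¬w = contradiction n>2 (≤⇒≯ (≤-≡-trans (all-but-one {K = λ w → v == w} u only) (cong suc (∑-δ v))))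
      where
      only : ∀ w → w ≢ u → (v == w) ≡ true
      only w w≢u with v ≟ w
      ... | yes _ = refl
      ... | no ne = contradiction (w , w≢u , ne ∘ sym) ¬w

pendant-split : ∀ {n} {u : Fin n} L → callsOf u L ≡ 1 → ∃₂ λ p q → ∃₂ λ c a → L ≡ p ++ c ∷ q × Joins c u a × occ u p ≡ false × occ u q ≡ false
pendant-split {u = u} (c ∷ L) eq with inc u c in i
... | true  = let (a , j) = inc-joins c i in [] , L , c , a , refl , j , refl , callsOf-0 L (suc-injective eq)
... | false = let (p , q , c′ , a , eq′ , j , op , oq) = pendant-split L eq in
      c ∷ p , q , c′ , a , cong (c ∷_) eq′ , j , trans (cong (_∨ occ u p) i) op , oq

met : ∀ {n} → Fin n → Fin n → List (Call n) → Bool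
met c v []      = false
met c v (e ∷ L) = (inc c e ∧ inc v e) ∨ met c v L

threshold : ∀ {n} {P : List (Call n) → Set} → (∀ L → Dec (P L)) → ∀ p L → ¬ P p → P (p ++ L) →
  ∃ λ p′ → ∃₂ λ e q → p′ ++ e ∷ q ≡ p ++ L × ¬ P p′ × P (p′ ++ e ∷ [])
threshold {P = P} P? p []      ¬Pp Pall = contradiction (subst P (++-identityʳ p) Pall) ¬Pp
threshold {P = P} P? p (e ∷ L) ¬Pp Pall with P? (p ++ e ∷ [])
... | yes Pe = p , e , L , refl , ¬Pp , Pe
... | no ¬Pe = let (p′ , e′ , q , eq , r) = threshold P? (p ++ e ∷ []) L ¬Pe (subst P (sym (++-assoc p (e ∷ []) L)) Pall) in
      p′ , e′ , q , trans eq (++-assoc p (e ∷ []) L) , r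

module _ {n} (c : Fin n) (κ : Fin n → Fin n) {L : List (Call n)}
  (κ-constant : ∀ {p e q u v} → p ++ e ∷ q ≡ L → Joins e u v → inc c e ≡ false → κ u ≡ κ v) where

  -- Calls without `c` stay inside a component, so information that changes component has been at
  -- `c`.
  through : ∀ p {q u w} → p ++ q ≡ L → q ⊢ u ⇝ w → κ u ≢ κ w → ∃₂ λ q₁ q₂ → q ≡ q₁ ++ q₂ × q₁ ⊢ u ⇝ c × q₂ ⊢ c ⇝ w
  through p eq done ne = contradiction refl ne
  through p eq (skip {e} r) ne =
    let (q₁ , q₂ , eq′ , r₁ , r₂) = through (p ++ e ∷ []) (trans (++-assoc p (e ∷ []) _) eq) r ne
    in e ∷ q₁ , q₂ , cong (e ∷_) eq′ , skip r₁ , r₂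
  through p eq (hop {e} {q} j r) ne with inc c e in i
  ... | true with joins-cases (proj₂ (inc-joins {v = c} e i)) j
  ...   | inj₁ (refl , _) = [] , e ∷ q , refl , done , hop j r
  ...   | inj₂ (_ , refl) = e ∷ [] , q , refl , hop j done , r
  through p eq (hop {e} j r) ne | false =
    let (q₁ , q₂ , eq′ , r₁ , r₂) = through (p ++ e ∷ []) (trans (++-assoc p (e ∷ []) _) eq) r (ne ∘ trans (κ-constant eq j i))
    in e ∷ q₁ , q₂ , cong (e ∷_) eq′ , hop j r₁ , r₂

-- Let P be the shortest prefix by which everybody's information has reached c, and let s be the last
-- to reach it. Outside the component of s in the calls avoiding c, information from s must travel
-- through c after P; those vertices need two forests of calls, one within P and one after it.
module Universal {n} {L : List (Call n)} (complete : Complete L) (c : Fin n)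
  (meets : ∀ w → w ≢ c → met c w L ≡ true) {p e q} (L≡ : p ++ e ∷ q ≡ L) (s : Fin n) (s-late : ¬ p ⊢ s ⇝ c)
  (all-early : ∀ w → p ++ e ∷ [] ⊢ w ⇝ c) (comps : Components (λ _ e _ → not (inc c e)) [] L) where

  κ = proj₁ comps
  P = p ++ e ∷ []

  P++q : P ++ q ≡ L
  P++q = trans (++-assoc p (e ∷ []) q) L≡

  α β : Fin n → Bool
  α v = (κ s == κ v) ∧ not (c == v)
  β v = not (κ s == κ v) ∧ not (c == v)

  κ-const : ∀ {p e q u v} → p ++ e ∷ q ≡ L → Joins e u v → inc c e ≡ false → κ u ≡ κ v
  κ-const {p} refl j i with allS-at [] p (proj₁ (proj₂ comps))
  κ-const refl (inj₁ refl) i | h = h (cong not i)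
  κ-const refl (inj₂ refl) i | h = sym (h (cong not i))

  -- The information of `s` reaches `w` through `c`, but it is not at `c` before the call `e`; hence
  -- its second leg runs within `q`.
  late : ∀ w → κ s ≢ κ w → q ⊢ c ⇝ w
  late w ne with through c κ (λ {p} → κ-const {p}) [] refl (complete s w) ne
  ... | l₁ , l₂ , eq , r₁ , r₂ with compare-splits l₁ (trans (sym eq) (sym L≡))
  ...   | inj₁ (k , refl) = contradiction (r₁ +⇝+ stay k) s-late
  ...   | inj₂ (k , _ , refl) = stay k +⇝+ r₂

  inA inB : Call n → Bool
  inA (a , b) = α a ∨ α b
  inB (a , b) = β a ∨ β b

  γ : Call n → ℕ
  γ e = ⟦ inB e ⟧

  sizes : # α + # β + 1 ≡ n
  sizes = begin
    # α + # β + 1 ≡⟨ cong₂ _+_ (sym (∑-distrib-+ (λ v → ⟦ α v ⟧) (λ v → ⟦ β v ⟧))) (sym (∑-δ c)) ⟩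
    ∑ (λ v → ⟦ α v ⟧ + ⟦ β v ⟧) + ∑ (λ v → ⟦ c == v ⟧) ≡⟨ ∑-distrib-+ (λ v → ⟦ α v ⟧ + ⟦ β v ⟧) _ ⟨
    ∑ (λ v → ⟦ α v ⟧ + ⟦ β v ⟧ + ⟦ c == v ⟧) ≡⟨ ∑-cong (λ v → one (κ s == κ v) (c == v)) ⟩
    ∑ {n} (λ _ → 1) ≡⟨ trans (∑-const n 1) (*-identityʳ n) ⟩
    n ∎
    where
    open ≡-Reasoning
    one : ∀ k t → ⟦ k ∧ not t ⟧ + ⟦ not k ∧ not t ⟧ + ⟦ t ⟧ ≡ 1
    one true  true  = refl
    one true  false = refl
    one false true  = refl
    one false false = refl

  β-c : ∀ v → β v ∧ (v == c) ≡ false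
  β-c v rewrite ==-sym v c with κ s == κ v | c == v
  ... | true  | true  = refl
  ... | true  | false = refl
  ... | false | true  = refl
  ... | false | false = refl

  private
    ∧-⟦⟧≤ : ∀ s t → ⟦ s ∧ t ⟧ ≤ ⟦ s ⟧
    ∧-⟦⟧≤ true  t = ⟦⟧≤1 t
    ∧-⟦⟧≤ false t = z≤n

    β-≢ : ∀ {v} → β v ≡ true → κ s ≢ κ v
    β-≢ {v} b eq rewrite eq | ==-refl (κ v) = contradiction b (λ ())

    restrict : ∀ {g : Fin n → Bool} → (∀ v → β v ≡ true → g v ≡ true) → ∀ v → ⟦ β v ⟧ ≡ ⟦ β v ∧ g v ⟧
    restrict h v with β v in b
    ... | true  = sym (true⇒⟦⟧ (h v b))
    ... | false = refl

  -- Read backwards from the end of `P`, the vertices of `β` whose information gets to `c` grow from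
  -- none to all, by at most one per call touching `β`.
  B-early : # β ≤ csum γ P
  B-early = begin
    # β ≡⟨ ∑-cong (restrict (λ v _ → dec-true (reach? P v c) (all-early v))) ⟩
    ∑ (λ v → ⟦ β v ∧ tells c P v ⟧) ≤⟨ collect-growth c β [] P ⟩
    ∑ (λ v → ⟦ β v ∧ (v == c) ⟧) + Sp (λ p (a , b) q → ⟦ (β a ∨ β b) ∧ collects c p (a , b) q ⟧) [] P
      ≤⟨ ≤-reflexive (count-none β-c) ⊕ Sp-mono [] P (allS [] P (λ p (a , b) q _ → ∧-⟦⟧≤ (β a ∨ β b) _)) ⟩
    Sp (λ _ e _ → γ e) [] P ≡⟨ Sp-csum _ [] P ⟩
    csum γ P ∎
    where open ≤-Reasoning

  B-late : # β ≤ csum γ q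
  B-late = begin
    # β ≡⟨ ∑-cong (restrict (λ v b → dec-true (reach? q c v) (late v (β-≢ b)))) ⟩
    ∑ (λ v → ⟦ β v ∧ knows c q v ⟧) ≤⟨ spread-growth c β [] q ⟩
    ∑ (λ v → ⟦ β v ∧ (c == v) ⟧) + Sp (λ p (a , b) q → ⟦ (β a ∨ β b) ∧ spreads c p (a , b) q ⟧) [] q
      ≤⟨ ≤-reflexive (count-none (λ v → trans (cong (β v ∧_) (==-sym c v)) (β-c v))) ⊕ Sp-mono [] q (allS [] q (λ p (a , b) q _ → ∧-⟦⟧≤ (β a ∨ β b) _)) ⟩
    Sp (λ _ e _ → γ e) [] q ≡⟨ Sp-csum _ [] q ⟩
    csum γ q ∎
    where open ≤-Reasoning

  A-connected : # α ≤ 1 + csum (λ (a , b) → ⟦ not (inc c (a , b)) ⟧ * ⟦ κ s == κ a ⟧) L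
  A-connected = begin
    # α ≤⟨ ∑-mono (λ v → ∧-⟦⟧≤ (κ s == κ v) _) ⟩
    ∑ (λ v → ⟦ κ s == κ v ⟧) ≤⟨ proj₂ (proj₂ comps) (κ s ==_) ⟩
    ∑ (λ k → ⟦ κ s == k ⟧) + Sp (λ _ (a , b) _ → ⟦ not (inc c (a , b)) ⟧ * ⟦ κ s == κ a ⟧) [] L ≡⟨ cong₂ _+_ (∑-δ (κ s)) (Sp-csum _ [] L) ⟩
    1 + csum (λ (a , b) → ⟦ not (inc c (a , b)) ⟧ * ⟦ κ s == κ a ⟧) L ∎
    where open ≤-Reasoning

  α-c : α c ≡ false
  α-c rewrite ==-refl c with κ s == κ c
  ... | true  = refl
  ... | false = refl

  -- `c` calls everybody, and each of its calls reaches at most one vertex of `α`.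
  A-spokes : # α ≤ csum (λ e → ⟦ inc c e ∧ inA e ⟧) L
  A-spokes = begin
    # α ≡⟨ ∑-cong linked ⟩
    # K L ≤⟨ backward-growth K old [] L ⟩
    # K [] + Sp (backwardGain K) [] L
      ≤⟨ ≤-reflexive (count-none (λ v → ∧-zeroʳ (α v))) ⊕ Sp-mono [] L (allS [] L pointwise) ⟩
    Sp (λ _ e _ → ⟦ inc c e ∧ inA e ⟧) [] L ≡⟨ Sp-csum _ [] L ⟩
    csum (λ e → ⟦ inc c e ∧ inA e ⟧) L ∎
    where
    open ≤-Reasoning
    K : List (Call n) → Fin n → Bool
    K l v = α v ∧ met c v l
    linked : ∀ v → ⟦ α v ⟧ ≡ ⟦ K L v ⟧
    linked v with α v in a
    ... | false = refl
    ... | true  = sym (true⇒⟦⟧ (meets v (λ { refl → not-both a α-c })))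
    old : ∀ a b q v → v ≢ a → v ≢ b → K ((a , b) ∷ q) v ≡ true → K q v ≡ true
    old a b q v v≢a v≢b k rewrite ==-≢ v≢a | ==-≢ v≢b | ∧-zeroʳ ((c == a) ∨ (c == b)) = k
    same : ∀ k → ⟦ k ∧ not k ⟧ ≡ 0
    same true  = refl
    same false = refl
    only : ∀ t k l → ⟦ (t ∧ k) ∧ l ⟧ ≤ ⟦ t ⟧
    only true  k l = ⟦⟧≤1 _
    only false k l = z≤n
    pointwise : ∀ p e q → p ++ e ∷ q ≡ L → backwardGain K p e q ≤ ⟦ inc c e ∧ inA e ⟧
    pointwise p (a , b) q eq = by (c ≟ a) (c ≟ b)
      where
      by : Dec (c ≡ a) → Dec (c ≡ b) → backwardGain K p (a , b) q ≤ ⟦ inc c (a , b) ∧ inA (a , b) ⟧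
      by (yes refl) _ rewrite ==-refl c | ∧-zeroʳ (κ s == κ c) = only (α b) _ _
      by (no c≢a) (yes refl) rewrite ==-≢ c≢a | ==-refl c | ∧-zeroʳ (κ s == κ c) | ∨-identityʳ ((κ s == κ a) ∧ true) =
        ≡-≤-trans (+-identityʳ _) (only ((κ s == κ a) ∧ true) _ _)
      by (no c≢a) (no c≢b) = ≡-≤-trans (cong₂ _+_ (unchanged a) (unchanged b)) z≤n
        where
        unchanged : ∀ v → ⟦ K ((a , b) ∷ q) v ∧ not (K q v) ⟧ ≡ 0
        unchanged v = trans (cong (λ t → ⟦ (α v ∧ ((t ∧ inc v (a , b)) ∨ met c v q)) ∧ not (K q v) ⟧)
          (cong₂ _∨_ (==-≢ c≢a) (==-≢ c≢b))) (same (K q v))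

  -- A call without `c` has both ends in `α` or both in `β`; a call of `c` has at most one end
  -- outside `c`.
  disjoint : ∀ p e q → p ++ e ∷ q ≡ L →
    ⟦ not (inc c e) ⟧ * ⟦ κ s == κ (proj₁ e) ⟧ + ⟦ inc c e ∧ inA e ⟧ + ⟦ inB e ⟧ ≤ 1
  disjoint p (a , b) q eq = by (c ≟ a) (c ≟ b)
    where
    excl : ∀ k t → ⟦ k ∧ t ⟧ + ⟦ not k ∧ t ⟧ ≤ 1
    excl true  true  = ≤-refl
    excl true  false = z≤n
    excl false true  = ≤-refl
    excl false false = z≤n
    by : Dec (c ≡ a) → Dec (c ≡ b) → ⟦ not (inc c (a , b)) ⟧ * ⟦ κ s == κ a ⟧ + ⟦ inc c (a , b) ∧ inA (a , b) ⟧ + ⟦ inB (a , b) ⟧ ≤ 1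
    by (yes refl) _ rewrite ==-refl c | ∧-zeroʳ (κ s == κ c) | ∧-zeroʳ (not (κ s == κ c)) = excl (κ s == κ b) (not (c == b))
    by (no c≢a) (yes refl) rewrite ==-≢ c≢a | ==-refl c | ∧-zeroʳ (κ s == κ c) | ∧-zeroʳ (not (κ s == κ c))
      | ∨-identityʳ ((κ s == κ a) ∧ true) | ∨-identityʳ (not (κ s == κ a) ∧ true) = excl (κ s == κ a) true
    by (no c≢a) (no c≢b) rewrite ==-≢ c≢a | ==-≢ c≢b
      | sym (κ-const {p} eq (inj₁ refl) (cong₂ _∨_ (==-≢ c≢a) (==-≢ c≢b))) with κ s == κ a
    ... | true  = ≤-refl
    ... | false = ≤-refl

  -- The three disjoint kinds of calls number at least |α| - 1, |α| and 2|β|, and |α| + |β| = n - 1.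
  bound : 2 * n ≤ length L + 3
  bound = linear 0 (B-early ⊕ B-late ⊕ A-connected ⊕ A-spokes ⊕ ≤-reflexive (sym (csum-++ γ P q)) ⊕ total ⊕ (n≤ ⊕ n≤))
      (ring n _ (# β) (csum γ P) (csum γ q) (csum γ (P ++ q)) (csum f₁ L) (csum f₂ L) (length L))
    where
    f₁ f₂ : Call n → ℕ
    f₁ (a , b) = ⟦ not (inc c (a , b)) ⟧ * ⟦ κ s == κ a ⟧
    f₂ e = ⟦ inc c e ∧ inA e ⟧
    n≤ : n ≤ # α + # β + 1
    n≤ = ≤-reflexive (sym sizes)
    ring : ∀ n A B bP bq bL x y l → 2 * n + (bP + bq + (1 + x) + y + bL + l + (A + B + 1 + (A + B + 1))) + 0
      ≡ l + 3 + (B + B + A + A + (bP + bq) + (x + y + bL) + (n + n))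
    ring = solve-∀
    total : csum f₁ L + csum f₂ L + csum γ (P ++ q) ≤ length L
    total = begin
      csum f₁ L + csum f₂ L + csum γ (P ++ q) ≡⟨ cong (λ l → csum f₁ L + csum f₂ L + csum γ l) P++q ⟩
      csum f₁ L + csum f₂ L + csum γ L ≡⟨ cong₂ _+_ (cong₂ _+_ (Sp-csum f₁ [] L) (Sp-csum f₂ [] L)) (Sp-csum γ [] L) ⟨
      Sp (λ _ e _ → f₁ e) [] L + Sp (λ _ e _ → f₂ e) [] L + Sp (λ _ e _ → γ e) [] L
        ≡⟨ trans (cong (_+ Sp (λ _ e _ → γ e) [] L) (sym (Sp-+ (λ _ e _ → f₁ e) (λ _ e _ → f₂ e) [] L))) (sym (Sp-+ (λ _ e _ → f₁ e + f₂ e) (λ _ e _ → γ e) [] L)) ⟩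
      Sp (λ _ e _ → f₁ e + f₂ e + γ e) [] L ≤⟨ Sp-mono [] L (allS [] L disjoint) ⟩
      Sp (λ _ _ _ → 1) [] L ≡⟨ Sp-1 [] L ⟩
      length L ∎
      where open ≤-Reasoning

universal-bound : ∀ {n} {L : List (Call n)} → Complete L → ∀ c → (∀ w → w ≢ c → met c w L ≡ true) →
  2 * n ≤ length L + 3
universal-bound {n} {L} complete c meets with all? (λ w → reach? [] w c)
-- If `c` knows everything before any call, then `c` is the only vertex.
... | yes trivial = ≤-trans (*-monoʳ-≤ 2 n≤1) (≤-trans (n≤1+n 2) (m≤n+m 3 (length L)))
  where
  n≤1 : n ≤ 1
  n≤1 = ≡-≤-trans (sym (count-all (λ w → dec-true (c ≟ w) (sym (only (trivial w)))))) (≤-reflexive (∑-δ c))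
    where
    only : ∀ {w} → [] ⊢ w ⇝ c → w ≡ c
    only done = refl
... | no ¬trivial with threshold (λ l → all? (λ w → reach? l w c)) [] L ¬trivial (λ w → complete w c)
...   | p , e , q , L≡ , ¬early , early with ¬∀⟶∃¬ n _ (λ w → reach? p w c) ¬early
...     | s , s-late =
  Universal.bound complete c meets L≡ s s-late early (components (λ _ e _ → not (inc c e)) [] L)

-- Temporal graphs as sequences of calls

members : ∀ {n} → (Fin n → Bool) → List (Fin n)
members {zero}  S = []
members {suc n} S = (if S zero then zero ∷_ else id) (map suc (members (S ∘ suc)))

∈-members : ∀ {n} (S : Fin n → Bool) {v} → S v ≡ true → v ∈ members S
∈-members S {zero}  Sv rewrite Sv = here refl
∈-members S {suc v} Sv with S zero
... | true  = there (∈-map⁺ suc (∈-members (S ∘ suc) Sv))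
... | false = ∈-map⁺ suc (∈-members (S ∘ suc) Sv)

all-members : ∀ {n} (S : Fin n → Bool) → All (λ v → S v ≡ true) (members S)
all-members {zero}  S = []
all-members {suc n} S with S zero in eq
... | true  = eq ∷ all-map⁺ (all-members (S ∘ suc))
... | false = all-map⁺ (all-members (S ∘ suc))

csum-map : ∀ {m n} (f : Call n → ℕ) (g : Fin m → Call n) (S : Fin m → Bool) → csum f (map g (members S)) ≡ ∑ (λ v → ⟦ S v ⟧ * f (g v))
csum-map {zero}  f g S = refl
csum-map {suc m} f g S with S zero | trans (cong (csum f) (sym (map-∘ {g = g} (members (S ∘ suc))))) (csum-map f (g ∘ suc) (S ∘ suc))
... | true  | rest = cong₂ _+_ (sym (+-identityʳ _)) rest
... | false | rest = rest

csum-lift : ∀ {n} (f : Call (suc n) → ℕ) (L : List (Call n)) → csum f (map (Product.map suc suc) L) ≡ csum (f ∘ Product.map suc suc) L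
csum-lift f []      = refl
csum-lift f (c ∷ L) = cong (f (Product.map suc suc c) +_) (csum-lift f L)

csum-↭ : ∀ {n} (f : Call n → ℕ) {L L′} → L ↭ L′ → csum f L ≡ csum f L′
csum-↭ f ↭-refl          = refl
csum-↭ f (↭-prep c p)    = cong (f c +_) (csum-↭ f p)
csum-↭ f (↭-swap c c′ p) = trans (cong (λ t → f c + (f c′ + t)) (csum-↭ f p)) (shuffle (f c) (f c′) _)
  where
  shuffle : ∀ a b t → a + (b + t) ≡ b + (a + t)
  shuffle = solve-∀
csum-↭ f (↭-trans p q)   = trans (csum-↭ f p) (csum-↭ f q)

edgeList : ∀ {n} → Graph n → List (Call n)
edgeList {zero}  G = []
edgeList {suc n} G = map (λ v → zero , suc v) (members (λ v → adj G zero (suc v))) ++ map (Product.map suc suc) (edgeList (behead G))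

edgeList-adj : ∀ {n} (G : Graph n) → All (λ (a , b) → adj G a b ≡ true) (edgeList G)
edgeList-adj {zero}  G = []
edgeList-adj {suc n} G = all-++⁺ (all-map⁺ (all-members (λ v → adj G zero (suc v)))) (all-map⁺ (edgeList-adj (behead G)))

∈-edgeList : ∀ {n} (G : Graph n) u v → adj G u v ≡ true → ∃ λ c → c ∈ edgeList G × Joins c u v
∈-edgeList {suc n} G zero    zero    e = contradiction (irrefl G zero) (not-both e)
∈-edgeList {suc n} G zero    (suc v) e = _ , ∈-++⁺ˡ (∈-map⁺ _ (∈-members (λ v → adj G zero (suc v)) e)) , inj₁ refl
∈-edgeList {suc n} G (suc u) zero    e = _ , ∈-++⁺ˡ (∈-map⁺ _ (∈-members (λ v → adj G zero (suc v)) (adj-flip G e))) , inj₂ refl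
∈-edgeList {suc n} G (suc u) (suc v) e with ∈-edgeList (behead G) u v e
... | c , m , inj₁ refl = _ , ∈-++⁺ʳ _ (∈-map⁺ _ m) , inj₁ refl
... | c , m , inj₂ refl = _ , ∈-++⁺ʳ _ (∈-map⁺ _ m) , inj₂ refl

edgeList-deg : ∀ {n} (G : Graph n) v → callsOf v (edgeList G) ≡ deg G v
edgeList-deg {suc n} G v = trans (csum-++ f (map (λ v → zero , suc v) (members S)) _)
    (trans (cong₂ _+_ (csum-map f (λ v → zero , suc v) S) (csum-lift f (edgeList (behead G)))) (at v))
  where
  f = λ c → ⟦ inc v c ⟧
  S = λ v → adj G zero (suc v)
  at : ∀ v → ∑ (λ u → ⟦ S u ⟧ * ⟦ inc v (zero , suc u) ⟧) + csum (λ c → ⟦ inc v (Product.map suc suc c) ⟧) (edgeList (behead G)) ≡ deg G v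
  at zero = trans (cong₂ _+_ (∑-cong (λ u → *-identityʳ ⟦ S u ⟧)) (none (edgeList (behead G)))) (trans (+-identityʳ _) (sym (deg-zero G)))
    where
    none : ∀ (L : List (Call n)) → csum (λ c → ⟦ inc zero (Product.map suc suc c) ⟧) L ≡ 0
    none []      = refl
    none (c ∷ L) = none L
  at (suc v) = trans (cong₂ _+_ (trans (∑-cong (λ u → *-comm ⟦ S u ⟧ ⟦ v == u ⟧)) (∑-pick v (λ u → ⟦ S u ⟧))) (edgeList-deg (behead G) v)) (sym (deg-suc G v))

met-∈ : ∀ {n} {L : List (Call n)} {c w e} → e ∈ L → Joins e c w → met c w L ≡ true
met-∈ {L = e ∷ L} {c} {w} (here refl) j rewrite joins-inc j | joins-inc (joins-sym j) = refl
met-∈ {L = e ∷ L} {c} {w} (there m)   j = ∨-trueʳ (inc c e ∧ inc w e) (met-∈ m j)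

module _ {n} {G : Graph n} {lab : Labeling n} (lab-sym : ∀ u v → adj G u v ≡ true → lab u v ≡ lab v u) where

  -- Consecutive edges of a path share a vertex and are distinct, so properness makes the labels
  -- increase strictly.
  path⇒walk : IsProper G lab → ∀ {x y} → TemporalPath G lab x y → Walk G lab 0 x y
  path⇒walk proper path = subst₂ (Walk G lab 0) start end (go k p (λ i j → distinct) edges monotone 0 (λ _ → z≤n))
    where
    open TemporalPath path
    go : ∀ k (p : Fin (suc k) → Fin n) → (∀ i j → p i ≡ p j → i ≡ j) →
      (edges : ∀ (i : Fin k) → adj G (p (inject₁ i)) (p (suc i)) ≡ true) →
      (∀ (i j : Fin k) → i ≤ᶠ j → lab (p (inject₁ i)) (p (suc i)) ≤ lab (p (inject₁ j)) (p (suc j))) →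
      ∀ s → (∀ (i : Fin k) → s ≤ lab (p (inject₁ i)) (p (suc i))) → Walk G lab s (p zero) (p (fromℕ k))
    go zero    p inj edges mono s lo = stop
    go (suc k) p inj edges mono s lo = step (edges zero) (lo zero)
        (go k (p ∘ suc) (λ i j eq → sucᶠ-injective (inj (suc i) (suc j) eq)) (edges ∘ suc) (λ i j le → mono (suc i) (suc j) (s≤s le)) _ strict)
      where
      strict : ∀ (i : Fin k) → lab (p zero) (p (suc zero)) < lab (p (suc (inject₁ i))) (p (suc (suc i)))
      strict zero = ≤∧≢⇒< (mono zero (suc zero) z≤n)
        (λ eq → proper (p (suc zero)) (p zero) (p (suc (suc zero))) (adj-flip G (edges zero)) (edges (suc zero))
          (λ same → contradiction (inj zero (suc (suc zero)) same) (λ ())) (trans (sym (lab-sym _ _ (edges zero))) eq))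
      strict (suc i) = <-≤-trans (strict zero) (mono (suc zero) (suc (suc i)) (s≤s z≤n))

  private
    key : Call n → ℕ
    key (a , b) = lab a b

    key-joins : ∀ {c u v} → adj G u v ≡ true → Joins c u v → key c ≡ lab u v
    key-joins e (inj₁ refl) = refl
    key-joins e (inj₂ refl) = sym (lab-sym _ _ e)

    Covered : ∀ {s x y} → List (Call n) → Walk G lab s x y → Set
    Covered L stop = ⊤
    Covered {x = x} L (step {z} e lo w) = (∃ λ c → c ∈ L × Joins c x z) × Covered L w

    cover : ∀ {L} → (∀ u v → adj G u v ≡ true → ∃ λ c → c ∈ L × Joins c u v) → ∀ {s x y} (w : Walk G lab s x y) → Covered L w
    cover all stop          = tt
    cover all (step e lo w) = all _ _ e , cover all w

    drop-head : ∀ {c L s x y} (w : Walk G lab s x y) → key c < s → Covered (c ∷ L) w → Covered L w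
    drop-head stop          lt _ = tt
    drop-head (step e lo w) lt ((c , here refl , j) , cov) =
      contradiction (key-joins e j) (<⇒≢ (<-≤-trans lt lo))
    drop-head (step e lo w) lt ((c , there m , j) , cov) = (c , m , j) , drop-head w (m≤n⇒m≤1+n (<-≤-trans lt lo)) cov

  -- The head of the sorted list is the next edge of the walk, or its label is no larger than that
  -- edge's and the walk never needs it again. Strictness makes the order among equal labels
  -- irrelevant.
  walk⇒⇝ : ∀ L → AllPairs (λ c c′ → key c ≤ key c′) L → ∀ {s x y} (w : Walk G lab s x y) → Covered L w → L ⊢ x ⇝ y
  walk⇒⇝ L       sorted          stop          cov = stay L
  walk⇒⇝ (c ∷ L) (least ∷ sorted) (step e lo w) ((c′ , here refl , j) , cov) =
    hop j (walk⇒⇝ L sorted w (drop-head w (s≤s (≤-reflexive (key-joins e j))) cov))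
  walk⇒⇝ (c ∷ L) (least ∷ sorted) (step e lo w) ((c′ , there m , j) , cov) =
    skip (walk⇒⇝ L sorted (step e lo w) ((c′ , m , j) ,
      drop-head w (s≤s (≤-≡-trans (All.lookup least m) (key-joins e j))) cov))

  record Schedule : Set where
    field
      list     : List (Call n)
      complete : Complete list
      loopfree : LoopFree list
      degrees  : ∀ v → callsOf v list ≡ deg G v
      joined   : ∀ c w → adj G c w ≡ true → met c w list ≡ true

  schedule : IsProper G lab → TemporallyConnected G lab → Schedule
  schedule proper connected = record
    { list = L
    ; complete = λ x y → let w = path⇒walk proper (connected x y) in walk⇒⇝ L sorted w (cover all w)
    ; loopfree = All.map (λ {(a , b)} → adj-≢ G {a} {b}) (All-resp-↭ (↭-sym (sort-↭ (edgeList G))) (edgeList-adj G))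
    ; degrees = λ v → trans (csum-↭ _ (sort-↭ (edgeList G))) (edgeList-deg G v)
    ; joined = λ c w e → let (_ , m , j) = all c w e in met-∈ m j }
    where
    order = On.decTotalOrder ≤-decTotalOrder key
    open Sort order using (sort; sort-↭; sort-↗)
    L = sort (edgeList G)
    sorted : AllPairs (λ c c′ → key c ≤ key c′) L
    sorted = Sorted⇒AllPairs (DecTotalOrder.totalOrder order) (sort-↗ (edgeList G))
    all : ∀ u v → adj G u v ≡ true → ∃ λ c → c ∈ L × Joins c u v
    all u v e = let (c , m , j) = ∈-edgeList G u v e in c , ∈-resp-↭ (↭-sym (sort-↭ (edgeList G))) m , j

-- The numerical condition and its necessity

at-fromℕ< : ∀ {n} (d : Fin n → ℕ) {i} (i<n : i < n) → d at i ≡ d (fromℕ< i<n)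
at-fromℕ< {n} d {i} i<n with suc i ≤? n
... | yes _ = refl
... | no ≰  = contradiction i<n ≰

module _ {n} (d : Fin n → ℕ) (non-increasing : NonIncreasing d) where

  at≤ : ∀ {i} u → i < n → toℕ u ≤ i → d at i ≤ d u
  at≤ u i<n le = ≡-≤-trans (at-fromℕ< d i<n) (non-increasing u _ (≤-≡-trans le (sym (toℕ-fromℕ< i<n))))

  ≤at : ∀ {i} u → i < n → i ≤ toℕ u → d u ≤ d at i
  ≤at u i<n le = ≤-≡-trans (non-increasing _ u (≡-≤-trans (toℕ-fromℕ< i<n) le)) (sym (at-fromℕ< d i<n))

n∸1<n : ∀ {n} → 1 ≤ n → n ∸ 1 < n
n∸1<n {suc n} _ = ≤-refl

n∸2<n : ∀ {n} → 2 ≤ n → n ∸ 2 < n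
n∸2<n {suc (suc n)} _ = s≤s (n≤1+n n)
n∸2<n {suc zero} (s≤s ())

toℕ≤n∸1 : ∀ {n} (u : Fin n) → toℕ u ≤ n ∸ 1
toℕ≤n∸1 {suc n} u = ≤-pred (toℕ<n u)

Condition : (n : ℕ) → (Fin n → ℕ) → Set
Condition n d = (seqSum d + 8 ≡ 4 * n × d at 0 + 1 < n × 2 ≤ d at (n ∸ 1))
  ⊎ (4 * n ≤ seqSum d + 6 × (n ≤ 2 ⊎ (2 < n × 2 ≤ d at (n ∸ 2) × 1 ≤ d at (n ∸ 1))))

module Necessity {n} {G : Graph n} {lab : Labeling n} {lab-sym : ∀ u v → adj G u v ≡ true → lab u v ≡ lab v u}
  (S : Schedule {G = G} {lab} lab-sym) where

  open Schedule S

  l = length list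

  total : ∑ (deg G) ≡ l + l
  total = trans (∑-cong (λ v → sym (degrees v))) (handshake-calls loopfree)

  not-isolated : 2 ≤ n → ∀ v → 1 ≤ deg G v
  not-isolated n≥2 v with any? (λ w → ¬? (v ≟ w))
  ... | yes (w , v≢w) = ≤-≡-trans (occ-callsOf list busy) (degrees v)
    where
    busy : occ v list ≡ true
    busy with occ v list in o
    ... | true  = refl
    ... | false = contradiction (sym (idle-start o (complete v w))) v≢w
  ... | no ¬w = contradiction (≤-trans n≥2 (≤-≡-trans (all-but-one {K = λ _ → false} v (λ w ne → contradiction (w , ne ∘ sym) ¬w)) (cong suc (∑-zero n)))) (λ { (s≤s ()) })

  leaf-bound : ∀ u → deg G u ≡ 1 → 2 * n ≤ l + 3
  leaf-bound u one with pendant-split {u = u} list (trans (degrees u) one)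
  ... | p , q , c , a , eq , j , op , oq = subst (λ L → 2 * n ≤ length L + 3) (sym eq)
        (Pendant.pendant-bound (subst Complete eq complete) j op oq)

  unique-leaf : 2 < n → ∀ u → deg G u ≡ 1 → ∀ v → v ≢ u → 2 ≤ deg G v
  unique-leaf n>2 u one v v≢u with pendant-split {u = u} list (trans (degrees u) one)
  ... | p , q , c , a , eq , j , op , oq = ≤-≡-trans (Pendant.two-calls (subst Complete eq complete) j op oq n>2 v v≢u)
        (trans (cong (callsOf v) (sym eq)) (degrees v))

  dominating-bound : ∀ c → n ≤ deg G c + 1 → 2 * n ≤ l + 3
  dominating-bound c big = universal-bound complete c (λ w w≢c → joined c w (adjacent w w≢c))
    where
    adjacent : ∀ w → w ≢ c → adj G c w ≡ true
    adjacent w w≢c with adj G c w in e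
    ... | true  = refl
    ... | false = contradiction fewer (≤⇒≯ big)
      where
      pointwise : ∀ v → ⟦ adj G c v ⟧ + (⟦ c == v ⟧ + ⟦ w == v ⟧) ≤ 1
      pointwise v with c ≟ v | w ≟ v
      ... | yes refl | yes refl = contradiction refl w≢c
      ... | yes refl | no _     rewrite irrefl G c = ≤-refl
      ... | no _     | yes refl rewrite e = ≤-refl
      ... | no _     | no _     = ≡-≤-trans (+-identityʳ _) (⟦⟧≤1 (adj G c v))
      fewer : deg G c + 1 < n
      fewer = ≡-≤-trans (trans (sym (+-suc (deg G c) 1)) (trans (cong (deg G c +_) (sym (∑-marks c w)))
          (sym (∑-distrib-+ (λ v → ⟦ adj G c v ⟧) _))))
        (≤-≡-trans (∑-mono pointwise) (trans (∑-const n 1) (*-identityʳ n)))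

  conclude : (d : Fin n → ℕ) → NonIncreasing d → (∀ u → deg G u ≡ d u) → Condition n d
  conclude d noninc d≡ = by (l + l + 8 ℕ.≟ 4 * n)
    where
    s≡ : seqSum d ≡ l + l
    s≡ = trans (sum-allFin d) (trans (∑-cong (λ u → sym (d≡ u))) total)
    gossip : 2 * n ≤ l + 4
    gossip = gossip-bound n complete
    by : Dec (l + l + 8 ≡ 4 * n) → Condition n d
    -- For m = 2n - 4 a dominating vertex or a leaf would contradict the bound m ≥ 2n - 3.
    by (yes tight) = inj₁ (trans (cong (_+ 8) s≡) tight , ≰⇒> low , ≰⇒> leafless)
      where
      no-slack : ¬ (2 * n ≤ l + 3)
      no-slack le = contradiction (linear {p = 1} {q = 0} 1 (le ⊕ le ⊕ ≤-reflexive tight) (ring l n)) (λ ())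
        where
        ring : ∀ l n → 1 + (l + 3 + (l + 3) + 4 * n) + 1 ≡ 0 + (2 * n + 2 * n + (l + l + 8))
        ring = solve-∀
      n≥2 : 2 ≤ n
      n≥2 = *-cancelˡ-≤ 4 (≤-≡-trans (m≤n+m 8 (l + l)) tight)
      n≥1 = ≤-trans (s≤s z≤n) n≥2
      low : ¬ (n ≤ d at 0 + 1)
      low le = no-slack (dominating-bound (fromℕ< n≥1) (≤-≡-trans le (cong (_+ 1) (trans (at-fromℕ< d n≥1) (sym (d≡ _))))))
      last = fromℕ< (n∸1<n n≥1)
      leafless : ¬ (d at (n ∸ 1) ≤ 1)
      leafless le = no-slack (leaf-bound last (≤-antisym (≡-≤-trans (trans (d≡ last) (sym (at-fromℕ< d (n∸1<n n≥1)))) le) (not-isolated n≥2 last)))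
    by (no slack) = inj₂ (enough , shape (n ≤? 2))
      where
      enough : 4 * n ≤ seqSum d + 6
      enough = subst (λ t → 4 * n ≤ t + 6) (sym s≡) (≡-≤-trans (ring₁ n) (≤-≡-trans (half ⊕ half) (ring₂ l)))
        where
        ring₁ : ∀ n → 4 * n ≡ 2 * n + 2 * n
        ring₁ = solve-∀
        ring₂ : ∀ l → l + 3 + (l + 3) ≡ l + l + 6
        ring₂ = solve-∀
        ring₃ : ∀ l → l + l + 8 ≡ l + 4 + (l + 4)
        ring₃ = solve-∀
        half : 2 * n ≤ l + 3
        half = ≤-pred (≤-≡-trans (≤∧≢⇒< gossip (λ eq → slack (trans (ring₃ l) (trans (cong₂ _+_ (sym eq) (sym eq)) (sym (ring₁ n)))))) (+-suc l 3))
      shape : Dec (n ≤ 2) → n ≤ 2 ⊎ (2 < n × 2 ≤ d at (n ∸ 2) × 1 ≤ d at (n ∸ 1))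
      shape (yes small) = inj₁ small
      shape (no large) = inj₂ (n>2 , ≰⇒> second , ≤-≡-trans (not-isolated n≥2 last) (trans (d≡ last) (sym (at-fromℕ< d (n∸1<n n≥1)))))
        where
        n>2 = ≰⇒> large
        n≥2 = <⇒≤ n>2
        n≥1 = ≤-trans (s≤s z≤n) n≥2
        last = fromℕ< (n∸1<n n≥1)
        u = fromℕ< (n∸2<n n≥2)
        n∸2<n∸1 : n ∸ 2 < n ∸ 1
        n∸2<n∸1 = ∸-monoʳ-< (s≤s (s≤s z≤n)) n≥2
        last≢u : last ≢ u
        last≢u eq = <-irrefl (trans (sym (toℕ-fromℕ< (n∸2<n n≥2))) (trans (cong toℕ (sym eq)) (toℕ-fromℕ< (n∸1<n n≥1)))) n∸2<n∸1
        -- Otherwise `u` is a leaf and so is the last vertex, but there is at most one leaf.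
        second : ¬ (d at (n ∸ 2) ≤ 1)
        second le = contradiction (≤-trans (unique-leaf n>2 u one last last≢u)
            (≡-≤-trans (d≡ last) (≤-trans (≤at d noninc last (n∸2<n n≥2) (≤-≡-trans (<⇒≤ n∸2<n∸1) (sym (toℕ-fromℕ< (n∸1<n n≥1))))) le))) (λ { (s≤s ()) })
          where
          one : deg G u ≡ 1
          one = ≤-antisym (≡-≤-trans (trans (d≡ u) (sym (at-fromℕ< d (n∸2<n n≥2)))) le) (not-isolated n≥2 u)

necessary : ∀ n (d : Fin n → ℕ) → NonIncreasing d → TCRealizable d → Condition n d
necessary n d noninc (G , realizes , lab , (lab-sym , _) , proper , connected) =
  Necessity.conclude {G = G} (schedule {G = G} {lab} lab-sym proper connected) d noninc (λ u → trans (sym (degree≡deg G u)) (realizes u))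

-- Sufficiency

unrooted : ∀ q → 4 ≤ q → ∃ (λ core → Plan {q} (λ _ → 3) core × Spare core) →
  ∀ n (d : Fin n → ℕ) → Fin n → (∀ u → 3 ≤ d u) → ∑ d + q ≡ 4 * n → ∃ (Plan d)
unrooted q q≥4 (core , P , spare) n d c d≥3 total =
  let (core′ , P′ , _) = min-degree-3-plan ⊥ q q≥4 (λ _ → core , P , (λ ()) , spare) n d c d≥3 total in core′ , P′

-- m = 2n − 3: the core is a single edge
tight₁-plan : ∀ n (d : Fin n → ℕ) → (∀ u → 2 ≤ d u) → (∀ u → d u + 1 ≤ n) → ∑ d + 6 ≡ 4 * n → ∃ (Plan d)
tight₁-plan = tight-plan 1 (unrooted 6 (m≤m+n 4 2) (_ , K₃₃-plan , suc (suc zero) , suc (suc (suc zero)) , (λ ()) , refl , refl)) (_ , triangle-plan)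

-- m = 2n − 4: the core is a four-cycle
tight₂-plan : ∀ n (d : Fin n → ℕ) → (∀ u → 2 ≤ d u) → (∀ u → d u + 2 ≤ n) → ∑ d + 8 ≡ 4 * n → ∃ (Plan d)
tight₂-plan = tight-plan 2 (unrooted 8 (m≤m+n 4 4) (_ , cube-plan , suc (suc (suc (suc zero))) , suc (suc (suc (suc (suc zero)))) , (λ ()) , refl , refl)) (_ , square-plan)

two-vertices : ∀ (G : Graph 2) → 8 ≤ ∑ (deg G) + 6 → ∃ (Plan (deg G))
two-vertices G enough = _ , plan-cong (λ { zero → one₀ ; (suc zero) → one₁ }) (attach-leaf zero (λ { zero _ → refl }) point-plan)
  where
  bound : ∀ u → deg G u ≤ 1
  bound u = ≤-pred (deg< G u)
  ring : ∀ a b → 1 + (a + (b + 0) + 6 + 1) + 0 ≡ a + (8 + (b + 0))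
  ring = solve-∀
  ring′ : ∀ a b → 1 + (a + (b + 0) + 6 + 1) + 0 ≡ b + (8 + (a + 0))
  ring′ = solve-∀
  one₀ : 1 ≡ deg G zero
  one₀ = ≤-antisym (linear 0 (enough ⊕ +-monoˡ-≤ 0 (bound (suc zero))) (ring (deg G zero) (deg G (suc zero)))) (bound zero)
  one₁ : 1 ≡ deg G (suc zero)
  one₁ = ≤-antisym (linear 0 (enough ⊕ +-monoˡ-≤ 0 (bound zero)) (ring′ (deg G zero) (deg G (suc zero)))) (bound (suc zero))

module Sufficiency {n} (d : Fin n → ℕ) (noninc : NonIncreasing d) (G : Graph n) (d≡ : ∀ u → deg G u ≡ d u) where

  s≡ : seqSum d ≡ ∑ d
  s≡ = sum-allFin d

  ∑≡ : ∑ (deg G) ≡ seqSum d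
  ∑≡ = trans (∑-cong d≡) (sym s≡)

  transfer : ∃ (Plan (deg G)) → TCRealizable d
  transfer (core , P) = plan⇒TC (plan-cong d≡ P)

  case₁ : seqSum d + 8 ≡ 4 * n → d at 0 + 1 < n → 2 ≤ d at (n ∸ 1) → TCRealizable d
  case₁ tight low leafless = plan⇒TC (proj₂ (tight₂-plan n d (λ u → ≤-trans leafless (at≤ d noninc u (n∸1<n n≥1) (toℕ≤n∸1 u)))
      (λ u → ≤-trans (+-monoˡ-≤ 2 (≤at d noninc u n≥1 z≤n)) (≡-≤-trans (+-suc (d at 0) 1) low)) (trans (cong (_+ 8) (sym s≡)) tight)))
    where
    n≥1 = ≤-trans (s≤s z≤n) low

  case₂ : 2 < n → 4 * n ≤ seqSum d + 6 → 2 ≤ d at (n ∸ 2) → 1 ≤ d at (n ∸ 1) → TCRealizable d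
  case₂ n>2 enough second last≥1 = by n>2 (2 ≤? d at (n ∸ 1))
    where
    n≥2 = <⇒≤ n>2
    n≥1 = ≤-trans (s≤s z≤n) n≥2
    enough′ : 4 * n ≤ ∑ (deg G) + 6
    enough′ = subst (λ t → 4 * n ≤ t + 6) (sym ∑≡) enough
    by : 2 < n → Dec (2 ≤ d at (n ∸ 1)) → TCRealizable d
    by _ (yes leafless) = transfer (dense (∑ (deg G) + 6 ℕ.≟ 4 * n))
      where
      d≥2 : ∀ u → 2 ≤ deg G u
      d≥2 u = ≤-trans leafless (≤-≡-trans (at≤ d noninc u (n∸1<n n≥1) (toℕ≤n∸1 u)) (sym (d≡ u)))
      -- Exactly 2n - 3 edges call for an edge as core. By parity any larger number is at least 2n -
      -- 2, and a vertex of largest degree can be the core.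
      dense : Dec (∑ (deg G) + 6 ≡ 4 * n) → ∃ (Plan (deg G))
      dense (yes tight) = tight₁-plan n (deg G) d≥2 (λ u → ≡-≤-trans (+-comm (deg G u) 1) (deg< G u)) tight
      dense (no slack) with handshake G
      ... | m , m≡ = let (core , P , _) = rooted-plan n G c (d≥2 , c-max , room) in core , P
        where
        room : 4 * n ≤ ∑ (deg G) + 4
        room = subst (λ t → 4 * n ≤ t + 4) (sym m≡) (even-bound n m (≤-pred (≤-≡-trans (≤∧≢⇒< enough′ (slack ∘ sym))
          (trans (cong (_+ 6) m≡) (+-suc (m + m) 5)))))
        c = fromℕ< n≥1
        c-max : ∀ u → deg G u ≤ suc (deg G c)
        c-max u = m≤n⇒m≤1+n (≡-≤-trans (d≡ u) (≤-≡-trans (noninc c u (≡-≤-trans (toℕ-fromℕ< n≥1) z≤n)) (sym (d≡ c))))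
    by (s≤s {n = n′} n′≥2) (no leaf) = transfer (leaf-plan n′ G last n′≥2 one others enough′)
      where
      last = fromℕ< (n∸1<n {n} n≥1)
      one : deg G last ≡ 1
      one = trans (d≡ last) (trans (sym (at-fromℕ< d (n∸1<n {n} n≥1))) (≤-antisym (≤-pred (≰⇒> leaf)) last≥1))
      others : ∀ u → u ≢ last → 2 ≤ deg G u
      others u u≢last = ≤-trans second (≤-≡-trans (at≤ d noninc u (n∸2<n n≥2) below-last) (sym (d≡ u)))
        where
        below-last : toℕ u ≤ n ∸ 2
        below-last = ∸-monoˡ-≤ 1 (≤∧≢⇒< (toℕ≤n∸1 u) (λ eq → u≢last (toℕ-injective (trans eq (sym (toℕ-fromℕ< (n∸1<n {n} n≥1)))))))

small-case : ∀ n (d : Fin n → ℕ) (G : Graph n) → (∀ u → deg G u ≡ d u) → n ≤ 2 → 4 * n ≤ ∑ (deg G) + 6 → TCRealizable d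
small-case 0 d G d≡ _ enough = realized d G d≡ (λ _ _ → 0) (λ _ _ → refl) (λ ())
small-case 1 d G d≡ _ enough = plan⇒TC (plan-cong (λ { zero → trans (sym (n<1⇒n≡0 (deg< G zero))) (d≡ zero) }) point-plan)
small-case 2 d G d≡ _ enough = plan⇒TC (plan-cong d≡ (proj₂ (two-vertices G enough)))
small-case (suc (suc (suc n))) d G d≡ (s≤s (s≤s ())) enough

sufficient : ∀ n (d : Fin n → ℕ) → NonIncreasing d → Graphical d → Condition n d → TCRealizable d
sufficient n d noninc (G , realizes) = λ
  { (inj₁ (tight , low , leafless)) → case₁ tight low leafless
  ; (inj₂ (enough , inj₁ small)) → small-case n d G d≡ small (subst (λ t → 4 * n ≤ t + 6) (sym ∑≡) enough)
  ; (inj₂ (enough , inj₂ (n>2 , second , last≥1))) → case₂ n>2 enough second last≥1 }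
  where
  d≡ : ∀ u → deg G u ≡ d u
  d≡ u = trans (sym (degree≡deg G u)) (realizes u)
  open Sufficiency d noninc G d≡

theorem5p1 : (n : ℕ) (d : Fin n → ℕ) → NonIncreasing d → Graphical d →
    (TCRealizable d ⇔
    ((seqSum d + 8 ≡ 4 * n × d at 0 + 1 < n × 2 ≤ d at (n ∸ 1))
    ⊎ (4 * n ≤ seqSum d + 6 ×
    (n ≤ 2 ⊎ (2 < n × 2 ≤ d at (n ∸ 2) × 1 ≤ d at (n ∸ 1))))))
theorem5p1 n d noninc graphical = mk⇔ (necessary n d noninc) (sufficient n d noninc graphical)
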